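{- Let $W_n$ be the Coxeter group of type $B_n$ with $S=\{s_0,\dots,s_{n-1}\}$. The assignment $\partial_i^J\mapsto\partial_{\mathtt a_i^J}$ (and the identification of sequences with subsets $J\subset S$ on objects) defines an isomorphism of $\mathbb Z$-linear categories (algebroids) $$\psi\colon\mathrm{LNC}_B(n)\xrightarrow{\ \sim\ }\mathcal{AD}(W_n,S)$$ from the labeled nilCoxeter algebroid of type $B$ to the atomic subcategory $\mathcal{AD}(W_n,S)$ of the nilCoxeter algebroid of double cosets $\mathcal D(W_n,S)$.
   Context: $W=W_n$ has simple reflections $s_0,\dots,s_{n-1}$ with $m_{s_0s_1}=4$, $m_{s_is_{i+1}}=3$ for $i\ge1$, other pairs commuting; length $\ell$. It acts by permutations $\sigma$ of $X=\{ -n,\dots,n\}$ with $\sigma(-i)=-\sigma(i)$, $s_0=(-1\ 1)$, $s_i=(i\ i{+}1)(-i\ { -i}{ - }1)$. For $I\subset S$, $W_I$ is the parabolic subgroup, $w_I$ its longest element, $\ell(I)=\ell(w_I)$. An $(I,J)$-coset is an element $p\in W_I\backslash W/W_J$ (with $(I,J)$ part of the data), with Bruhat-maximal element $\overline p$. Let $*$ be the $0$-Hecke (star) product on $W$ ($s*w=sw$ if $\ell(sw)>\ell(w)$, else $s*w=w$). For an $(I,J)$-coset $p$ and a $(J,K)$-coset $q$, $p*q=W_I(\overline p*\overline q)W_K$; it is reduced if $\overline p*\overline q=(\overline pw_J^{ -1})\overline q$ with $\ell(\overline p*\overline q)=\ell(\overline p)-\ell(J)+\ell(\overline q)$. $\mathcal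 D(W,S)$ is the $\mathbb Z$-linear category whose objects are the subsets of $S$, with $\mathrm{Hom}(J,I)$ the free $\mathbb Z$-module with basis $\{\partial_p\}$ over $(I,J)$-cosets $p$, and $\partial_p\circ\partial_q=\partial_{p*q}$ if $p*q$ is reduced, $\partial_p\circ\partial_q=0$ otherwise. Atomic cosets: for $J\subset S$ write $S\setminus J=\{s_{d_0},\dots,s_{d_{k-1}}\}$ with $d_0<\dots<d_{k-1}$. For $s=s_{d_i}$, $M=J\cup\{s\}$, $t=w_Msw_M$, let $\mathtt a_i^J$ be the $(M\setminus\{t\},J)$-coset containing $w_M$; these are the atomic cosets. $\mathcal{AD}(W,S)$ is the (non-full) $\mathbb Z$-linear subcategory of $\mathcal D(W,S)$ with all objects, generated by $\partial_p$ for $p$ atomic. $\mathrm{LNC}_B(n)$, $n\ge0$, is the $\mathbb Z$-linear category presented as follows. Objects are the sequences $(n_0,n_1,\dots,n_k)$ of positive integers (with $k\ge 0$ varying) with $\sum n_c=n+1$. These are identified with subsets $J\subset S$: $J$ corresponds to the sizes, in order, of the classes of the equivalence relation on $\{0,1,\dots,n\}$ generated by $j\sim j+1$ whenever $s_j\in J$ (so $n_0$ is the size of the class of $0$). Generating morphisms are $\partial_i^J$ for $0\le i\le k-1$: for $i>0$, $\partial_i^J$ goes from $J\leftrightarrow(n_0,n_1,\dots,n_i,n_{i+1},\dots,n_k)$ to $(n_0,n_1,\dots,n_{i+1},n_i,\dots,n_k)$, while $\partial_0^J$ goes from $J$ to itself. The relations, for every $J$ (whenever the generators involved exist; omitted superscripts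 being the unique ones making compositions well defined), are $\partial_0\partial_1\partial_0\partial_1^J=\partial_1\partial_0\partial_1\partial_0^J$; $\partial_i\partial_{i+1}\partial_i^J=\partial_{i+1}\partial_i\partial_{i+1}^J$ for $1\le i\le k-2$; $\partial_i\partial_j^J=\partial_j\partial_i^J$ for $|i-j|>1$; and $\partial_i\partial_i^J=0$ for $0\le i\le k-1$. -}

module Defs where

open import Level using (0ℓ)
open import Algebra.Bundles.Raw using (RawGroup)
open import Algebra.Morphism.Structures using (module GroupMorphisms)
open import Algebra.Structures using (IsMonoid)
open import Data.Fin.Base using (Fin; toℕ)
open import Data.Fin.Subset using (Subset; inside; outside; _∈_; _∪_; _-_; ⁅_⁆)
open import Data.Fin.Subset.Properties using (_∈?_)
open import Data.List.Base
  using (List; []; _∷_; _++_; length; reverse; replicate; concat; filter; lookup; allFin; sum)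
open import Data.List.Properties using (++-assoc; ++-identityʳ; unfold-reverse)
open import Data.List.Relation.Unary.All using (All)
open import Data.Nat.Base using (ℕ; zero; suc; _+_; _≤_; _<_; _>_; ∣_-_∣; NonZero; z≤n; s≤s)
import Data.Nat.Properties as ℕ
open import Data.Product.Base using (Σ; ∃; _×_; _,_; proj₁; proj₂; Σ-syntax; ∃-syntax)
open import Data.Vec.Base using ([]; _∷_)
open import Function.Definitions using (Bijective)
open import Relation.Binary.Core using (Rel)
open import Relation.Binary.Definitions using (Decidable)
open import Relation.Binary.PropositionalEquality
  using (_≡_; refl; sym; trans; cong; subst)
open import Relation.Nullary using (¬_; Dec; yes; no; ¬?)
open import Relation.Nullary.Decidable using (_×-dec_; map′)

-- As with the library's raw bundles, the laws are not fields.  For a presented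
-- category they hold by construction, and they transport along _≅_.
record Rawℤ-Category : Set₁ where
  infixr 9 _∘_
  field
    Obj : Set
    Hom : Obj → Obj → RawGroup 0ℓ 0ℓ      -- Hom a b : morphisms from a to b

  module Hom {a b} = RawGroup (Hom a b)

  field
    id  : ∀ {a} → Hom.Carrier {a} {a}
    _∘_ : ∀ {a b c} → Hom.Carrier {b} {c} → Hom.Carrier {a} {b} → Hom.Carrier {a} {c}

infix 4 _≅_

record _≅_ (𝒞 𝒟 : Rawℤ-Category) : Set where
  private
    module 𝒞 = Rawℤ-Category 𝒞
    module 𝒟 = Rawℤ-Category 𝒟
  field
    F₀ : 𝒞.Obj → 𝒟.Obj
    F₁ : ∀ {a b} → 𝒞.Hom.Carrier {a} {b} → 𝒟.Hom.Carrier {F₀ a} {F₀ b}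

    F₀-bijective : Bijective _≡_ _≡_ F₀
    F₁-isGroupIsomorphism : ∀ {a b} →
      GroupMorphisms.IsGroupIsomorphism (𝒞.Hom a b) (𝒟.Hom (F₀ a) (F₀ b)) F₁
    F₁-id : ∀ {a} → F₁ (𝒞.id {a}) 𝒟.Hom.≈ 𝒟.id
    F₁-∘  : ∀ {a b c} (f : 𝒞.Hom.Carrier {b} {c}) (g : 𝒞.Hom.Carrier {a} {b}) →
            F₁ (f 𝒞.∘ g) 𝒟.Hom.≈ (F₁ f 𝒟.∘ F₁ g)

-- _≋_ is the least congruence containing R that makes Term a preadditive category.
module Presentation {Obj : Set} (Gen : Obj → Obj → Set) where

  infixr 9 _∘_
  infixl 6 _⊕_

  data Term : Obj → Obj → Set where
    gen : ∀ {a b} → Gen a b → Term a b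
    id  : ∀ {a} → Term a a
    _∘_ : ∀ {a b c} → Term b c → Term a b → Term a c
    0#  : ∀ {a b} → Term a b
    _⊕_ : ∀ {a b} → Term a b → Term a b → Term a b
    ⊖_  : ∀ {a b} → Term a b → Term a b

  module _ (R : ∀ {a b} → Rel (Term a b) 0ℓ) where

    infix 4 _≋_

    data _≋_ : ∀ {a b} → Rel (Term a b) 0ℓ where
      rel : ∀ {a b} {f g : Term a b} → R f g → f ≋ g

      ≋-refl  : ∀ {a b} {f : Term a b} → f ≋ f
      ≋-sym   : ∀ {a b} {f g : Term a b} → f ≋ g → g ≋ f
      ≋-trans : ∀ {a b} {f g h : Term a b} → f ≋ g → g ≋ h → f ≋ h

      ∘-cong    : ∀ {a b c} {f f′ : Term b c} {g g′ : Term a b} →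
                  f ≋ f′ → g ≋ g′ → f ∘ g ≋ f′ ∘ g′
      ∘-assoc   : ∀ {a b c d} (f : Term c d) (g : Term b c) (h : Term a b) →
                  (f ∘ g) ∘ h ≋ f ∘ (g ∘ h)
      identityˡ : ∀ {a b} (f : Term a b) → id ∘ f ≋ f
      identityʳ : ∀ {a b} (f : Term a b) → f ∘ id ≋ f

      ⊕-cong      : ∀ {a b} {f f′ g g′ : Term a b} → f ≋ f′ → g ≋ g′ → f ⊕ g ≋ f′ ⊕ g′
      ⊖-cong      : ∀ {a b} {f f′ : Term a b} → f ≋ f′ → ⊖ f ≋ ⊖ f′
      ⊕-assoc     : ∀ {a b} (f g h : Term a b) → (f ⊕ g) ⊕ h ≋ f ⊕ (g ⊕ h)
      ⊕-comm      : ∀ {a b} (f g : Term a b) → f ⊕ g ≋ g ⊕ f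
      ⊕-identityˡ : ∀ {a b} (f : Term a b) → 0# ⊕ f ≋ f
      ⊖-inverseˡ  : ∀ {a b} (f : Term a b) → (⊖ f) ⊕ f ≋ 0#

      distribˡ : ∀ {a b c} (f : Term b c) (g h : Term a b) → f ∘ (g ⊕ h) ≋ f ∘ g ⊕ f ∘ h
      distribʳ : ∀ {a b c} (h : Term a b) (f g : Term b c) → (f ⊕ g) ∘ h ≋ f ∘ h ⊕ g ∘ h

    presented : Rawℤ-Category
    presented = record
      { Obj = Obj
      ; Hom = λ a b → record
          { Carrier = Term a b ; _≈_ = _≋_ ; _∙_ = _⊕_ ; ε = 0# ; _⁻¹ = ⊖_ }
      ; id  = id
      ; _∘_ = _∘_
      }

-- (n₀,…,n_k), with k = length entries - 1; entries is nonempty by total.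
record Sequence (n : ℕ) : Set where
  field
    entries   : List ℕ
    .positive : All NonZero entries
    .total    : sum entries ≡ suc n

open Sequence public

data Swap : ℕ → Rel (List ℕ) 0ℓ where
  here  : ∀ {x y v} → Swap 0 (x ∷ y ∷ v) (y ∷ x ∷ v)
  there : ∀ {i x v w} → Swap i v w → Swap (suc i) (x ∷ v) (x ∷ w)

-- Step i v w : the generator ∂ᵢ exists at v and has target w.
-- There is at most one such w, and at most one proof of Step i v w.
data Step : ℕ → Rel (List ℕ) 0ℓ where
  fix  : ∀ {x y v} → Step 0 (x ∷ y ∷ v) (x ∷ y ∷ v)
  swap : ∀ {i v w} → Swap (suc i) v w → Step (suc i) v w

infix 4 _⟶[_]_

data _⟶[_]_ {n : ℕ} (a : Sequence n) (i : ℕ) (b : Sequence n) : Set where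
  step : Step i (entries a) (entries b) → a ⟶[ i ] b

module LNC (n : ℕ) where

  open Presentation {Sequence n} (λ a b → Σ[ i ∈ ℕ ] a ⟶[ i ] b) public

  ∂ : ∀ {a b} i → a ⟶[ i ] b → Term a b
  ∂ i e = gen (i , e)

  -- The intermediate objects are determined by the first one.
  data Relation : ∀ {a b} → Rel (Term a b) 0ℓ where
    braid₄ : ∀ {a b c d b′ c′ d′ z}
      (e₁ : a ⟶[ 1 ] b)  (e₂ : b  ⟶[ 0 ] c)  (e₃ : c  ⟶[ 1 ] d)  (e₄ : d  ⟶[ 0 ] z)
      (f₁ : a ⟶[ 0 ] b′) (f₂ : b′ ⟶[ 1 ] c′) (f₃ : c′ ⟶[ 0 ] d′) (f₄ : d′ ⟶[ 1 ] z) →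
      Relation (∂ 0 e₄ ∘ ∂ 1 e₃ ∘ ∂ 0 e₂ ∘ ∂ 1 e₁)
               (∂ 1 f₄ ∘ ∂ 0 f₃ ∘ ∂ 1 f₂ ∘ ∂ 0 f₁)
    braid₃ : ∀ {a b c b′ c′ z} i → 1 ≤ i →
      (e₁ : a ⟶[ i ] b)      (e₂ : b  ⟶[ suc i ] c) (e₃ : c  ⟶[ i ] z)
      (f₁ : a ⟶[ suc i ] b′) (f₂ : b′ ⟶[ i ] c′)    (f₃ : c′ ⟶[ suc i ] z) →
      Relation (∂ i e₃ ∘ ∂ (suc i) e₂ ∘ ∂ i e₁)
               (∂ (suc i) f₃ ∘ ∂ i f₂ ∘ ∂ (suc i) f₁)
    commute : ∀ {a b b′ z} i j → ∣ i - j ∣ > 1 →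
      (e₁ : a ⟶[ j ] b)  (e₂ : b  ⟶[ i ] z)
      (f₁ : a ⟶[ i ] b′) (f₂ : b′ ⟶[ j ] z) →
      Relation (∂ i e₂ ∘ ∂ j e₁) (∂ j f₂ ∘ ∂ i f₁)
    square : ∀ {a b z} i (e₁ : a ⟶[ i ] b) (e₂ : b ⟶[ i ] z) →
      Relation (∂ i e₂ ∘ ∂ i e₁) 0#

  category : Rawℤ-Category
  category = presented Relation

LNC-B : ℕ → Rawℤ-Category
LNC-B n = LNC.category n

-- The sizes, in order, of the classes of the equivalence relation on {0,…,n}
-- generated by j ∼ j+1 for j ∈ J.  Recursion on J removes the point 0, which
-- either lies in the class of 1 or is a class by itself.
classSizes : ∀ {n} → Subset n → List ℕ
classSizes []            = 1 ∷ []
classSizes (inside  ∷ J) = enlargeFirst (classSizes J)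
  where
  enlargeFirst : List ℕ → List ℕ
  enlargeFirst []       = []   -- classSizes is never empty
  enlargeFirst (x ∷ xs) = suc x ∷ xs
classSizes (outside ∷ J) = 1 ∷ classSizes J

-- mA is the Coxeter matrix of the subdiagram s₁, s₂, … of type A, reindexed from 0.
mA : ℕ → ℕ → ℕ
mA zero          zero          = 1
mA zero          (suc zero)    = 3
mA zero          (suc (suc _)) = 2
mA (suc zero)    zero          = 3
mA (suc (suc _)) zero          = 2
mA (suc i)       (suc j)       = mA i j

mB : ℕ → ℕ → ℕ
mB zero          zero          = 1
mB zero          (suc zero)    = 4
mB zero          (suc (suc _)) = 2
mB (suc zero)    zero          = 4
mB (suc (suc _)) zero          = 2
mB (suc i)       (suc j)       = mA i j

module CoxeterGroup (n : ℕ) where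

  infix  4 _≈_ _∈⟨_⟩
  infixl 7 _·_
  infix  8 _⁻¹

  -- W = ⟨ S ∣ (s t)^{m s t} = 1 ⟩ with S = {s₀,…,sₙ₋₁} = Fin n.  As s² = 1 is
  -- among the relations, words in S suffice.
  W : Set
  W = List (Fin n)

  pattern ε = []

  _·_ : W → W → W
  _·_ = _++_

  _⁻¹ : W → W
  _⁻¹ = reverse

  ⟦_⟧ : Fin n → W
  ⟦ s ⟧ = s ∷ []

  data _≈_ : Rel W 0ℓ where
    order   : ∀ s t → concat (replicate (mB (toℕ s) (toℕ t)) (s ∷ t ∷ [])) ≈ ε
    ≈-refl  : ∀ {w} → w ≈ w
    ≈-sym   : ∀ {v w} → v ≈ w → w ≈ v
    ≈-trans : ∀ {u v w} → u ≈ v → v ≈ w → u ≈ w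
    ·-cong  : ∀ {v v′ w w′} → v ≈ v′ → w ≈ w′ → v · w ≈ v′ · w′

  _∈⟨_⟩ : W → Subset n → Set
  w ∈⟨ I ⟩ = ∃[ v ] All (_∈ I) v × v ≈ w

  -- x ∼[ I , J ] y : the cosets W_I x W_J and W_I y W_J coincide; equivalently,
  -- y is an element of W_I x W_J.  An (I,J)-coset is an element of W up to this
  -- relation.
  infix 4 _∼[_,_]_

  _∼[_,_]_ : W → Subset n → Subset n → W → Set
  x ∼[ I , J ] y = ∃[ u ] ∃[ v ] u ∈⟨ I ⟩ × v ∈⟨ J ⟩ × u · x · v ≈ y

  IsReflection : W → Set
  IsReflection t = ∃[ w ] ∃[ s ] t ≈ w · ⟦ s ⟧ · w ⁻¹

  data Bruhat (ℓ : W → ℕ) : Rel W 0ℓ where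
    reflexive : ∀ {v w} → v ≈ w → Bruhat ℓ v w
    ascend    : ∀ {u v t} → Bruhat ℓ u v → IsReflection t → ℓ v < ℓ (v · t) →
                ∀ {w} → v · t ≈ w → Bruhat ℓ u w

  -- The defining properties in this record determine ℓ, and determine _*_, w₀
  -- and max up to _≈_: the associative product _*_ is computed from a reduced
  -- word of its left factor.
  record Calculus : Set where
    infixl 7 _*_
    infix  4 _≤ᴮ_
    field
      ℓ          : W → ℕ
      ℓ-attained : ∀ w → ∃[ v ] v ≈ w × length v ≡ ℓ w
      ℓ-minimal  : ∀ {v w} → v ≈ w → ℓ w ≤ length v

      _*_       : W → W → W
      *-monoid  : IsMonoid _≈_ _*_ ε
      *-ascent  : ∀ s w → ℓ w < ℓ (⟦ s ⟧ · w) → ⟦ s ⟧ * w ≈ ⟦ s ⟧ · w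
      *-descent : ∀ s w → ¬ ℓ w < ℓ (⟦ s ⟧ · w) → ⟦ s ⟧ * w ≈ w

      w₀         : Subset n → W
      w₀-∈       : ∀ I → w₀ I ∈⟨ I ⟩
      w₀-longest : ∀ I {u} → u ∈⟨ I ⟩ → ℓ u ≤ ℓ (w₀ I)

    _≤ᴮ_ : Rel W 0ℓ
    _≤ᴮ_ = Bruhat ℓ

    field
      max    : Subset n → Subset n → W → W
      max-∈  : ∀ I J p → p ∼[ I , J ] max I J p
      max-≤ᴮ : ∀ I J p {x} → p ∼[ I , J ] x → x ≤ᴮ max I J p

  s·s≈ε : ∀ s → ⟦ s ⟧ · ⟦ s ⟧ ≈ ε
  s·s≈ε s = subst (λ m → concat (replicate m (s ∷ s ∷ [])) ≈ ε) (mB-diagonal (toℕ s)) (order s s)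
    where
    mA-diagonal : ∀ i → mA i i ≡ 1
    mA-diagonal zero          = refl
    mA-diagonal (suc zero)    = refl
    mA-diagonal (suc (suc i)) = mA-diagonal (suc i)

    mB-diagonal : ∀ i → mB i i ≡ 1
    mB-diagonal zero          = refl
    mB-diagonal (suc zero)    = refl
    mB-diagonal (suc (suc i)) = mA-diagonal (suc i)

  ≡⇒≈ : ∀ {v w} → v ≡ w → v ≈ w
  ≡⇒≈ refl = ≈-refl

  inverseˡ : ∀ w → w ⁻¹ · w ≈ ε
  inverseˡ []      = ≈-refl
  inverseˡ (s ∷ w) =
    ≈-trans (≡⇒≈ (trans (cong (_++ s ∷ w) (unfold-reverse s w)) (++-assoc (reverse w) ⟦ s ⟧ (s ∷ w))))
    (≈-trans (·-cong (≈-refl {w ⁻¹}) (·-cong (s·s≈ε s) (≈-refl {w})))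
             (inverseˡ w))

  inverseʳ : ∀ w → w · w ⁻¹ ≈ ε
  inverseʳ []      = ≈-refl
  inverseʳ (s ∷ w) =
    ≈-trans (≡⇒≈ (trans (cong ((s ∷ w) ++_) (unfold-reverse s w))
                         (cong (s ∷_) (sym (++-assoc w (reverse w) ⟦ s ⟧)))))
    (≈-trans (·-cong (≈-refl {⟦ s ⟧}) (·-cong (inverseʳ w) (≈-refl {⟦ s ⟧})))
             (s·s≈ε s))

module Algebroid {n : ℕ} (𝒲 : CoxeterGroup.Calculus n) where

  open CoxeterGroup n
  open Calculus 𝒲

  infix 4 _≟_

  _≟_ : Decidable _≈_
  v ≟ w = map′ to from (ℓ (v · w ⁻¹) ℕ.≟ 0)
    where
    to : ℓ (v · w ⁻¹) ≡ 0 → v ≈ w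
    to eq with ℓ-attained (v · w ⁻¹)
    ... | []    , ε≈   , _  =
      ≈-trans (≡⇒≈ (sym (++-identityʳ v)))
      (≈-trans (·-cong (≈-refl {v}) (≈-sym (inverseˡ w)))
      (≈-trans (≡⇒≈ (sym (++-assoc v (w ⁻¹) w)))
               (·-cong (≈-sym ε≈) (≈-refl {w}))))
    ... | _ ∷ _ , _    , len with () ← trans len eq

    from : v ≈ w → ℓ (v · w ⁻¹) ≡ 0
    from v≈w = ℕ.n≤0⇒n≡0
      (ℓ-minimal (≈-sym (≈-trans (·-cong v≈w (≈-refl {w ⁻¹})) (inverseʳ w))))

  -- For p an (I,J)-coset and q a (J,K)-coset.
  module _ (I J K : Subset n) (p q : W) where

    private
      p̄ = max I J p
      q̄ = max J K q

    -- Representative of the (I,K)-coset p * q.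
    _⋆_ : W
    _⋆_ = p̄ * q̄

    -- ℓ (p̄ * q̄) = ℓ p̄ - ℓ (w₀ J) + ℓ q̄, without subtraction.
    IsReduced : Set
    IsReduced = p̄ * q̄ ≈ (p̄ · w₀ J ⁻¹) · q̄
              × ℓ (p̄ * q̄) + ℓ (w₀ J) ≡ ℓ p̄ + ℓ q̄

    isReduced? : Dec IsReduced
    isReduced? = (p̄ * q̄ ≟ (p̄ · w₀ J ⁻¹) · q̄)
           ×-dec (ℓ (p̄ * q̄) + ℓ (w₀ J) ℕ.≟ ℓ p̄ + ℓ q̄)

  -- Morphism J I modulo _≋_ is the free abelian group on the (I,J)-cosets.
  data Morphism (J I : Subset n) : Set where
    ∂   : W → Morphism J I
    0#  : Morphism J I
    _⊕_ : Morphism J I → Morphism J I → Morphism J I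
    ⊖_  : Morphism J I → Morphism J I

  infixl 6 _⊕_
  infix  4 _≋_

  data _≋_ {J I : Subset n} : Rel (Morphism J I) 0ℓ where
    ∂-cong  : ∀ {p q} → p ∼[ I , J ] q → ∂ p ≋ ∂ q

    ≋-refl  : ∀ {f} → f ≋ f
    ≋-sym   : ∀ {f g} → f ≋ g → g ≋ f
    ≋-trans : ∀ {f g h} → f ≋ g → g ≋ h → f ≋ h

    ⊕-cong      : ∀ {f f′ g g′} → f ≋ f′ → g ≋ g′ → f ⊕ g ≋ f′ ⊕ g′
    ⊖-cong      : ∀ {f f′} → f ≋ f′ → ⊖ f ≋ ⊖ f′
    ⊕-assoc     : ∀ f g h → (f ⊕ g) ⊕ h ≋ f ⊕ (g ⊕ h)
    ⊕-comm      : ∀ f g → f ⊕ g ≋ g ⊕ f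
    ⊕-identityˡ : ∀ f → 0# ⊕ f ≋ f
    ⊖-inverseˡ  : ∀ f → (⊖ f) ⊕ f ≋ 0#

  infixr 9 _∘_

  _∘_ : ∀ {I J K} → Morphism J I → Morphism K J → Morphism K I
  _∘_ {I} {J} {K} (∂ p) (∂ q) with isReduced? I J K p q
  ... | yes _ = ∂ (_⋆_ I J K p q)
  ... | no  _ = 0#
  ∂ p ∘ 0#      = 0#
  ∂ p ∘ (g ⊕ h) = (∂ p ∘ g) ⊕ (∂ p ∘ h)
  ∂ p ∘ (⊖ g)   = ⊖ (∂ p ∘ g)
  0#      ∘ h   = 0#
  (f ⊕ g) ∘ h   = (f ∘ h) ⊕ (g ∘ h)
  (⊖ f)   ∘ h   = ⊖ (f ∘ h)

  -- The identity of J is the basis element of the (J,J)-coset W_J.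
  idᴰ : ∀ {J} → Morphism J J
  idᴰ = ∂ ε

  𝒟 : Rawℤ-Category
  𝒟 = record
    { Obj = Subset n
    ; Hom = λ J I → record
        { Carrier = Morphism J I ; _≈_ = _≋_ ; _∙_ = _⊕_ ; ε = 0# ; _⁻¹ = ⊖_ }
    ; id  = idᴰ
    ; _∘_ = _∘_
    }

  -- The list d₀ < d₁ < … < d_{k-1} of the indices of S ∖ J.
  missing : Subset n → List (Fin n)
  missing J = filter (λ s → ¬? (s ∈? J)) (allFin n)

  -- IsAtomic J i I p : there is an i-th atomic coset a at J, it is an
  -- (I,J)-coset, and it equals p.
  IsAtomic : Subset n → ℕ → Subset n → W → Set
  IsAtomic J i I p =
    Σ[ d ∈ Fin (length (missing J)) ]
      let s = lookup (missing J) d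
          M = J ∪ ⁅ s ⁆
      in toℕ d ≡ i
       × ∃[ t ] ⟦ t ⟧ ≈ w₀ M · ⟦ s ⟧ · w₀ M
              × I ≡ M - t
              × p ∼[ I , J ] w₀ M

  data InAD : ∀ {J I} → Morphism J I → Set where
    atomic : ∀ {J I} i {p} → IsAtomic J i I p → InAD (∂ {J} {I} p)
    id∈    : ∀ {J} → InAD (idᴰ {J})
    ∘∈     : ∀ {I J K} {f : Morphism J I} {g : Morphism K J} → InAD f → InAD g → InAD (f ∘ g)
    0∈     : ∀ {J I} → InAD {J} {I} 0#
    ⊕∈     : ∀ {J I} {f g : Morphism J I} → InAD f → InAD g → InAD (f ⊕ g)
    ⊖∈     : ∀ {J I} {f : Morphism J I} → InAD f → InAD (⊖ f)
    resp   : ∀ {J I} {f g : Morphism J I} → f ≋ g → InAD f → InAD g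

  𝒜𝒟 : Rawℤ-Category
  𝒜𝒟 = record
    { Obj = Subset n
    ; Hom = λ J I → record
        { Carrier = Σ (Morphism J I) InAD
        ; _≈_     = λ f g → proj₁ f ≋ proj₁ g
        ; _∙_     = λ (f , f∈) (g , g∈) → f ⊕ g , ⊕∈ f∈ g∈
        ; ε       = 0# , 0∈
        ; _⁻¹     = λ (f , f∈) → ⊖ f , ⊖∈ f∈
        }
    ; id  = idᴰ , id∈
    ; _∘_ = λ (f , f∈) (g , g∈) → f ∘ g , ∘∈ f∈ g∈
    }

  -- ψ is the identification of sequences with subsets on objects, and sends
  -- the generator ∂ᵢ at J to the basis element of the i-th atomic coset at J.
  IsAtomicAssignment : LNC-B n ≅ 𝒜𝒟 → Set
  IsAtomicAssignment ψ =
      (∀ a → classSizes (F₀ a) ≡ entries a)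
    × (∀ {a b} i (e : a ⟶[ i ] b) →
         ∃[ p ] IsAtomic (F₀ a) i (F₀ b) p × proj₁ (F₁ (LNC.∂ n i e)) ≋ ∂ p)
    where open _≅_ ψ

-- Let s₀ negate the first entry of a list of signed values and sᵢ exchange two
-- neighbouring entries.  In this model of type B descents are local, so
-- Matsumoto's theorem is a case check on two adjacent descents.  It solves the
-- word problem of W; the exchange condition follows, then the lifting property
-- of the Bruhat order, and with it the 0-Hecke product and the maxima of double
-- cosets.
--
-- The minimal element x of an atomic coset satisfies W_I x = x W_J: it moves a
-- block of consecutive values past the next block, or replaces the first block
-- by its opposite.  A product of two cosets of this kind is reduced exactly if
-- the lengths of their minimal elements add.  Along a path from J the k blocks
-- form a signed arrangement which evolves like an element of type B_k, and the
-- lengths add exactly if this arrangement ascends.  Hence both the nonzero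
-- monomials of LNC_B(n) with source J (by Matsumoto's theorem for B_k) and the
-- basis elements of 𝒜𝒟 with source J (as distinct arrangements give distinct
-- cosets) are indexed by the elements of type B_k.

module Submission where

-- Two things that the construction needs are not part of the data. Composition in `𝒟` is shown to
-- be associative and unital only on combinations of basis elements whose minimal element x
-- satisfies W_I x = x W_J. These combinations are closed under composition, and there the product
-- is governed by a condition on lengths in W. Moreover the morphism groups of `𝒟` are given by
-- generators and relations, so distinct basis elements are not visibly independent. Faithfulness
-- therefore comes from a linear left inverse, defined by recursion on formal sums. It has to decide
-- whether a double coset comes from a reduced word of type B_k; this is possible because maxima are
-- normal forms of double cosets and reduced words have length at most k². The relations of LNC_B(n)
-- need no calculation inside W: their two sides are monomials of words joined by a braid move, or
-- one side is the monomial of a word that is not reduced. Braid equivalence is kept apart from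
-- cancellation so that its derivations hold in W and in LNC_B(n) alike.

open import Algebra.Bundles using (AbelianGroup; Group)
import Algebra.Properties.AbelianGroup as AbelianGroupProperties
import Algebra.Properties.CommutativeSemigroup as CommutativeSemigroupProperties
import Algebra.Properties.Group as GroupProperties
open import Algebra.Structures using (IsMonoid)
open import Data.Fin.Base using (Fin; zero; suc; toℕ; fromℕ<)
import Data.Fin.Properties as Fin
open import Data.Fin.Subset using (Subset; inside; outside; _∈_; _∉_; _∪_; _─_; _-_; ⁅_⁆; ⊥)
open import Data.Fin.Subset.Properties using (_∈?_; x∈p∧x≢y⇒x∈p-y; x∈p∪q⁺; x∈⁅x⁆; ∪-identityʳ)
open import Data.List.Base using (List; []; _∷_; _++_; length; reverse; map; concatMap; concat; replicate; lookup; filter; allFin)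
open import Data.List.Membership.Propositional using (lose) renaming (_∈_ to _∈ᴸ_)
import Data.List.Membership.Propositional.Properties as Membership
import Data.List.Properties as List
open import Data.List.Relation.Unary.All as All using (All; []; _∷_)
import Data.List.Relation.Unary.All.Properties as All
open import Data.List.Relation.Unary.AllPairs using (AllPairs; []; _∷_)
open import Data.List.Relation.Unary.Any as Any using (Any)
import Data.List.Relation.Unary.Any.Properties as Any
open import Data.List.Relation.Unary.Linked using (Linked; []; [-]; _∷_)
open import Data.Nat.Base using (ℕ; zero; suc; _+_; _∸_; _≤_; _<_; _>_; ∣_-_∣; NonZero; z≤n; s≤s; s≤s⁻¹)
open import Data.Nat.ListAction using (sum)
import Data.Nat.Properties as ℕ
open import Data.Product.Base using (∃; _×_; _,_; proj₁; proj₂; ∃-syntax; Σ-syntax)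
open import Data.Sum.Base using (_⊎_; inj₁; inj₂)
open import Data.Vec.Base using ([]; _∷_) renaming (here to hereᵛ; there to thereᵛ)
open import Function.Base using (_∘_)
open import Level using (0ℓ)
open import Relation.Binary.Core using (Rel)
open import Relation.Binary.Definitions using (tri<; tri≈; tri>)
open import Relation.Binary.PropositionalEquality using (_≡_; _≢_; refl; sym; trans; cong; cong₂; subst; subst₂; module ≡-Reasoning)
import Relation.Binary.Reasoning.Setoid as SetoidReasoning
open import Relation.Nullary using (¬_; ¬?; Dec; yes; no; contradiction; recompute)
open import Relation.Nullary.Decidable using (_×-dec_)
open import Defs

-- Signed permutations

-- The value pos c (resp. neg c) stands for the integer c + 1 (resp. -(c + 1)).
data Value : Set where
  pos neg : ℕ → Value

negate : Value → Value
negate (pos c) = neg c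
negate (neg c) = pos c

magnitude : Value → ℕ
magnitude (pos c) = c
magnitude (neg c) = c

infix 4 _≺_ _≺?_

data _≺_ : Rel Value 0ℓ where
  neg≺pos : ∀ {a b} → neg a ≺ pos b
  pos≺pos : ∀ {a b} → a < b → pos a ≺ pos b
  neg≺neg : ∀ {a b} → b < a → neg a ≺ neg b

_≺?_ : ∀ a b → Dec (a ≺ b)
neg a ≺? pos b = yes neg≺pos
pos a ≺? neg b = no λ ()
pos a ≺? pos b with a ℕ.<? b
... | yes a<b = yes (pos≺pos a<b)
... | no  a≮b = no λ { (pos≺pos a<b) → a≮b a<b }
neg a ≺? neg b with b ℕ.<? a
... | yes b<a = yes (neg≺neg b<a)
... | no  b≮a = no λ { (neg≺neg b<a) → b≮a b<a }

≺-asym : ∀ {a b} → a ≺ b → ¬ b ≺ a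
≺-asym (pos≺pos p) (pos≺pos q) = ℕ.<-asym p q
≺-asym (neg≺neg p) (neg≺neg q) = ℕ.<-asym p q

≺-irrefl : ∀ {a} → ¬ a ≺ a
≺-irrefl p = ≺-asym p p

≺-trans : ∀ {a b c} → a ≺ b → b ≺ c → a ≺ c
≺-trans neg≺pos     (pos≺pos _) = neg≺pos
≺-trans (pos≺pos p) (pos≺pos q) = pos≺pos (ℕ.<-trans p q)
≺-trans (neg≺neg _) neg≺pos     = neg≺pos
≺-trans (neg≺neg p) (neg≺neg q) = neg≺neg (ℕ.<-trans q p)

≺-connex : ∀ a b → a ≢ b → a ≺ b ⊎ b ≺ a
≺-connex (neg a) (pos b) _ = inj₁ neg≺pos
≺-connex (pos a) (neg b) _ = inj₂ neg≺pos
≺-connex (pos a) (pos b) a≢b with ℕ.<-cmp a b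
... | tri< p _ _ = inj₁ (pos≺pos p)
... | tri≈ _ p _ = contradiction (cong pos p) a≢b
... | tri> _ _ p = inj₂ (pos≺pos p)
≺-connex (neg a) (neg b) a≢b with ℕ.<-cmp a b
... | tri< p _ _ = inj₂ (neg≺neg p)
... | tri≈ _ p _ = contradiction (cong neg p) a≢b
... | tri> _ _ p = inj₁ (neg≺neg p)

negate-involutive : ∀ a → negate (negate a) ≡ a
negate-involutive (pos c) = refl
negate-involutive (neg c) = refl

negate-antitone : ∀ {a b} → a ≺ b → negate b ≺ negate a
negate-antitone neg≺pos     = neg≺pos
negate-antitone (pos≺pos p) = neg≺neg p
negate-antitone (neg≺neg p) = pos≺pos p

negate-swapˡ : ∀ {a b} → a ≺ negate b → b ≺ negate a
negate-swapˡ {a} {b} p = subst (_≺ negate a) (negate-involutive b) (negate-antitone p)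

magnitude-negate : ∀ a → magnitude (negate a) ≡ magnitude a
magnitude-negate (pos c) = refl
magnitude-negate (neg c) = refl

swapAt : ∀ {A : Set} → ℕ → List A → List A
swapAt zero    (a ∷ b ∷ v) = b ∷ a ∷ v
swapAt (suc i) (a ∷ v)     = a ∷ swapAt i v
swapAt _       v           = v

act : ℕ → List Value → List Value
act zero    []      = []
act zero    (a ∷ v) = negate a ∷ v
act (suc i) v       = swapAt i v

data AscentAt : ℕ → List Value → Set where
  here  : ∀ {a b v} → a ≺ b → AscentAt zero (a ∷ b ∷ v)
  there : ∀ {i a v} → AscentAt i v → AscentAt (suc i) (a ∷ v)

data Ascent : ℕ → List Value → Set where
  flip : ∀ {c v} → Ascent zero (pos c ∷ v)
  swap : ∀ {i v} → AscentAt i v → Ascent (suc i) v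

-- As `act i` is an involution, a descent of `v` is an ascent of its image. Facts about descents
-- thus become instances of facts about ascents.
Descent : ℕ → List Value → Set
Descent i v = Ascent i (act i v)

swapAt-involutive : ∀ {A : Set} i (v : List A) → swapAt i (swapAt i v) ≡ v
swapAt-involutive zero    []          = refl
swapAt-involutive zero    (a ∷ [])    = refl
swapAt-involutive zero    (a ∷ b ∷ v) = refl
swapAt-involutive (suc i) []          = refl
swapAt-involutive (suc i) (a ∷ v)     = cong (a ∷_) (swapAt-involutive i v)

act-involutive : ∀ i v → act i (act i v) ≡ v
act-involutive zero    []      = refl
act-involutive zero    (a ∷ v) = cong (_∷ v) (negate-involutive a)
act-involutive (suc i) v       = swapAt-involutive i v

act-injective : ∀ i {v w} → act i v ≡ act i w → v ≡ w
act-injective i {v} {w} eq = trans (sym (act-involutive i v)) (trans (cong (act i) eq) (act-involutive i w))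

length-swapAt : ∀ {A : Set} i (v : List A) → length (swapAt i v) ≡ length v
length-swapAt zero    []          = refl
length-swapAt zero    (a ∷ [])    = refl
length-swapAt zero    (a ∷ b ∷ v) = refl
length-swapAt (suc i) []          = refl
length-swapAt (suc i) (a ∷ v)     = cong suc (length-swapAt i v)

length-act : ∀ i v → length (act i v) ≡ length v
length-act zero    []      = refl
length-act zero    (a ∷ v) = refl
length-act (suc i) v       = length-swapAt i v

All-swapAt : ∀ {A : Set} {P : A → Set} i {v} → All P v → All P (swapAt i v)
All-swapAt zero    []          = []
All-swapAt zero    (p ∷ [])    = p ∷ []
All-swapAt zero    (p ∷ q ∷ r) = q ∷ p ∷ r
All-swapAt (suc i) []          = []
All-swapAt (suc i) (p ∷ r)     = p ∷ All-swapAt i r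

module _ {P : Value → Set} (P-negate : ∀ {a} → P a → P (negate a)) where

  All-act : ∀ i {v} → All P v → All P (act i v)
  All-act zero    []      = []
  All-act zero    (p ∷ r) = P-negate p ∷ r
  All-act (suc i) r       = All-swapAt i r

-- Absolute values are compared, since mere distinctness of the entries can be lost when `act zero`
-- negates one of them.
Apart : Rel Value 0ℓ
Apart a b = magnitude a ≢ magnitude b

Apart-sym : ∀ {a b} → Apart a b → Apart b a
Apart-sym p = p ∘ sym

Apart-negateˡ : ∀ a {b} → Apart a b → Apart (negate a) b
Apart-negateˡ a p = p ∘ trans (sym (magnitude-negate a))

Apart⇒≢ : ∀ {a b} → Apart a b → a ≢ b
Apart⇒≢ p refl = p refl

AllPairs-swapAt : ∀ i {v} → AllPairs Apart v → AllPairs Apart (swapAt i v)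
AllPairs-swapAt zero    []                      = []
AllPairs-swapAt zero    (p ∷ [])                = p ∷ []
AllPairs-swapAt zero    {a ∷ b ∷ _} ((p ∷ r) ∷ q ∷ s) = (Apart-sym {a} {b} p ∷ q) ∷ r ∷ s
AllPairs-swapAt (suc i) []                      = []
AllPairs-swapAt (suc i) (r ∷ s)                 = All-swapAt i r ∷ AllPairs-swapAt i s

AllPairs-act : ∀ i {v} → AllPairs Apart v → AllPairs Apart (act i v)
AllPairs-act zero    []      = []
AllPairs-act zero    {a ∷ _} (r ∷ s) = All.map (λ {b} → Apart-negateˡ a {b}) r ∷ s
AllPairs-act (suc i) s       = AllPairs-swapAt i s

-- By the pigeonhole principle these are the signed permutations of 1, ..., k in one-line notation.
record Window (k : ℕ) (v : List Value) : Set where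
  field
    length≡  : length v ≡ k
    bounded  : All (λ a → magnitude a < k) v
    distinct : AllPairs Apart v

open Window public

act-window : ∀ {k} i {v} → Window k v → Window k (act i v)
act-window {k} i {v} W = record
  { length≡  = trans (length-act i v) (length≡ W)
  ; bounded  = All-act (λ {a} → subst (_< k) (sym (magnitude-negate a))) i (bounded W)
  ; distinct = AllPairs-act i (distinct W)
  }

ascentAt? : ∀ i {v} → AllPairs Apart v → suc i < length v → AscentAt i v ⊎ AscentAt i (swapAt i v)
ascentAt? zero    {a ∷ b ∷ v} ((p ∷ _) ∷ _) _ with ≺-connex a b (Apart⇒≢ p)
... | inj₁ a≺b = inj₁ (here a≺b)
... | inj₂ b≺a = inj₂ (here b≺a)
ascentAt? zero    {a ∷ []} _ (s≤s ())
ascentAt? (suc i) {a ∷ v} (_ ∷ s) (s≤s l) with ascentAt? i s l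
... | inj₁ p = inj₁ (there p)
... | inj₂ p = inj₂ (there p)

ascent? : ∀ {k} i {v} → Window k v → i < k → Ascent i v ⊎ Descent i v
ascent? zero {[]} W i<k = contradiction (subst (zero <_) (sym (length≡ W)) i<k) λ ()
ascent? zero {pos c ∷ v} W i<k = inj₁ flip
ascent? zero {neg c ∷ v} W i<k = inj₂ flip
ascent? (suc i) W i<k with ascentAt? i (distinct W) (subst (suc i <_) (sym (length≡ W)) i<k)
... | inj₁ p = inj₁ (swap p)
... | inj₂ p = inj₂ (swap p)

¬ascentAt×descentAt : ∀ {i v} → AscentAt i v → ¬ AscentAt i (swapAt i v)
¬ascentAt×descentAt (here p)  (here q)  = ≺-asym p q
¬ascentAt×descentAt (there p) (there q) = ¬ascentAt×descentAt p q

¬ascent×descent : ∀ {i v} → Ascent i v → ¬ Descent i v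
¬ascent×descent flip     ()
¬ascent×descent (swap p) (swap q) = ¬ascentAt×descentAt p q

-- Inversions as length

indicator : ∀ {P : Set} → Dec P → ℕ
indicator (yes _) = 1
indicator (no  _) = 0

indicator-yes : ∀ {P : Set} (d : Dec P) → P → indicator d ≡ 1
indicator-yes (yes _) _ = refl
indicator-yes (no ¬p) p = contradiction p ¬p

indicator-no : ∀ {P : Set} (d : Dec P) → ¬ P → indicator d ≡ 0
indicator-no (yes p) ¬p = contradiction p ¬p
indicator-no (no  _) _  = refl

indicator-cong : ∀ {P Q : Set} (d : Dec P) (e : Dec Q) → (P → Q) → (Q → P) → indicator d ≡ indicator e
indicator-cong (yes p) e f g = sym (indicator-yes e (f p))
indicator-cong (no ¬p) e f g = sym (indicator-no e (¬p ∘ g))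

-- For integers a, b in this order in the window, the pair contributes
-- [a > b] + [a + b < 0] to the length.
inversions₂ : Value → Value → ℕ
inversions₂ a b = indicator (b ≺? a) + indicator (b ≺? negate a)

inversions₁ : Value → ℕ
inversions₁ (pos _) = 0
inversions₁ (neg _) = 1

inversionsWith : Value → List Value → ℕ
inversionsWith a []      = 0
inversionsWith a (b ∷ v) = inversions₂ a b + inversionsWith a v

inversions : List Value → ℕ
inversions []      = 0
inversions (a ∷ v) = inversions₁ a + (inversionsWith a v + inversions v)

-- Negating `a` exchanges the two summands. Hence `act zero` changes only the contribution
-- `inversions₁` of the first entry.
inversions₂-negate : ∀ a b → inversions₂ (negate a) b ≡ inversions₂ a b
inversions₂-negate a b rewrite negate-involutive a = ℕ.+-comm (indicator (b ≺? negate a)) _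

inversionsWith-negate : ∀ a v → inversionsWith (negate a) v ≡ inversionsWith a v
inversionsWith-negate a []      = refl
inversionsWith-negate a (b ∷ v) = cong₂ _+_ (inversions₂-negate a b) (inversionsWith-negate a v)

x+y+z≡y+x+z : ∀ x y z → x + (y + z) ≡ y + (x + z)
x+y+z≡y+x+z x y z = trans (sym (ℕ.+-assoc x y z)) (trans (cong (_+ z) (ℕ.+-comm x y)) (ℕ.+-assoc y x z))

inversionsWith-swapAt : ∀ a i v → inversionsWith a (swapAt i v) ≡ inversionsWith a v
inversionsWith-swapAt a zero    []          = refl
inversionsWith-swapAt a zero    (b ∷ [])    = refl
inversionsWith-swapAt a zero    (b ∷ c ∷ v) = x+y+z≡y+x+z (inversions₂ a c) (inversions₂ a b) _
inversionsWith-swapAt a (suc i) []          = refl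
inversionsWith-swapAt a (suc i) (b ∷ v)     = cong (inversions₂ a b +_) (inversionsWith-swapAt a i v)

-- The condition a + b < 0 is symmetric, so only the comparison of `a` with `b` changes.
inversions₂-swap : ∀ {a b} → a ≺ b → inversions₂ b a ≡ suc (inversions₂ a b)
inversions₂-swap {a} {b} a≺b
  rewrite indicator-yes (a ≺? b) a≺b | indicator-no (b ≺? a) (≺-asym a≺b)
  = cong suc (indicator-cong (a ≺? negate b) (b ≺? negate a) negate-swapˡ negate-swapˡ)

inversions-swapAt : ∀ {i v} → AscentAt i v → inversions (swapAt i v) ≡ suc (inversions v)
inversions-swapAt {v = a ∷ b ∷ v} (here a≺b) rewrite inversions₂-swap a≺b =
  -- What remains is a permutation of summands.
  trans (cong (inversions₁ b +_) (cong suc (ℕ.+-assoc (inversions₂ a b) _ _)))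
  (trans (ℕ.+-suc (inversions₁ b) _)
  (cong suc
    (trans (cong (λ z → inversions₁ b + (inversions₂ a b + z))
              (x+y+z≡y+x+z (inversionsWith b v) (inversions₁ a) _))
    (trans (cong (inversions₁ b +_) (x+y+z≡y+x+z (inversions₂ a b) (inversions₁ a) _))
    (trans (x+y+z≡y+x+z (inversions₁ b) (inversions₁ a) _)
    (cong (inversions₁ a +_)
      (trans (x+y+z≡y+x+z (inversions₁ b) (inversions₂ a b) _)
      (trans (cong (inversions₂ a b +_)
         (trans (cong (inversions₁ b +_) (x+y+z≡y+x+z (inversionsWith b v) (inversionsWith a v) (inversions v)))
                (x+y+z≡y+x+z (inversions₁ b) (inversionsWith a v) _)))
      (sym (ℕ.+-assoc (inversions₂ a b) _ _))))))))))
inversions-swapAt {suc i} {a ∷ v} (there p)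
  rewrite inversionsWith-swapAt a i v | inversions-swapAt p =
  trans (cong (inversions₁ a +_) (ℕ.+-suc (inversionsWith a v) _)) (ℕ.+-suc (inversions₁ a) _)

inversions-ascent : ∀ {i v} → Ascent i v → inversions (act i v) ≡ suc (inversions v)
inversions-ascent {v = pos c ∷ v} flip = cong (λ z → suc (z + inversions v)) (inversionsWith-negate (pos c) v)
inversions-ascent (swap p) = inversions-swapAt p

inversions-descent : ∀ {i v} → Descent i v → inversions v ≡ suc (inversions (act i v))
inversions-descent {i} {v} d = trans (cong inversions (sym (act-involutive i v))) (inversions-ascent d)

inversions-act-≤ : ∀ {k i v} → Window k v → i < k → inversions (act i v) ≤ suc (inversions v)
inversions-act-≤ {i = i} W i<k with ascent? i W i<k
... | inj₁ p = ℕ.≤-reflexive (inversions-ascent p)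
... | inj₂ p = ℕ.m≤n⇒m≤1+n (ℕ.≤-trans (ℕ.n≤1+n _) (ℕ.≤-reflexive (sym (inversions-descent p))))

range : ℕ → ℕ → List Value
range m zero    = []
range m (suc k) = pos m ∷ range (suc m) k

length-range : ∀ m k → length (range m k) ≡ k
length-range m zero    = refl
length-range m (suc k) = cong suc (length-range (suc m) k)

range-bounded : ∀ m k → All (λ a → magnitude a < m + k) (range m k)
range-bounded m zero    = []
range-bounded m (suc k) = ℕ.m<m+n m (s≤s z≤n)
  ∷ subst (λ z → All (λ a → magnitude a < z) (range (suc m) k)) (sym (ℕ.+-suc m k)) (range-bounded (suc m) k)

range-≻ : ∀ m k {c} → c < m → All (pos c ≺_) (range m k)
range-≻ m zero    c<m = []
range-≻ m (suc k) c<m = pos≺pos c<m ∷ range-≻ (suc m) k (ℕ.m<n⇒m<1+n c<m)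

range-distinct : ∀ m k → AllPairs Apart (range m k)
range-distinct m zero    = []
range-distinct m (suc k) = All.map (λ { (pos≺pos p) → ℕ.<⇒≢ p }) (range-≻ (suc m) k ℕ.≤-refl) ∷ range-distinct (suc m) k

range-window : ∀ k → Window k (range 0 k)
range-window k = record
  { length≡ = length-range 0 k ; bounded = range-bounded 0 k ; distinct = range-distinct 0 k }

range-ascentAt : ∀ m k i → suc i < k → AscentAt i (range m k)
range-ascentAt m (suc (suc k)) zero    _         = here (pos≺pos ℕ.≤-refl)
range-ascentAt m (suc k)       (suc i) (s≤s i<k) = there (range-ascentAt (suc m) k i i<k)
range-ascentAt m (suc zero)    zero    (s≤s ())

range-ascent : ∀ k i → i < k → Ascent i (range 0 k)
range-ascent (suc k) zero    _   = flip
range-ascent k       (suc i) i<k = swap (range-ascentAt 0 k i i<k)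

-- Pigeonhole in its ordered form: the entries increase, start at `m` or later and stay below `m`
-- plus their number, so there is no room for a gap.
increasing⇒range : ∀ m a v → Linked _≺_ (pos a ∷ v) → m ≤ a →
  All (λ b → magnitude b < m + length (pos a ∷ v)) (pos a ∷ v) → pos a ∷ v ≡ range m (length (pos a ∷ v))
increasing⇒range m a [] _ m≤a (a<m+1 ∷ []) =
  cong (λ z → pos z ∷ []) (ℕ.≤-antisym (ℕ.≤-pred (subst (a <_) (ℕ.+-comm m 1) a<m+1)) m≤a)
increasing⇒range m a (pos b ∷ v) (pos≺pos a<b ∷ l) m≤a (_ ∷ bs)
  with increasing⇒range (suc m) b v l (ℕ.≤-trans (s≤s m≤a) a<b)
         (subst (λ z → All (λ b → magnitude b < z) (pos b ∷ v)) (ℕ.+-suc m _) bs)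
... | eq with List.∷-injectiveˡ eq
... | refl = cong₂ _∷_ (cong pos (ℕ.≤-antisym (ℕ.≤-pred a<b) m≤a)) eq

descentAt⊎increasing : ∀ {v} → AllPairs Apart v →
  (∃[ i ] suc i < length v × AscentAt i (swapAt i v)) ⊎ Linked _≺_ v
descentAt⊎increasing [] = inj₂ []
descentAt⊎increasing (_ ∷ []) = inj₂ [-]
descentAt⊎increasing {a ∷ b ∷ v} ((p ∷ _) ∷ s) with ≺-connex a b (Apart⇒≢ p)
... | inj₂ b≺a = inj₁ (0 , s≤s (s≤s z≤n) , here b≺a)
... | inj₁ a≺b with descentAt⊎increasing s
...   | inj₁ (i , i< , q) = inj₁ (suc i , s≤s i< , there q)
...   | inj₂ l = inj₂ (a≺b ∷ l)

-- Without a descent at a positive letter the entries increase; without a descent at letter 0 the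
-- first entry is positive, and so are all. Only the identity is left.
descent⊎range : ∀ {k v} → Window k v → (∃[ i ] i < k × Descent i v) ⊎ v ≡ range 0 k
descent⊎range {k} {v} W with descentAt⊎increasing (distinct W)
... | inj₁ (i , i< , p) = inj₁ (suc i , subst (suc i <_) (length≡ W) i< , swap p)
descent⊎range {k} {[]} record { length≡ = refl } | inj₂ l = inj₂ refl
descent⊎range {k} {neg c ∷ v} record { length≡ = refl } | inj₂ l = inj₁ (0 , s≤s z≤n , flip)
descent⊎range {k} {pos c ∷ v} W@record { length≡ = refl } | inj₂ l =
  inj₂ (increasing⇒range 0 c v l z≤n (bounded W))

Far : Rel ℕ 0ℓ
Far i j = ∣ i - j ∣ > 1

act-swapAt-comm : ∀ i v → act 0 (swapAt (suc i) v) ≡ swapAt (suc i) (act 0 v)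
act-swapAt-comm i []      = refl
act-swapAt-comm i (a ∷ v) = refl

swapAt-comm : ∀ {A : Set} i j → Far i j → (v : List A) → swapAt i (swapAt j v) ≡ swapAt j (swapAt i v)
swapAt-comm (suc i) (suc j) f [] = refl
swapAt-comm (suc i) (suc j) f (a ∷ v) = cong (a ∷_) (swapAt-comm i j f v)
swapAt-comm zero (suc (suc j)) f [] = refl
swapAt-comm zero (suc (suc j)) f (a ∷ []) = refl
swapAt-comm zero (suc (suc j)) f (a ∷ b ∷ v) = refl
swapAt-comm (suc (suc i)) zero f [] = refl
swapAt-comm (suc (suc i)) zero f (a ∷ []) = refl
swapAt-comm (suc (suc i)) zero f (a ∷ b ∷ v) = refl
swapAt-comm zero zero () v
swapAt-comm zero (suc zero) (s≤s ()) v
swapAt-comm (suc zero) zero (s≤s ()) v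

act-comm : ∀ i j → Far i j → ∀ v → act i (act j v) ≡ act j (act i v)
act-comm zero    (suc (suc j)) f v = act-swapAt-comm j v
act-comm (suc (suc i)) zero    f v = sym (act-swapAt-comm i v)
act-comm (suc i) (suc j) f v = swapAt-comm i j f v
act-comm zero zero () v
act-comm zero (suc zero) (s≤s ()) v
act-comm (suc zero) zero (s≤s ()) v

ascentAt-swapAt : ∀ i j → Far i j → ∀ {v} → AscentAt i v → AscentAt i (swapAt j v)
ascentAt-swapAt zero    (suc (suc j)) f (here p)  = here p
ascentAt-swapAt (suc (suc i)) zero    f (there (there p)) = there (there p)
ascentAt-swapAt (suc i) (suc j) f (there p) = there (ascentAt-swapAt i j f p)
ascentAt-swapAt zero zero () p
ascentAt-swapAt zero (suc zero) (s≤s ()) p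
ascentAt-swapAt (suc zero) zero (s≤s ()) p

ascent-act : ∀ i j → Far i j → ∀ {v} → Ascent i v → Ascent i (act j v)
ascent-act zero (suc (suc j)) f flip = flip
ascent-act (suc (suc i)) zero f (swap (there p)) = swap (there p)
ascent-act (suc i) (suc j) f (swap p) = swap (ascentAt-swapAt i j f p)
ascent-act zero zero () p
ascent-act zero (suc zero) (s≤s ()) p
ascent-act (suc zero) zero (s≤s ()) p

swapAt-braid : ∀ {A : Set} i (v : List A) → suc (suc i) < length v →
  swapAt i (swapAt (suc i) (swapAt i v)) ≡ swapAt (suc i) (swapAt i (swapAt (suc i) v))
swapAt-braid zero (a ∷ b ∷ c ∷ v) _ = refl
swapAt-braid (suc i) (a ∷ v) (s≤s l) = cong (a ∷_) (swapAt-braid i v l)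
swapAt-braid zero (a ∷ b ∷ []) (s≤s (s≤s ()))
swapAt-braid zero (a ∷ []) (s≤s ())

act-braid₄ : ∀ v → act 0 (act 1 (act 0 (act 1 v))) ≡ act 1 (act 0 (act 1 (act 0 v)))
act-braid₄ []          = refl
act-braid₄ (a ∷ [])    = refl
act-braid₄ (a ∷ b ∷ v) = refl

-- If i and i + 1 are descents of v, so are all letters along both expressions
-- of the longest element of the rank two subgroup they generate.
swapAt-dihedral : ∀ i {v} → AscentAt i (swapAt i v) → AscentAt (suc i) (swapAt (suc i) v) →
  let v₀ = swapAt i (swapAt (suc i) (swapAt i v)) in
  (AscentAt i v₀ × AscentAt (suc i) (swapAt i v₀)) × (AscentAt (suc i) v₀ × AscentAt i (swapAt (suc i) v₀))
swapAt-dihedral zero {a ∷ b ∷ c ∷ v} (here p) (there (here q)) =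
  (here q , there (here (≺-trans q p))) , (there (here p) , here (≺-trans q p))
swapAt-dihedral (suc i) {a ∷ v} (there p) (there q) with swapAt-dihedral i p q
... | (p₁ , p₂) , q₁ , q₂ = (there p₁ , there p₂) , there q₁ , there q₂
swapAt-dihedral zero {a ∷ b ∷ []} (here p) (there ())

-- Descents at 0 and 1 make the first two entries negative and decreasing, so `v₀` starts with their
-- absolute values in increasing order. The indices come with equations because they will be of the
-- form `toℕ s`.
act-dihedral₄ : ∀ i j → i ≡ 0 → j ≡ 1 → ∀ {v} → Descent i v → Descent j v →
  let v₀ = act i (act j (act i (act j v))) in
  (Ascent i v₀ × Ascent j (act i v₀) × Ascent i (act j (act i v₀))) ×
  (Ascent j v₀ × Ascent i (act j v₀) × Ascent j (act i (act j v₀))) ×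
  v₀ ≡ act j (act i (act j (act i v)))
act-dihedral₄ _ _ refl refl {neg a ∷ neg b ∷ v} flip (swap (here (neg≺neg p))) =
  (flip , swap (here neg≺pos) , flip) ,
  (swap (here (pos≺pos p)) , flip , swap (here neg≺pos)) ,
  refl
act-dihedral₄ _ _ refl refl {neg a ∷ []} flip (swap ())
act-dihedral₄ _ _ refl refl {neg a ∷ pos b ∷ v} flip (swap (here ()))

act-dihedral₃ : ∀ i j → 1 ≤ i → j ≡ suc i → ∀ v → j < length v → Descent i v → Descent j v →
  let v₀ = act i (act j (act i v)) in
  (Ascent i v₀ × Ascent j (act i v₀)) × (Ascent j v₀ × Ascent i (act j v₀)) ×
  v₀ ≡ act j (act i (act j v))
act-dihedral₃ (suc i) j _ refl v j< (swap p) (swap q) with swapAt-dihedral i p q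
... | (p₁ , p₂) , q₁ , q₂ = (swap p₁ , swap p₂) , (swap q₁ , swap q₂) , swapAt-braid i v j<

-- One case for each exponent 1, 2, 3, 4 of the Coxeter matrix, the last two in both orders: `jda`
-- and `ruof` are `adj` and `four` with the letters exchanged.
data Pair (i j : ℕ) : Set where
  same : i ≡ j → Pair i j
  far  : Far i j → Pair i j
  adj  : 1 ≤ i → j ≡ suc i → Pair i j
  jda  : 1 ≤ j → i ≡ suc j → Pair i j
  four : i ≡ 0 → j ≡ 1 → Pair i j
  ruof : i ≡ 1 → j ≡ 0 → Pair i j

pair : ∀ i j → Pair i j
pair zero          zero          = same refl
pair zero          (suc zero)    = four refl refl
pair zero          (suc (suc j)) = far (s≤s (s≤s z≤n))
pair (suc zero)    zero          = ruof refl refl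
pair (suc (suc i)) zero          = far (s≤s (s≤s z≤n))
pair (suc i)       (suc j) with pair i j
... | same eq      = same (cong suc eq)
... | far f        = far f
... | adj _ eq     = adj (s≤s z≤n) (cong suc eq)
... | jda _ eq     = jda (s≤s z≤n) (cong suc eq)
... | four eq eq′  = adj (s≤s z≤n) (trans (cong suc eq′) (cong (2 +_) (sym eq)))
... | ruof eq eq′  = jda (s≤s z≤n) (trans (cong suc eq) (cong (2 +_) (sym eq′)))

Far-sym : ∀ i j → Far i j → Far j i
Far-sym i j = subst (1 <_) (ℕ.∣-∣-comm i j)

-- Matsumoto's theorem

infixr 5 _▷_

_▷_ : ∀ {k} → List (Fin k) → List Value → List Value
[]      ▷ v = v
(s ∷ w) ▷ v = act (toℕ s) (w ▷ v)

▷-++ : ∀ {k} (u w : List (Fin k)) v → (u ++ w) ▷ v ≡ u ▷ w ▷ v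
▷-++ []      w v = refl
▷-++ (s ∷ u) w v = cong (act (toℕ s)) (▷-++ u w v)

-- As words act from the left, window w lists the values of w⁻¹.
window : ∀ {k} → List (Fin k) → List Value
window {k} w = w ▷ range 0 k

▷-window : ∀ {k} (w : List (Fin k)) {v} → Window k v → Window k (w ▷ v)
▷-window []      W = W
▷-window (s ∷ w) W = act-window (toℕ s) (▷-window w W)

isWindow : ∀ {k} (w : List (Fin k)) → Window k (window w)
isWindow {k} w = ▷-window w (range-window k)

-- Recorded letter by letter. By `inversions-reduced` and `tight⇒Reduced` it amounts to the length
-- of the word being the inversion number of its window.
data Reduced {k} : List (Fin k) → Set where
  []  : Reduced []
  _∷_ : ∀ {s w} → Ascent (toℕ s) (window w) → Reduced w → Reduced (s ∷ w)

inversionsWith-range : ∀ a m k → a < m → inversionsWith (pos a) (range m k) ≡ 0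
inversionsWith-range a m zero    a<m = refl
inversionsWith-range a m (suc k) a<m
  rewrite indicator-no (pos m ≺? pos a) (≺-asym (pos≺pos a<m)) = inversionsWith-range a (suc m) k (ℕ.m<n⇒m<1+n a<m)

inversions-range : ∀ m k → inversions (range m k) ≡ 0
inversions-range m zero    = refl
inversions-range m (suc k) rewrite inversionsWith-range m (suc m) k ℕ.≤-refl = inversions-range (suc m) k

inversions-reduced : ∀ {k} {w : List (Fin k)} → Reduced w → inversions (window w) ≡ length w
inversions-reduced {k} []      = inversions-range 0 k
inversions-reduced     (p ∷ r) = trans (inversions-ascent p) (cong suc (inversions-reduced r))

inversions-≤-length : ∀ {k} (w : List (Fin k)) → inversions (window w) ≤ length w
inversions-≤-length {k} []      = ℕ.≤-reflexive (inversions-range 0 k)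
inversions-≤-length     (s ∷ w) = ℕ.≤-trans (inversions-act-≤ (isWindow w) (Fin.toℕ<n s)) (s≤s (inversions-≤-length w))

-- Descents are stripped off until the identity is reached; the inversion number `m` drops each
-- time, so the recursion terminates.
reducedWord : ∀ {k} m v → Window k v → inversions v ≡ m → ∃[ w ] Reduced {k} w × window w ≡ v
reducedWord m v W eq with descent⊎range W
... | inj₂ v≡ = [] , [] , sym v≡
reducedWord zero v W eq | inj₁ (i , i<k , d) with () ← trans (sym eq) (inversions-descent d)
reducedWord {k} (suc m) v W eq | inj₁ (i , i<k , d)
  with reducedWord m (act i v) (act-window i W) (ℕ.suc-injective (trans (sym (inversions-descent d)) eq))
... | w , r , w≡ = fromℕ< i<k ∷ w
  , subst₂ Ascent (sym i≡) (sym w≡) d ∷ r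
  , trans (cong₂ act i≡ w≡) (act-involutive i v)
  where
  i≡ : toℕ (fromℕ< i<k) ≡ i
  i≡ = Fin.toℕ-fromℕ< i<k

infix 4 _~_

-- Braid moves only, without cancellation of squares. So `_~_` preserves length, and a derivation
-- can be replayed in LNC_B(n), where squares vanish instead of being identities.
data _~_ {k} : Rel (List (Fin k)) 0ℓ where
  ~-refl  : ∀ {w} → w ~ w
  ~-sym   : ∀ {u w} → u ~ w → w ~ u
  ~-trans : ∀ {u v w} → u ~ v → v ~ w → u ~ w
  ~-cons  : ∀ s {u w} → u ~ w → s ∷ u ~ s ∷ w
  ~-far   : ∀ s t {w} → Far (toℕ s) (toℕ t) → s ∷ t ∷ w ~ t ∷ s ∷ w
  ~-adj   : ∀ s t {w} → 1 ≤ toℕ s → toℕ t ≡ suc (toℕ s) → s ∷ t ∷ s ∷ w ~ t ∷ s ∷ t ∷ w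
  ~-four  : ∀ s t {w} → toℕ s ≡ 0 → toℕ t ≡ 1 → s ∷ t ∷ s ∷ t ∷ w ~ t ∷ s ∷ t ∷ s ∷ w

Joins : ∀ {k} → Rel (List (Fin k)) 0ℓ
Joins u w = Reduced u → Reduced w → window u ≡ window w → u ~ w

reduced-length : ∀ {k} {u w : List (Fin k)} → Reduced u → Reduced w → window u ≡ window w → length u ≡ length w
reduced-length r r′ eq = trans (sym (inversions-reduced r)) (trans (cong inversions eq) (inversions-reduced r′))

cancel₂ : ∀ i j v → act i (act j (act j (act i v))) ≡ v
cancel₂ i j v = trans (cong (act i) (act-involutive j _)) (act-involutive i v)

cancel₃ : ∀ i j v → act i (act j (act i (act i (act j (act i v))))) ≡ v
cancel₃ i j v = trans (cong (act i ∘ act j) (act-involutive i _)) (cancel₂ i j v)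

-- Two reduced words of one element with first letters s ≠ t are joined through
-- reduced words starting with the two expressions of the longest element of ⟨s , t⟩.
matsumoto′ : ∀ {k} m (u w : List (Fin k)) → length u ≡ m → Joins u w
matsumoto′ m [] [] _ _ _ _ = ~-refl
matsumoto′ m [] (t ∷ w) _ r r′ eq with () ← reduced-length r r′ eq
matsumoto′ m (s ∷ u) [] _ r r′ eq with () ← reduced-length r r′ eq
matsumoto′ {k} (suc m) (s ∷ u) (t ∷ w) len (p ∷ r) (q ∷ r′) eq = cases (pair (toℕ s) (toℕ t))
  where
  i = toℕ s
  j = toℕ t
  U = window u
  V = act i U

  lenᵤ : length u ≡ m
  lenᵤ = ℕ.suc-injective len

  ds : Descent i V
  ds = subst (Ascent i) (sym (act-involutive i U)) p

  W≡ : window w ≡ act j V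
  W≡ = trans (sym (act-involutive j (window w))) (cong (act j) (sym eq))

  dt : Descent j V
  dt = subst (Ascent j) W≡ q

  -- `s ∷ x` and `t ∷ y` are related by one braid move. The recursive calls compare `u` with `x` and
  -- `y` with `w`, words of length `m`.
  via : ∀ {x y} → Reduced x → window x ≡ act i V → Reduced y → window y ≡ act j V →
        s ∷ x ~ t ∷ y → s ∷ u ~ t ∷ w
  via {x} {y} rx x≡ ry y≡ xy =
    ~-trans (~-cons s (matsumoto′ m u x lenᵤ r rx (trans (sym (act-involutive i U)) (sym x≡))))
    (~-trans xy (~-cons t (matsumoto′ m y w
      (trans (reduced-length ry r′ (trans y≡ (sym W≡)))
             (ℕ.suc-injective (trans (sym (reduced-length {u = s ∷ u} (p ∷ r) (q ∷ r′) eq)) len)))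
      ry r′ (trans y≡ (sym W≡)))))

  cases : Pair i j → s ∷ u ~ t ∷ w
  cases (same i≡j) with Fin.toℕ-injective i≡j
  ... | refl = ~-cons s (matsumoto′ m u w lenᵤ r r′ (act-injective i eq))
  -- `x` spells the window left over when the longest element of ⟨ s , t ⟩ is stripped from `V`.
  -- Here and in the cases below, either expression of that element can be put back in front of `x`
  -- letter by letter, each time at an ascent.
  cases (far f) with reducedWord _ (act j (act i V)) (act-window j (act-window i (act-window i (isWindow u)))) refl
  ... | x , rx , x≡ = via
    (subst (Ascent j) (sym x≡) djt ∷ rx)
    (trans (cong (act j) x≡) (act-involutive j _))
    (subst (Ascent i) (sym (trans x≡ (act-comm j i (Far-sym i j f) V))) dis ∷ rx)
    (trans (cong (act i) (trans x≡ (act-comm j i (Far-sym i j f) V))) (act-involutive i _))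
    (~-far s t f)
    where
    djt : Ascent j (act j (act i V))
    djt = subst (Ascent j) (act-comm i j f V) (ascent-act j i (Far-sym i j f) dt)
    dis : Ascent i (act i (act j V))
    dis = subst (Ascent i) (act-comm j i (Far-sym i j f) V) (ascent-act i j f ds)
  cases (adj 1≤i j≡) with reducedWord _ (act i (act j (act i V))) (act-window i (act-window j (act-window i (act-window i (isWindow u))))) refl
    | act-dihedral₃ i j 1≤i j≡ V (subst (j <_) (sym (length≡ (act-window i (isWindow u)))) (Fin.toℕ<n t)) ds dt
  ... | x , rx , x≡ | (a₁ , a₂) , (b₁ , b₂) , br = via
    (subst (Ascent j) (sym (cong (act i) x≡)) a₂ ∷ subst (Ascent i) (sym x≡) a₁ ∷ rx)
    (trans (cong (act j ∘ act i) x≡) (cancel₂ j i _))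
    (subst (Ascent i) (sym (cong (act j) x≡)) b₂ ∷ subst (Ascent j) (sym x≡) b₁ ∷ rx)
    (trans (cong (act i ∘ act j) (trans x≡ br)) (cancel₂ i j _))
    (~-adj s t 1≤i j≡)
  cases (jda 1≤j i≡) with reducedWord _ (act j (act i (act j V))) (act-window j (act-window i (act-window j (act-window i (isWindow u))))) refl
    | act-dihedral₃ j i 1≤j i≡ V (subst (i <_) (sym (length≡ (act-window i (isWindow u)))) (Fin.toℕ<n s)) dt ds
  ... | x , rx , x≡ | (a₁ , a₂) , (b₁ , b₂) , br = via
    (subst (Ascent j) (sym (cong (act i) x≡)) b₂ ∷ subst (Ascent i) (sym x≡) b₁ ∷ rx)
    (trans (cong (act j ∘ act i) (trans x≡ br)) (cancel₂ j i _))
    (subst (Ascent i) (sym (cong (act j) x≡)) a₂ ∷ subst (Ascent j) (sym x≡) a₁ ∷ rx)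
    (trans (cong (act i ∘ act j) x≡) (cancel₂ i j _))
    (~-sym (~-adj t s 1≤j i≡))
  cases (four i≡0 j≡1) with reducedWord _ (act i (act j (act i (act j V))))
        (act-window i (act-window j (act-window i (act-window j (act-window i (isWindow u)))))) refl
    | act-dihedral₄ i j i≡0 j≡1 ds dt
  ... | x , rx , x≡ | (a₁ , a₂ , a₃) , (b₁ , b₂ , b₃) , br = via
    (subst (Ascent j) (sym (cong (act i ∘ act j) x≡)) b₃
      ∷ subst (Ascent i) (sym (cong (act j) x≡)) b₂ ∷ subst (Ascent j) (sym x≡) b₁ ∷ rx)
    (trans (cong (act j ∘ act i ∘ act j) (trans x≡ br)) (cancel₃ j i _))
    (subst (Ascent i) (sym (cong (act j ∘ act i) x≡)) a₃
      ∷ subst (Ascent j) (sym (cong (act i) x≡)) a₂ ∷ subst (Ascent i) (sym x≡) a₁ ∷ rx)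
    (trans (cong (act i ∘ act j ∘ act i) x≡) (cancel₃ i j _))
    (~-four s t i≡0 j≡1)
  cases (ruof i≡1 j≡0) with reducedWord _ (act j (act i (act j (act i V))))
        (act-window j (act-window i (act-window j (act-window i (act-window i (isWindow u)))))) refl
    | act-dihedral₄ j i j≡0 i≡1 dt ds
  ... | x , rx , x≡ | (a₁ , a₂ , a₃) , (b₁ , b₂ , b₃) , br = via
    (subst (Ascent j) (sym (cong (act i ∘ act j) x≡)) a₃
      ∷ subst (Ascent i) (sym (cong (act j) x≡)) a₂ ∷ subst (Ascent j) (sym x≡) a₁ ∷ rx)
    (trans (cong (act j ∘ act i ∘ act j) x≡) (cancel₃ j i _))
    (subst (Ascent i) (sym (cong (act j ∘ act i) x≡)) b₃
      ∷ subst (Ascent j) (sym (cong (act i) x≡)) b₂ ∷ subst (Ascent i) (sym x≡) b₁ ∷ rx)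
    (trans (cong (act i ∘ act j ∘ act i) (trans x≡ br)) (cancel₃ i j _))
    (~-sym (~-four t s j≡0 i≡1))

matsumoto : ∀ {k} {u w : List (Fin k)} → Joins u w
matsumoto {u = u} {w} = matsumoto′ (length u) u w refl

-- The word problem of W

mA-suc : ∀ i j → mA (suc i) (suc j) ≡ mA i j
mA-suc zero    j = refl
mA-suc (suc i) j = refl

mB-suc : ∀ i j → mB (suc i) (suc j) ≡ mA i j
mB-suc zero    j = refl
mB-suc (suc i) j = refl

mA-far : ∀ i j → Far i j → mA i j ≡ 2
mA-far zero          (suc (suc j)) f = refl
mA-far (suc (suc i)) zero          f = refl
mA-far (suc i)       (suc j)       f = trans (mA-suc i j) (mA-far i j f)
mA-far zero          zero          ()
mA-far zero          (suc zero)    (s≤s ())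
mA-far (suc zero)    zero          (s≤s ())

mA-adj : ∀ i → mA i (suc i) ≡ 3 × mA (suc i) i ≡ 3 × mA i i ≡ 1
mA-adj zero          = refl , refl , refl
mA-adj (suc i) with mA-adj i
... | p , q , r = trans (mA-suc i (suc i)) p , q , trans (mA-suc i i) r

mB-far : ∀ i j → Far i j → mB i j ≡ 2
mB-far zero          (suc (suc j)) f = refl
mB-far (suc (suc i)) zero          f = refl
mB-far (suc i)       (suc j)       f = trans (mB-suc i j) (mA-far i j f)
mB-far zero          zero          ()
mB-far zero          (suc zero)    (s≤s ())
mB-far (suc zero)    zero          (s≤s ())

mB-same : ∀ i → mB i i ≡ 1
mB-same zero    = refl
mB-same (suc i) = trans (mB-suc i i) (proj₂ (proj₂ (mA-adj i)))

mB-adj : ∀ i j → 1 ≤ i → j ≡ suc i → mB i j ≡ 3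
mB-adj (suc i) _ _ refl = trans (mB-suc i (suc i)) (proj₁ (mA-adj i))

mB-jda : ∀ i j → 1 ≤ j → i ≡ suc j → mB i j ≡ 3
mB-jda _ (suc j) _ refl = proj₁ (proj₂ (mA-adj j))

mB-four : ∀ i j → i ≡ 0 → j ≡ 1 → mB i j ≡ 4
mB-four _ _ refl refl = refl

mB-ruof : ∀ i j → i ≡ 1 → j ≡ 0 → mB i j ≡ 4
mB-ruof _ _ refl refl = refl

act-braid₃ : ∀ i j → 1 ≤ i → j ≡ suc i → ∀ v → j < length v → act i (act j (act i v)) ≡ act j (act i (act j v))
act-braid₃ (suc i) _ _ refl v l = swapAt-braid i v l

transpose : ℕ → ℕ → ℕ
transpose zero    zero          = 1
transpose zero    (suc zero)    = 0
transpose zero    (suc (suc c)) = suc (suc c)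
transpose (suc r) zero          = zero
transpose (suc r) (suc c)       = suc (transpose r c)

-- Letters put in front of a word act on the positions of its window, a letter appended behind acts
-- on the values (`window-∷ʳ`). This is the action on values.
actValue : ℕ → Value → Value
actValue zero    (pos zero)    = neg zero
actValue zero    (neg zero)    = pos zero
actValue zero    (pos (suc c)) = pos (suc c)
actValue zero    (neg (suc c)) = neg (suc c)
actValue (suc r) (pos c)       = pos (transpose r c)
actValue (suc r) (neg c)       = neg (transpose r c)

actValue-negate : ∀ r a → actValue r (negate a) ≡ negate (actValue r a)
actValue-negate zero    (pos zero)    = refl
actValue-negate zero    (neg zero)    = refl
actValue-negate zero    (pos (suc c)) = refl
actValue-negate zero    (neg (suc c)) = refl
actValue-negate (suc r) (pos c)       = refl
actValue-negate (suc r) (neg c)       = refl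

transpose-< : ∀ {r c} → c < r → transpose r c ≡ c
transpose-< {suc r} {zero}  _         = refl
transpose-< {suc r} {suc c} (s≤s c<r) = cong suc (transpose-< c<r)

transpose-> : ∀ {r c} → suc r < c → transpose r c ≡ c
transpose-> {zero}  {suc (suc c)} _       = refl
transpose-> {suc r} {suc c}       (s≤s l) = cong suc (transpose-> l)
transpose-> {zero}  {suc zero} (s≤s ())

transpose-r : ∀ r → transpose r r ≡ suc r
transpose-r zero    = refl
transpose-r (suc r) = cong suc (transpose-r r)

transpose-1+r : ∀ r → transpose r (suc r) ≡ r
transpose-1+r zero    = refl
transpose-1+r (suc r) = cong suc (transpose-1+r r)

transpose-apart : ∀ {r c} → c ≢ r → c ≢ suc r → transpose r c ≡ c
transpose-apart {r} {c} p q with ℕ.<-cmp c r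
... | tri< c<r _ _ = transpose-< c<r
... | tri≈ _ c≡r _ = contradiction c≡r p
... | tri> _ _ r<c = transpose-> (ℕ.≤∧≢⇒< r<c (q ∘ sym))

transpose-inversion : ∀ r {a b} → a < b → transpose r b < transpose r a → a ≡ r × b ≡ suc r
transpose-inversion zero    {zero}        {suc zero}    _ _ = refl , refl
transpose-inversion zero    {zero}        {suc (suc b)} _ (s≤s ())
transpose-inversion zero    {suc zero}    {suc (suc b)} _ ()
transpose-inversion zero    {suc (suc a)} {suc (suc b)} p q = contradiction q (ℕ.<-asym p)
transpose-inversion zero    {suc (suc a)} {suc zero} (s≤s ()) q
transpose-inversion zero    {suc zero} {suc zero} (s≤s ()) q
transpose-inversion (suc r) {zero}        {suc b}       _ ()
transpose-inversion (suc r) {suc a}       {suc b}       (s≤s p) (s≤s q) with transpose-inversion r p q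
... | refl , refl = refl , refl

actValue-apart : ∀ {c} a → magnitude a ≢ c → magnitude a ≢ suc c → actValue (suc c) a ≡ a
actValue-apart (pos a) p q = cong pos (transpose-apart p q)
actValue-apart (neg a) p q = cong neg (transpose-apart p q)

actValue-zero-apart : ∀ a → magnitude a ≢ 0 → actValue 0 a ≡ a
actValue-zero-apart (pos zero)    p = contradiction refl p
actValue-zero-apart (neg zero)    p = contradiction refl p
actValue-zero-apart (pos (suc c)) p = refl
actValue-zero-apart (neg (suc c)) p = refl

-- The local source of the exchange condition: neighbouring values are the only ones whose order a
-- simple reflection can reverse. For `r` zero these are -1 and 1, which `Apart` excludes.
actValue-inversion : ∀ r {a b} → Apart a b → a ≺ b → actValue r b ≺ actValue r a →
  actValue r a ≡ b × actValue r b ≡ a × (∀ c → Apart c a → Apart c b → actValue r c ≡ c)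
actValue-inversion (suc r) p (pos≺pos a<b) (pos≺pos q) with transpose-inversion r a<b q
... | refl , refl = cong pos (transpose-r r) , cong pos (transpose-1+r r) , actValue-apart
actValue-inversion (suc r) p (neg≺neg b<a) (neg≺neg q) with transpose-inversion r b<a q
... | refl , refl = cong neg (transpose-1+r r) , cong neg (transpose-r r) , (λ c x y → actValue-apart c y x)
actValue-inversion zero {neg zero}    {pos zero}    p neg≺pos q = contradiction refl p
actValue-inversion zero {neg zero}    {pos (suc b)} p neg≺pos (pos≺pos ())
actValue-inversion zero {neg (suc a)} {pos zero}    p neg≺pos (neg≺neg ())
actValue-inversion zero {neg (suc a)} {pos (suc b)} p neg≺pos ()
actValue-inversion zero {pos zero}    {pos (suc b)} p (pos≺pos _) ()
actValue-inversion zero {pos (suc a)} {pos (suc b)} p (pos≺pos l) (pos≺pos q) = contradiction q (ℕ.<-asym l)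
actValue-inversion zero {neg (suc a)} {neg zero}    p (neg≺neg _) ()
actValue-inversion zero {neg (suc a)} {neg (suc b)} p (neg≺neg l) (neg≺neg q) = contradiction q (ℕ.<-asym l)

map-swapAt : ∀ {A B : Set} (f : A → B) i v → map f (swapAt i v) ≡ swapAt i (map f v)
map-swapAt f zero    []          = refl
map-swapAt f zero    (a ∷ [])    = refl
map-swapAt f zero    (a ∷ b ∷ v) = refl
map-swapAt f (suc i) []          = refl
map-swapAt f (suc i) (a ∷ v)     = cong (f a ∷_) (map-swapAt f i v)

map-act : ∀ (f : Value → Value) → (∀ a → f (negate a) ≡ negate (f a)) → ∀ i v → map f (act i v) ≡ act i (map f v)
map-act f f-negate zero    []      = refl
map-act f f-negate zero    (a ∷ v) = cong (_∷ map f v) (f-negate a)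
map-act f f-negate (suc i) v       = map-swapAt f i v

map-fixed : ∀ {f : Value → Value} {v} → All (λ a → f a ≡ a) v → map f v ≡ v
map-fixed []       = refl
map-fixed (p ∷ ps) = cong₂ _∷_ p (map-fixed ps)

swapAt-range : ∀ r m k → suc r < k → swapAt r (range m k) ≡ map (actValue (suc (m + r))) (range m k)
swapAt-range zero m (suc (suc k)) _ rewrite ℕ.+-identityʳ m =
  cong₂ _∷_ (cong pos (sym (transpose-r m)))
  (cong₂ _∷_ (cong pos (sym (transpose-1+r m)))
  (sym (map-fixed (All.map (λ { (pos≺pos l) → cong pos (transpose-> l) }) (range-≻ (2 + m) k ℕ.≤-refl)))))
swapAt-range (suc r) m (suc k) (s≤s l) =
  cong₂ _∷_ (cong pos (sym (transpose-< (ℕ.m<m+n m (s≤s z≤n)))))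
  (trans (swapAt-range r (suc m) k l) (cong (λ z → map (actValue (suc z)) (range (suc m) k)) (sym (ℕ.+-suc m r))))
swapAt-range zero m (suc zero) (s≤s ())

act-range : ∀ r k → r < k → act r (range 0 k) ≡ map (actValue r) (range 0 k)
act-range zero    (suc k) _ = cong (neg 0 ∷_) (sym (map-fixed (All.map fixed (range-≻ 1 k ℕ.≤-refl))))
  where
  fixed : ∀ {a} → pos 0 ≺ a → actValue 0 a ≡ a
  fixed {pos (suc c)} _ = refl
  fixed {pos zero} (pos≺pos ())
act-range (suc r) k       l = swapAt-range r 0 k l

▷-map : ∀ {k} (f : Value → Value) → (∀ a → f (negate a) ≡ negate (f a)) →
  ∀ (w : List (Fin k)) v → w ▷ map f v ≡ map f (w ▷ v)
▷-map f f-negate []      v = refl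
▷-map f f-negate (s ∷ w) v =
  trans (cong (act (toℕ s)) (▷-map f f-negate w v)) (sym (map-act f f-negate (toℕ s) (w ▷ v)))

-- The letter `r` acts first, on the identity window, where moving positions and moving values have
-- the same effect. The map on values commutes with negation and hence passes through the letters of
-- `w`.
window-∷ʳ : ∀ {k} (w : List (Fin k)) r → window (w ++ r ∷ []) ≡ map (actValue (toℕ r)) (window w)
window-∷ʳ {k} w r = trans (▷-++ w (r ∷ []) (range 0 k))
  (trans (cong (w ▷_) (act-range (toℕ r) k (Fin.toℕ<n r))) (▷-map (actValue (toℕ r)) (actValue-negate (toℕ r)) w (range 0 k)))

-- The second component carries the induction: an entry passed on the way is apart from the
-- exchanged pair and hence fixed by `r`.
swapAt-exchange : ∀ r i {v} → AllPairs Apart v → AscentAt i v → AscentAt i (swapAt i (map (actValue r) v)) →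
  swapAt i v ≡ map (actValue r) v × (∀ c → All (Apart c) v → actValue r c ≡ c)
swapAt-exchange r zero {a ∷ b ∷ v} ((p ∷ ps) ∷ qs ∷ _) (here a≺b) (here q)
  with actValue-inversion r p a≺b q
... | ra≡b , rb≡a , fixed =
  cong₂ _∷_ (sym ra≡b) (cong₂ _∷_ (sym rb≡a) (sym (map-fixed
    (All.zipWith (λ {c} (x , y) → fixed c (Apart-sym {a} {c} x) (Apart-sym {b} {c} y)) (ps , qs))))) ,
  λ { c (x ∷ y ∷ _) → fixed c x y }
swapAt-exchange r (suc i) {a ∷ v} (p ∷ ps) (there x) (there y) with swapAt-exchange r i ps x y
... | eq , fixed = cong₂ _∷_ (sym (fixed a p)) eq , λ { c (_ ∷ z) → fixed c z }

-- If applying the simple transposition r to the values turns the ascent at i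
-- into a descent, then it has the same effect as letter i.
act-exchange : ∀ {k} r i {v} → Window k v → Ascent i v → Descent i (map (actValue r) v) →
  act i v ≡ map (actValue r) v
act-exchange r       (suc i) W (swap p) (swap q) = proj₁ (swapAt-exchange r i (distinct W) p q)
act-exchange zero    zero    {pos zero ∷ v} W flip d with distinct W
... | ps ∷ _ = cong (neg 0 ∷_) (sym (map-fixed (All.map (λ {c} p → actValue-zero-apart c (p ∘ sym)) ps)))
act-exchange zero    zero    {pos (suc c) ∷ v} W flip ()
act-exchange (suc r) zero    {pos c ∷ v} W flip ()

module Words (n : ℕ) where

  open CoxeterGroup n public

  group : Group 0ℓ 0ℓ
  group = record
    { Carrier = W ; _≈_ = _≈_ ; _∙_ = _·_ ; ε = ε ; _⁻¹ = _⁻¹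
    ; isGroup = record
      { isMonoid = record
        { isSemigroup = record
          { isMagma = record
            { isEquivalence = record { refl = ≈-refl ; sym = ≈-sym ; trans = ≈-trans }
            ; ∙-cong = ·-cong }
          ; assoc = λ x y z → ≡⇒≈ (List.++-assoc x y z) }
        ; identity = (λ _ → ≈-refl) , λ x → ≡⇒≈ (List.++-identityʳ x) }
      ; inverse = inverseˡ , inverseʳ
      ; ⁻¹-cong = λ {x} {y} x≈y →
          ≈-trans (≡⇒≈ (sym (List.++-identityʳ (x ⁻¹))))
          (≈-trans (·-cong (≈-refl {x ⁻¹}) (≈-sym (inverseʳ y)))
          (≈-trans (≡⇒≈ (sym (List.++-assoc (x ⁻¹) y (y ⁻¹))))
          (·-cong (≈-trans (·-cong (≈-refl {x ⁻¹}) (≈-sym x≈y)) (inverseˡ x)) (≈-refl {y ⁻¹}))))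
      }
    }

  open Group group public using (setoid; ⁻¹-cong)
  module G = GroupProperties group
  module ≈-Reasoning = SetoidReasoning setoid

  ▷-order : ∀ s t g → length g ≡ n → concat (replicate (mB (toℕ s) (toℕ t)) (s ∷ t ∷ [])) ▷ g ≡ g
  ▷-order s t g len = cases (pair i j)
    where
    i = toℕ s
    j = toℕ t

    j< : j < length g
    j< = subst (j <_) (sym len) (Fin.toℕ<n t)

    i< : i < length g
    i< = subst (i <_) (sym len) (Fin.toℕ<n s)

    to : ∀ {m} → mB i j ≡ m → concat (replicate m (s ∷ t ∷ [])) ▷ g ≡ g →
         concat (replicate (mB i j) (s ∷ t ∷ [])) ▷ g ≡ g
    to refl p = p

    cases : Pair i j → concat (replicate (mB i j) (s ∷ t ∷ [])) ▷ g ≡ g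
    cases (same i≡j) with Fin.toℕ-injective i≡j
    ... | refl = to (mB-same i) (act-involutive i g)
    cases (far f) = to (mB-far i j f) (trans (act-comm i j f _) (trans (cong (act j) (act-involutive i _)) (act-involutive j g)))
    cases (adj 1≤i eq) = to (mB-adj i j 1≤i eq)
      (trans (cong (act i ∘ act j ∘ act i) (sym (act-braid₃ i j 1≤i eq g j<))) (cancel₃ i j g))
    cases (jda 1≤j eq) = to (mB-jda i j 1≤j eq)
      (trans (cong (act i ∘ act j ∘ act i) (act-braid₃ j i 1≤j eq g i<)) (cancel₃ i j g))
    cases (four i≡0 j≡1) = to (mB-four i j i≡0 j≡1) (four′ i j i≡0 j≡1)
      where
      four′ : ∀ i j → i ≡ 0 → j ≡ 1 → act i (act j (act i (act j (act i (act j (act i (act j g))))))) ≡ g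
      four′ i j refl refl = trans (cong (act i ∘ act j ∘ act i ∘ act j) (act-braid₄ g))
        (trans (cong (act i ∘ act j ∘ act i) (act-involutive j (act i (act j (act i g))))) (cancel₃ i j g))
    cases (ruof i≡1 j≡0) = to (mB-ruof i j i≡1 j≡0) (four′ i j i≡1 j≡0)
      where
      four′ : ∀ i j → i ≡ 1 → j ≡ 0 → act i (act j (act i (act j (act i (act j (act i (act j g))))))) ≡ g
      four′ i j refl refl = trans (cong (act i ∘ act j ∘ act i ∘ act j) (sym (act-braid₄ g)))
        (trans (cong (act i ∘ act j ∘ act i) (act-involutive j (act i (act j (act i g))))) (cancel₃ i j g))

  length-▷ : ∀ (w : W) g → length (w ▷ g) ≡ length g
  length-▷ []      g = refl
  length-▷ (s ∷ w) g = trans (length-act (toℕ s) _) (length-▷ w g)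

  -- General lists of length `n` are needed for `·-cong`, where the left factor acts on what the
  -- right factor has produced.
  ▷-cong : ∀ {v w} → v ≈ w → ∀ g → length g ≡ n → v ▷ g ≡ w ▷ g
  ▷-cong (order s t) g l = ▷-order s t g l
  ▷-cong ≈-refl g l = refl
  ▷-cong (≈-sym p) g l = sym (▷-cong p g l)
  ▷-cong (≈-trans p q) g l = trans (▷-cong p g l) (▷-cong q g l)
  ▷-cong (·-cong {v} {v′} {w} {w′} p q) g l =
    trans (▷-++ v w g)
    (trans (▷-cong p (w ▷ g) (trans (length-▷ w g) l))
    (trans (cong (v′ ▷_) (▷-cong q g l)) (sym (▷-++ v′ w′ g))))

  window-cong : ∀ {v w} → v ≈ w → window v ≡ window w
  window-cong p = ▷-cong p (range 0 n) (length-range 0 n)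

  cons-cong : ∀ s {v w} → v ≈ w → s ∷ v ≈ s ∷ w
  cons-cong s p = ·-cong (≈-refl {⟦ s ⟧}) p

  s·s·w≈w : ∀ s w → s ∷ s ∷ w ≈ w
  s·s·w≈w s w = ·-cong (s·s≈ε s) (≈-refl {w})

  order′ : ∀ s t {m} → mB (toℕ s) (toℕ t) ≡ m → concat (replicate m (s ∷ t ∷ [])) ≈ ε
  order′ s t refl = order s t

  ~⇒≈ : ∀ {v w} → v ~ w → v ≈ w
  ~⇒≈ ~-refl = ≈-refl
  ~⇒≈ (~-sym p) = ≈-sym (~⇒≈ p)
  ~⇒≈ (~-trans p q) = ≈-trans (~⇒≈ p) (~⇒≈ q)
  ~⇒≈ (~-cons s p) = cons-cong s (~⇒≈ p)
  ~⇒≈ (~-far s t {w} f) = ·-cong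
    (G.inverseˡ-unique (s ∷ t ∷ []) (s ∷ t ∷ []) (order′ s t (mB-far (toℕ s) (toℕ t) f))) (≈-refl {w})
  ~⇒≈ (~-adj s t {w} l eq) = ·-cong
    (G.inverseˡ-unique (s ∷ t ∷ s ∷ []) (t ∷ s ∷ t ∷ []) (order′ s t (mB-adj (toℕ s) (toℕ t) l eq))) (≈-refl {w})
  ~⇒≈ (~-four s t {w} p q) = ·-cong
    (G.inverseˡ-unique (s ∷ t ∷ s ∷ t ∷ []) (s ∷ t ∷ s ∷ t ∷ []) (order′ s t (mB-four (toℕ s) (toℕ t) p q))) (≈-refl {w})

  -- If `s` is a descent of the reduced word `v`, Matsumoto's theorem rewrites `v` as `s ∷ x`, and
  -- the two copies of `s` cancel.
  reduce : ∀ w → ∃[ v ] Reduced v × w ≈ v × window v ≡ window w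
  reduce [] = [] , [] , ≈-refl , refl
  reduce (s ∷ w) with reduce w
  ... | v , r , w≈v , v≡ with ascent? (toℕ s) (isWindow v) (Fin.toℕ<n s)
  ...   | inj₁ a = s ∷ v , a ∷ r , cons-cong s w≈v , cong (act (toℕ s)) v≡
  ...   | inj₂ d with reducedWord _ (act (toℕ s) (window v)) (act-window (toℕ s) (isWindow v)) refl
  ...     | x , rx , x≡ = x , rx
    , ≈-trans (cons-cong s (≈-trans w≈v (~⇒≈ (matsumoto r (subst (Ascent (toℕ s)) (sym x≡) d ∷ rx)
        (sym (trans (cong (act (toℕ s)) x≡) (act-involutive (toℕ s) _)))))))
      (s·s·w≈w s x)
    , trans x≡ (cong (act (toℕ s)) v≡)

  -- Reduced forms with the same window differ by braid moves, and these hold in W. Equations in W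
  -- can therefore be checked on windows.
  window-injective : ∀ {v w} → window v ≡ window w → v ≈ w
  window-injective {v} {w} eq with reduce v | reduce w
  ... | x , rx , v≈x , x≡ | y , ry , w≈y , y≡ =
    ≈-trans v≈x (≈-trans (~⇒≈ (matsumoto rx ry (trans x≡ (trans eq (sym y≡))))) (≈-sym w≈y))

  ℓ : W → ℕ
  ℓ w = inversions (window w)

  ℓ-cong : ∀ {v w} → v ≈ w → ℓ v ≡ ℓ w
  ℓ-cong p = cong inversions (window-cong p)

  ℓ-minimal : ∀ {v w} → v ≈ w → ℓ w ≤ length v
  ℓ-minimal {v} p = subst (_≤ length v) (ℓ-cong p) (inversions-≤-length v)

  ℓ-attained : ∀ w → ∃[ v ] v ≈ w × length v ≡ ℓ w
  ℓ-attained w with reduce w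
  ... | v , r , w≈v , v≡ = v , ≈-sym w≈v , trans (sym (inversions-reduced r)) (cong inversions v≡)

  infix 4 _<ₗ_
  _<ₗ_ : Fin n → W → Set
  s <ₗ w = ℓ w < ℓ (s ∷ w)

  length-step : ∀ s w → (ℓ (s ∷ w) ≡ suc (ℓ w)) ⊎ (ℓ w ≡ suc (ℓ (s ∷ w)))
  length-step s w with ascent? (toℕ s) (isWindow w) (Fin.toℕ<n s)
  ... | inj₁ a = inj₁ (inversions-ascent a)
  ... | inj₂ d = inj₂ (inversions-descent d)

  <ₗ⇒ascent : ∀ {s w} → ℓ w < ℓ (s ∷ w) → Ascent (toℕ s) (window w)
  <ₗ⇒ascent {s} {w} l with ascent? (toℕ s) (isWindow w) (Fin.toℕ<n s)
  ... | inj₁ a = a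
  ... | inj₂ d = contradiction l (ℕ.<-asym (ℕ.≤-reflexive (sym (inversions-descent d))))

  >ₗ⇒descent : ∀ {s w} → ℓ (s ∷ w) < ℓ w → Descent (toℕ s) (window w)
  >ₗ⇒descent {s} {w} l with ascent? (toℕ s) (isWindow w) (Fin.toℕ<n s)
  ... | inj₂ d = d
  ... | inj₁ a = contradiction l (ℕ.<-asym (ℕ.≤-reflexive (sym (inversions-ascent a))))

  commutes : ∀ s g r → Ascent (toℕ s) (window g) → Descent (toℕ s) (map (actValue (toℕ r)) (window g)) →
    s ∷ g ≈ g · ⟦ r ⟧
  commutes s g r a d = window-injective
    (trans (act-exchange (toℕ r) (toℕ s) (isWindow g) a d) (sym (window-∷ʳ g r)))

  -- The exchange condition for a single appended letter. `exchange` applies it at the place of a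
  -- word where the comparison with `s` changes.
  exchangeˡ : ∀ s g r → ℓ g < ℓ (s ∷ g) → ℓ (s ∷ g · ⟦ r ⟧) < ℓ (g · ⟦ r ⟧) → s ∷ g ≈ g · ⟦ r ⟧
  exchangeˡ s g r p q = commutes s g r (<ₗ⇒ascent {s} {g} p)
    (subst (Descent (toℕ s)) (window-∷ʳ g r) (>ₗ⇒descent {s} {g · ⟦ r ⟧} q))

  ℓ-⁻¹-≤ : ∀ w → ℓ (w ⁻¹) ≤ ℓ w
  ℓ-⁻¹-≤ w with ℓ-attained w
  ... | v , v≈w , len = subst (ℓ (w ⁻¹) ≤_) (trans (List.length-reverse v) len) (ℓ-minimal (⁻¹-cong v≈w))

  ℓ-⁻¹ : ∀ w → ℓ (w ⁻¹) ≡ ℓ w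
  ℓ-⁻¹ w = ℕ.≤-antisym (ℓ-⁻¹-≤ w) (subst (λ z → ℓ z ≤ ℓ (w ⁻¹)) (List.reverse-involutive w) (ℓ-⁻¹-≤ (w ⁻¹)))

-- Exchange, Bruhat order and 0-Hecke product

-- This is k², the length of the longest element of type B_k. It serves as fuel in `saturate` and
-- bounds the search for reduced words in `search`.
inversionsBound : ℕ → ℕ
inversionsBound zero    = 0
inversionsBound (suc k) = 1 + ((k + k) + inversionsBound k)

indicator-≤1 : ∀ {P : Set} (d : Dec P) → indicator d ≤ 1
indicator-≤1 (yes _) = ℕ.≤-refl
indicator-≤1 (no  _) = z≤n

inversionsWith-≤ : ∀ a v → inversionsWith a v ≤ length v + length v
inversionsWith-≤ a []      = z≤n
inversionsWith-≤ a (b ∷ v) = subst (inversionsWith a (b ∷ v) ≤_) (cong suc (sym (ℕ.+-suc (length v) (length v))))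
  (ℕ.+-mono-≤ (ℕ.+-mono-≤ (indicator-≤1 (b ≺? a)) (indicator-≤1 (b ≺? negate a))) (inversionsWith-≤ a v))

inversions₁-≤1 : ∀ a → inversions₁ a ≤ 1
inversions₁-≤1 (pos _) = z≤n
inversions₁-≤1 (neg _) = ℕ.≤-refl

inversions-≤ : ∀ v → inversions v ≤ inversionsBound (length v)
inversions-≤ []      = z≤n
inversions-≤ (a ∷ v) = ℕ.+-mono-≤ (inversions₁-≤1 a) (ℕ.+-mono-≤ (inversionsWith-≤ a v) (inversions-≤ v))

All-reverse : ∀ {A : Set} {P : A → Set} {v} → All P v → All P (reverse v)
All-reverse []                  = []
All-reverse {P = P} {x ∷ v} (p ∷ ps) = subst (All P) (sym (List.unfold-reverse x v)) (All.++⁺ (All-reverse ps) (p ∷ []))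

module Coxeter (n : ℕ) where

  open Words n public

  assoc : ∀ u v w → (u · v) · w ≈ u · (v · w)
  assoc u v w = ≡⇒≈ (List.++-assoc u v w)

  cancelˡ : ∀ u {v w} → u · v ≈ u · w → v ≈ w
  cancelˡ u = G.∙-cancelˡ u _ _

  <ₗ-cong : ∀ {s v w} → v ≈ w → s <ₗ v → s <ₗ w
  <ₗ-cong {s} p = subst₂ _<_ (ℓ-cong p) (ℓ-cong (cons-cong s p))

  ≮ₗ⇒> : ∀ {s w} → ¬ s <ₗ w → ℓ (s ∷ w) < ℓ w
  ≮ₗ⇒> {s} {w} ≮ with length-step s w
  ... | inj₁ eq = contradiction (ℕ.≤-reflexive (sym eq)) ≮
  ... | inj₂ eq = ℕ.≤-reflexive (sym eq)

  >⇒<ₗ : ∀ {s w} → ℓ (s ∷ w) < ℓ w → s <ₗ s ∷ w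
  >⇒<ₗ {s} {w} = subst (ℓ (s ∷ w) <_) (sym (ℓ-cong (s·s·w≈w s w)))

  <ₗ⇒≮ₗ : ∀ {s w} → s <ₗ w → ¬ s <ₗ s ∷ w
  <ₗ⇒≮ₗ {s} {w} p q = ℕ.<-asym p (subst (ℓ (s ∷ w) <_) (ℓ-cong (s·s·w≈w s w)) q)

  <ₗ⇒≡ : ∀ {s w} → s <ₗ w → ℓ (s ∷ w) ≡ suc (ℓ w)
  <ₗ⇒≡ {s} {w} p with length-step s w
  ... | inj₁ eq = eq
  ... | inj₂ eq = contradiction p (ℕ.<-asym (ℕ.≤-reflexive (sym eq)))

  ≮ₗ⇒≡ : ∀ {s w} → ¬ s <ₗ w → ℓ w ≡ suc (ℓ (s ∷ w))
  ≮ₗ⇒≡ {s} {w} ≮ with length-step s w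
  ... | inj₁ eq = contradiction (ℕ.≤-reflexive (sym eq)) ≮
  ... | inj₂ eq = eq

  ℓ-ε : ℓ ε ≡ 0
  ℓ-ε = inversions-range 0 n

  ℓ-bound : ∀ w → ℓ w ≤ inversionsBound n
  ℓ-bound w = subst (λ z → ℓ w ≤ inversionsBound z) (length≡ (isWindow w)) (inversions-≤ (window w))

  ℓ≡0⇒≈ε : ∀ {w} → ℓ w ≡ 0 → w ≈ ε
  ℓ≡0⇒≈ε {w} eq with ℓ-attained w
  ... | []    , ε≈w , _   = ≈-sym ε≈w
  ... | _ ∷ _ , _   , len with () ← trans len eq

  <ₗ-ε : ∀ s → s <ₗ ε
  <ₗ-ε s with length-step s ε
  ... | inj₁ eq = ℕ.≤-reflexive (sym eq)
  ... | inj₂ eq with () ← trans (sym ℓ-ε) eq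

  ℓ-subadditive : ∀ u v → ℓ (u · v) ≤ ℓ u + ℓ v
  ℓ-subadditive u v with ℓ-attained u | ℓ-attained v
  ... | x , x≈ , lx | y , y≈ , ly =
    subst (ℓ (u · v) ≤_) (trans (List.length-++ x) (cong₂ _+_ lx ly)) (ℓ-minimal (·-cong x≈ y≈))

  ℓ-·-⟦⟧ : ∀ w s → ℓ (w · ⟦ s ⟧) ≡ ℓ (s ∷ w ⁻¹)
  ℓ-·-⟦⟧ w s = trans (sym (ℓ-⁻¹ (w · ⟦ s ⟧))) (cong ℓ (List.reverse-++ w ⟦ s ⟧))

  -- The exchange condition, for the reflection u⁻¹ s u: the letter of x at
  -- which the sign of its root changes is deleted.
  exchange : ∀ s u x → s <ₗ u → ¬ s <ₗ u · x →
    ∃[ x′ ] length x ≡ suc (length x′) × (∀ {P : Fin n → Set} → All P x → All P x′) × s ∷ u · x ≈ u · x′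
  exchange s u [] p ≮ = contradiction (<ₗ-cong {s} (≡⇒≈ (sym (List.++-identityʳ u))) p) ≮
  exchange s u (y ∷ x) p ≮ with ℓ (u · ⟦ y ⟧) ℕ.<? ℓ (s ∷ u · ⟦ y ⟧)
  ... | yes q with exchange s (u · ⟦ y ⟧) x q (≮ ∘ <ₗ-cong {s} (assoc u ⟦ y ⟧ x))
  ...   | x′ , len , sub , eq = y ∷ x′ , cong suc len , (λ { (a ∷ as) → a ∷ sub as })
    , ≈-trans (cons-cong s (≈-sym (assoc u ⟦ y ⟧ x))) (≈-trans eq (assoc u ⟦ y ⟧ x′))
  exchange s u (y ∷ x) p ≮ | no q = x , refl , (λ { (_ ∷ as) → as })
    , ≈-trans (·-cong (exchangeˡ s u y p (≮ₗ⇒> {s} {u · ⟦ y ⟧} q)) (≈-refl {y ∷ x}))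
      (≈-trans (assoc u ⟦ y ⟧ (y ∷ x)) (·-cong (≈-refl {u}) (s·s·w≈w y x)))

  tight⇒Reduced : ∀ w → length w ≡ ℓ w → Reduced w
  tight⇒Reduced []      _   = []
  tight⇒Reduced (s ∷ w) len with length-step s w
  ... | inj₁ eq = <ₗ⇒ascent {s} {w} (ℕ.≤-reflexive (sym eq)) ∷ tight⇒Reduced w (ℕ.suc-injective (trans len eq))
  ... | inj₂ eq = contradiction (inversions-≤-length w)
    (ℕ.<⇒≱ (ℕ.≤-trans (ℕ.n≤1+n _) (ℕ.≤-reflexive (sym (trans eq (cong suc (sym len)))))))

  Reduced⇒tight : ∀ {w} → Reduced w → length w ≡ ℓ w
  Reduced⇒tight = sym ∘ inversions-reduced

  -- `reduce` gives no control over the letters of its result, whereas the exchange condition only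
  -- deletes letters, so that the word stays in its parabolic subgroup.
  reduceIn : ∀ {P : Fin n → Set} w → All P w → ∃[ v ] All P v × Reduced v × w ≈ v
  reduceIn [] [] = [] , [] , [] , ≈-refl
  reduceIn (s ∷ w) (p ∷ ps) with reduceIn w ps
  ... | v , qs , r , w≈v with ℓ v ℕ.<? ℓ (s ∷ v)
  ...   | yes l = s ∷ v , p ∷ qs , <ₗ⇒ascent {s} {v} l ∷ r , cons-cong s w≈v
  ...   | no ≮ with exchange s ε v (<ₗ-ε s) ≮
  ...     | x , len , sub , eq = x , sub qs
    , tight⇒Reduced x (ℕ.suc-injective (trans (sym len) (trans (Reduced⇒tight r) (trans (≮ₗ⇒≡ {s} {v} ≮) (cong suc (ℓ-cong eq))))))
    , ≈-trans (cons-cong s w≈v) eq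

  -- u y = r u x says that y = t x for the reflection t = u⁻¹ r u.
  reflect-shorter : ∀ {r u x y} → r <ₗ u → ¬ r <ₗ u · x → u · y ≈ r ∷ u · x → ℓ y < ℓ x
  reflect-shorter {r} {u} {x} {y} p ≮ eq with ℓ-attained x
  ... | x̂ , x̂≈ , len with exchange r u x̂ p (≮ ∘ <ₗ-cong {r} (·-cong (≈-refl {u}) x̂≈))
  ...   | x′ , len′ , _ , eq′ = subst (ℓ y <_) len (subst (ℓ y <_) (sym len′) (s≤s (ℓ-minimal {x′}
    (≈-sym (cancelˡ u (≈-trans eq (≈-trans (cons-cong r (·-cong (≈-refl {u}) (≈-sym x̂≈))) eq′)))))))

  reflect-sym : ∀ {r u x y} → u · y ≈ r ∷ u · x → u · x ≈ r ∷ u · y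
  reflect-sym {r} {u} {x} eq = ≈-trans (≈-sym (s·s·w≈w r (u · x))) (cons-cong r (≈-sym eq))

  reflect-longer : ∀ {r u x y} → r <ₗ u → r <ₗ u · x → u · y ≈ r ∷ u · x → ℓ x < ℓ y
  reflect-longer {r} {u} {x} {y} p q eq =
    reflect-shorter {r} {u} {y} {x} p (λ l → <ₗ⇒≮ₗ {r} {u · x} q (<ₗ-cong {r} eq l)) (reflect-sym {r} {u} {x} eq)

  -- Bruhat order and its lifting property

  infix 4 _⋖_ _≼_

  -- y = t x for the reflection t = u⁻¹ r u. Writing t with `r <ₗ u` and without inverses is the
  -- form in which `exchange` and `reflect-shorter` apply.
  record _⋖_ (x y : W) : Set where
    constructor edge
    field
      shorter : ℓ x < ℓ y
      r       : Fin n
      u       : W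
      r<u     : r <ₗ u
      equal   : u · y ≈ r ∷ u · x

  data _≼_ (x : W) : W → Set where
    ≼-reflexive : ∀ {y} → x ≈ y → x ≼ y
    ≼-step      : ∀ {y z} → x ≼ y → y ⋖ z → x ≼ z

  ⋖⇒≼ : ∀ {x y} → x ⋖ y → x ≼ y
  ⋖⇒≼ = ≼-step (≼-reflexive ≈-refl)

  ≼-trans : ∀ {x y z} → x ≼ y → y ≼ z → x ≼ z
  ≼-trans {x} p (≼-step q e) = ≼-step (≼-trans p q) e
  ≼-trans (≼-reflexive p) (≼-reflexive q) = ≼-reflexive (≈-trans p q)
  ≼-trans (≼-step p (edge l r u r<u eq)) (≼-reflexive q) =
    ≼-step p (edge (subst (_ <_) (ℓ-cong q) l) r u r<u (≈-trans (·-cong (≈-refl {u}) (≈-sym q)) eq))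

  ≼-length : ∀ {x y} → x ≼ y → x ≈ y ⊎ ℓ x < ℓ y
  ≼-length (≼-reflexive p) = inj₁ p
  ≼-length (≼-step p e) with ≼-length p
  ... | inj₁ x≈y = inj₂ (subst (_< _) (sym (ℓ-cong x≈y)) (_⋖_.shorter e))
  ... | inj₂ l   = inj₂ (ℕ.<-trans l (_⋖_.shorter e))

  ≼⇒≤ : ∀ {x y} → x ≼ y → ℓ x ≤ ℓ y
  ≼⇒≤ p with ≼-length p
  ... | inj₁ q = ℕ.≤-reflexive (ℓ-cong q)
  ... | inj₂ l = ℕ.<⇒≤ l

  ⋖⇒<ₗ : ∀ {x y} (e : x ⋖ y) → _⋖_.r e <ₗ _⋖_.u e · x
  ⋖⇒<ₗ {x} {y} (edge l r u r<u eq) with ℓ (u · x) ℕ.<? ℓ (r ∷ u · x)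
  ... | yes q = q
  ... | no ≮ = contradiction l (ℕ.<-asym (reflect-shorter {r} {u} r<u ≮ eq))

  -- The reflection for the new edge is s t s, given by u s in place of u. This lies on the wrong
  -- side of `r` only if r u = u s, that is t = s, and then y = s x.
  liftˡ-⋖ : ∀ s {x y} → x ⋖ y → (s ∷ x ⋖ s ∷ y) ⊎ (s ∷ x ≈ y)
  liftˡ-⋖ s {x} {y} e@(edge l r u r<u eq) with ℓ (u · ⟦ s ⟧) ℕ.<? ℓ (r ∷ u · ⟦ s ⟧)
  ... | yes q = inj₁ (edge (reflect-longer {r} {u · ⟦ s ⟧} q (<ₗ-cong {r} (≈-sym (us x)) (⋖⇒<ₗ e)) eq′) r (u · ⟦ s ⟧) q eq′)
    where
    us : ∀ z → (u · ⟦ s ⟧) · (s ∷ z) ≈ u · z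
    us z = ≈-trans (assoc u ⟦ s ⟧ (s ∷ z)) (·-cong (≈-refl {u}) (s·s·w≈w s z))
    eq′ : (u · ⟦ s ⟧) · (s ∷ y) ≈ r ∷ (u · ⟦ s ⟧) · (s ∷ x)
    eq′ = ≈-trans (us y) (≈-trans eq (cons-cong r (≈-sym (us x))))
  ... | no ≮ = inj₂ (≈-sym (cancelˡ u (≈-trans eq
    (≈-trans (·-cong (exchangeˡ r u s r<u (≮ₗ⇒> {r} {u · ⟦ s ⟧} ≮)) (≈-refl {x})) (assoc u ⟦ s ⟧ x)))))

  -- The reflection t is unchanged. The edge can fail only if `r` no longer ascends u x s, and then
  -- the exchange condition gives r u x = u x s, that is y = x s.
  liftʳ-⋖ : ∀ s {x y} → x ⋖ y → (x · ⟦ s ⟧ ⋖ y · ⟦ s ⟧) ⊎ (x · ⟦ s ⟧ ≈ y)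
  liftʳ-⋖ s {x} {y} e@(edge l r u r<u eq) with ℓ (u · (x · ⟦ s ⟧)) ℕ.<? ℓ (r ∷ u · (x · ⟦ s ⟧))
  ... | yes q = inj₁ (edge (reflect-longer {r} {u} r<u q eq′) r u r<u eq′)
    where
    eq′ : u · (y · ⟦ s ⟧) ≈ r ∷ u · (x · ⟦ s ⟧)
    eq′ = ≈-trans (≈-sym (assoc u y ⟦ s ⟧)) (≈-trans (·-cong eq (≈-refl {⟦ s ⟧})) (cons-cong r (assoc u x ⟦ s ⟧)))
  ... | no ≮ = inj₂ (≈-sym (cancelˡ u (≈-trans eq (≈-trans
    (exchangeˡ r (u · x) s (⋖⇒<ₗ e) (≮ₗ⇒> {r} {(u · x) · ⟦ s ⟧} (≮ ∘ <ₗ-cong {r} (assoc u x ⟦ s ⟧))))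
    (assoc u x ⟦ s ⟧)))))

  -- The lifting property with the descents left open: one edge at a time is multiplied by `s`, and
  -- a degenerate edge puts s x below y itself. `absorbˡ` adds the assumption on `y`.
  liftˡ : ∀ s {x y} → x ≼ y → (s ∷ x ≼ y) ⊎ (s ∷ x ≼ s ∷ y)
  liftˡ s (≼-reflexive p) = inj₂ (≼-reflexive (cons-cong s p))
  liftˡ s (≼-step p e) with liftˡ s p
  ... | inj₁ q = inj₁ (≼-step q e)
  ... | inj₂ q with liftˡ-⋖ s e
  ...   | inj₁ e′ = inj₂ (≼-step q e′)
  ...   | inj₂ eq = inj₁ (≼-trans q (≼-reflexive eq))

  liftʳ : ∀ s {x y} → x ≼ y → (x · ⟦ s ⟧ ≼ y) ⊎ (x · ⟦ s ⟧ ≼ y · ⟦ s ⟧)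
  liftʳ s (≼-reflexive p) = inj₂ (≼-reflexive (·-cong p (≈-refl {⟦ s ⟧})))
  liftʳ s (≼-step p e) with liftʳ s p
  ... | inj₁ q = inj₁ (≼-step q e)
  ... | inj₂ q with liftʳ-⋖ s e
  ...   | inj₁ e′ = inj₂ (≼-step q e′)
  ...   | inj₂ eq = inj₁ (≼-trans q (≼-reflexive eq))

  lowerˡ : ∀ s {x y} → x ≼ y → (x ≼ s ∷ y) ⊎ (s ∷ x ≼ s ∷ y)
  lowerˡ s (≼-reflexive p) = inj₂ (≼-reflexive (cons-cong s p))
  lowerˡ s (≼-step {y} {z} p e) with lowerˡ s p | liftˡ-⋖ s e
  ... | inj₁ q | inj₁ e′ = inj₁ (≼-step q e′)
  ... | inj₂ q | inj₁ e′ = inj₂ (≼-step q e′)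
  ... | _      | inj₂ eq = inj₁ (≼-trans p (≼-reflexive (≈-trans (≈-sym (s·s·w≈w s y)) (cons-cong s eq))))

  <ₗ⇒⋖ : ∀ {s x} → s <ₗ x → x ⋖ s ∷ x
  <ₗ⇒⋖ {s} l = edge l s ε (<ₗ-ε s) ≈-refl

  -- Here the reflection is x s x⁻¹, which makes x⁻¹ the element u.
  <ᵣ⇒⋖ : ∀ {s x} → ℓ x < ℓ (x · ⟦ s ⟧) → x ⋖ x · ⟦ s ⟧
  <ᵣ⇒⋖ {s} {x} l = edge l s (x ⁻¹)
    (subst₂ _<_ (sym (ℓ-⁻¹ x)) (ℓ-·-⟦⟧ x s) l)
    (≈-trans (≈-sym (assoc (x ⁻¹) x ⟦ s ⟧))
      (≈-trans (·-cong (inverseˡ x) (≈-refl {⟦ s ⟧})) (cons-cong s (≈-sym (inverseˡ x)))))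

  ·s·s≈ : ∀ x s → (x · ⟦ s ⟧) · ⟦ s ⟧ ≈ x
  ·s·s≈ x s = ≈-trans (assoc x ⟦ s ⟧ ⟦ s ⟧) (≈-trans (·-cong (≈-refl {x}) (s·s≈ε s)) (≡⇒≈ (List.++-identityʳ x)))

  ≮ᵣ⇒> : ∀ {s x} → ¬ ℓ x < ℓ (x · ⟦ s ⟧) → ℓ (x · ⟦ s ⟧) < ℓ x
  ≮ᵣ⇒> {s} {x} ≮ = subst₂ _<_ (sym (ℓ-·-⟦⟧ x s)) (ℓ-⁻¹ x)
    (≮ₗ⇒> {s} {x ⁻¹} (≮ ∘ subst₂ _<_ (ℓ-⁻¹ x) (sym (ℓ-·-⟦⟧ x s))))

  absorbˡ : ∀ {s x y} → ¬ s <ₗ y → x ≼ y → s ∷ x ≼ y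
  absorbˡ {s} {x} {y} ≮ p with liftˡ s p
  ... | inj₁ q = q
  ... | inj₂ q = ≼-trans q (≼-trans (⋖⇒≼ (<ₗ⇒⋖ {s} {s ∷ y} (>⇒<ₗ {s} {y} (≮ₗ⇒> {s} {y} ≮)))) (≼-reflexive (s·s·w≈w s y)))

  absorbʳ : ∀ {s x y} → ¬ ℓ y < ℓ (y · ⟦ s ⟧) → x ≼ y → x · ⟦ s ⟧ ≼ y
  absorbʳ {s} {x} {y} ≮ p with liftʳ s p
  ... | inj₁ q = q
  ... | inj₂ q = ≼-trans q (≼-trans (⋖⇒≼ (<ᵣ⇒⋖ {s} {y · ⟦ s ⟧}
      (subst (ℓ (y · ⟦ s ⟧) <_) (sym (ℓ-cong (·s·s≈ y s))) (≮ᵣ⇒> {s} {y} ≮)))) (≼-reflexive (·s·s≈ y s)))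

  lower : ∀ {s x y} → s <ₗ x → x ≼ y → x ≼ s ∷ y
  lower {s} {x} l p with lowerˡ s p
  ... | inj₁ q = q
  ... | inj₂ q = ≼-trans (⋖⇒≼ (<ₗ⇒⋖ {s} {x} l)) q

  -- Edges multiply by a reflection on the left, `Bruhat` on the right; conjugation by y turns u⁻¹ r
  -- u into (u y)⁻¹ r (u y).
  ≼⇒Bruhat : ∀ {x y} → x ≼ y → Bruhat ℓ x y
  ≼⇒Bruhat (≼-reflexive p) = reflexive p
  ≼⇒Bruhat (≼-step {y} {z} p (edge l r u r<u eq)) =
    ascend (≼⇒Bruhat p) ((u · y) ⁻¹ , r , ≈-refl) (subst (ℓ y <_) (sym (ℓ-cong yt≈z)) l) yt≈z
    where
    t : W
    t = (u · y) ⁻¹ · ⟦ r ⟧ · ((u · y) ⁻¹) ⁻¹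
    yt≈z : y · t ≈ z
    yt≈z = cancelˡ u (begin
      u · (y · t) ≈⟨ assoc u y t ⟨
      (u · y) · t ≈⟨ assoc (u · y) ((u · y) ⁻¹ · ⟦ r ⟧) (((u · y) ⁻¹) ⁻¹) ⟨
      ((u · y) · ((u · y) ⁻¹ · ⟦ r ⟧)) · ((u · y) ⁻¹) ⁻¹
        ≈⟨ ·-cong (assoc (u · y) ((u · y) ⁻¹) ⟦ r ⟧) (≡⇒≈ (sym (List.reverse-involutive (u · y)))) ⟨
      (((u · y) · (u · y) ⁻¹) · ⟦ r ⟧) · (u · y)
        ≈⟨ ·-cong (·-cong (inverseʳ (u · y)) (≈-refl {⟦ r ⟧})) (≈-refl {u · y}) ⟩
      r ∷ u · y ≈⟨ eq ⟨
      u · z ∎)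
      where open ≈-Reasoning

  -- Parabolic subgroups and maxima of double cosets

  ⟨⟩-cong : ∀ {I v w} → v ≈ w → v ∈⟨ I ⟩ → w ∈⟨ I ⟩
  ⟨⟩-cong p (x , xs , eq) = x , xs , ≈-trans eq p

  ⟨⟩-ε : ∀ {I} → ε ∈⟨ I ⟩
  ⟨⟩-ε = ε , [] , ≈-refl

  ⟨⟩-· : ∀ {I v w} → v ∈⟨ I ⟩ → w ∈⟨ I ⟩ → v · w ∈⟨ I ⟩
  ⟨⟩-· (x , xs , p) (y , ys , q) = x · y , All.++⁺ xs ys , ·-cong p q

  ⟨⟩-⟦⟧ : ∀ {I s} → s ∈ I → ⟦ s ⟧ ∈⟨ I ⟩
  ⟨⟩-⟦⟧ {s = s} p = ⟦ s ⟧ , p ∷ [] , ≈-refl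

  ⟨⟩-⁻¹ : ∀ {I v} → v ∈⟨ I ⟩ → v ⁻¹ ∈⟨ I ⟩
  ⟨⟩-⁻¹ (x , xs , p) = x ⁻¹ , All-reverse xs , ⁻¹-cong p

  ∼-reflexive : ∀ {I J x y} → x ≈ y → x ∼[ I , J ] y
  ∼-reflexive {x = x} p = ε , ε , ⟨⟩-ε , ⟨⟩-ε , ≈-trans (≡⇒≈ (List.++-identityʳ x)) p

  ∼-mulˡ : ∀ {I J x y w} → w ∈⟨ I ⟩ → x ∼[ I , J ] y → x ∼[ I , J ] w · y
  ∼-mulˡ {x = x} {w = w} w∈ (u , v , u∈ , v∈ , eq) = w · u , v , ⟨⟩-· w∈ u∈ , v∈ ,
    ≈-trans (≡⇒≈ (trans (cong (_++ v) (List.++-assoc w u x)) (List.++-assoc w (u ++ x) v))) (·-cong (≈-refl {w}) eq)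

  ∼-mulʳ : ∀ {I J x y w} → w ∈⟨ J ⟩ → x ∼[ I , J ] y → x ∼[ I , J ] y · w
  ∼-mulʳ {x = x} {w = w} w∈ (u , v , u∈ , v∈ , eq) = u , v · w , u∈ , ⟨⟩-· v∈ w∈ ,
    ≈-trans (≡⇒≈ (sym (List.++-assoc (u ++ x) v w))) (·-cong eq (≈-refl {w}))

  Saturated : Subset n → Subset n → W → Set
  Saturated I J u = (∀ {s} → s ∈ I → ¬ s <ₗ u) × (∀ {s} → s ∈ J → ¬ ℓ u < ℓ (u · ⟦ s ⟧))

  -- Letters of `I` on the left and of `J` on the right are added as long as the length rises. As
  -- lengths are bounded, `m` bounds the number of further rises.
  saturate : ∀ I J p m u → inversionsBound n ≤ ℓ u + m → p ∼[ I , J ] u → p ≼ u →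
    ∃[ x ] p ∼[ I , J ] x × p ≼ x × Saturated I J x
  saturate I J p m u bound p∼u p≼u with Fin.any? (λ s → (s ∈? I) ×-dec (ℓ u ℕ.<? ℓ (s ∷ u)))
  saturate I J p zero u bound p∼u p≼u | yes (s , s∈ , l) =
    contradiction (ℓ-bound (s ∷ u)) (ℕ.<⇒≱ (ℕ.≤-<-trans (subst (inversionsBound n ≤_) (ℕ.+-identityʳ (ℓ u)) bound) l))
  saturate I J p (suc m) u bound p∼u p≼u | yes (s , s∈ , l) =
    saturate I J p m (s ∷ u)
      (ℕ.≤-trans (subst (inversionsBound n ≤_) (ℕ.+-suc (ℓ u) m) bound) (ℕ.+-monoˡ-≤ m l))
      (∼-mulˡ (⟨⟩-⟦⟧ s∈) p∼u) (≼-step p≼u (<ₗ⇒⋖ {s} {u} l))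
  ... | no noˡ with Fin.any? (λ s → (s ∈? J) ×-dec (ℓ u ℕ.<? ℓ (u · ⟦ s ⟧)))
  saturate I J p zero u bound p∼u p≼u | no noˡ | yes (s , s∈ , l) =
    contradiction (ℓ-bound (u · ⟦ s ⟧)) (ℕ.<⇒≱ (ℕ.≤-<-trans (subst (inversionsBound n ≤_) (ℕ.+-identityʳ (ℓ u)) bound) l))
  saturate I J p (suc m) u bound p∼u p≼u | no noˡ | yes (s , s∈ , l) =
    saturate I J p m (u · ⟦ s ⟧)
      (ℕ.≤-trans (subst (inversionsBound n ≤_) (ℕ.+-suc (ℓ u) m) bound) (ℕ.+-monoˡ-≤ m l))
      (∼-mulʳ (⟨⟩-⟦⟧ s∈) p∼u) (≼-step p≼u (<ᵣ⇒⋖ {s} {u} l))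
  saturate I J p m u bound p∼u p≼u | no noˡ | no noʳ =
    u , p∼u , p≼u , (λ s∈ l → noˡ (_ , s∈ , l)) , (λ s∈ l → noʳ (_ , s∈ , l))

  absorbWordˡ : ∀ {I} {y} → (∀ {s} → s ∈ I → ¬ s <ₗ y) → ∀ w → All (_∈ I) w → ∀ {x} → x ≼ y → w · x ≼ y
  absorbWordˡ sat []      []       p = p
  absorbWordˡ sat (s ∷ w) (i ∷ is) p = absorbˡ (sat i) (absorbWordˡ sat w is p)

  absorbWordʳ : ∀ {J} {y} → (∀ {s} → s ∈ J → ¬ ℓ y < ℓ (y · ⟦ s ⟧)) → ∀ w → All (_∈ J) w → ∀ {x} → x ≼ y → x · w ≼ y
  absorbWordʳ sat []      []       {x} p = ≼-trans (≼-reflexive (≡⇒≈ (List.++-identityʳ x))) p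
  absorbWordʳ sat (s ∷ w) (i ∷ is) {x} p =
    ≼-trans (≼-reflexive (≈-sym (assoc x ⟦ s ⟧ w))) (absorbWordʳ sat w is (absorbʳ (sat i) p))

  -- By the lifting property, whatever lies below `x` stays below it when multiplied by a letter of
  -- `I` on the left or of `J` on the right. Starting from p, this reaches the whole double coset.
  saturated-max : ∀ {I J p x} → Saturated I J x → p ≼ x → ∀ {y} → p ∼[ I , J ] y → y ≼ x
  saturated-max {p = p} (satˡ , satʳ) p≼x (u , v , (û , û∈ , û≈) , (v̂ , v̂∈ , v̂≈) , eq) =
    ≼-trans (≼-reflexive (≈-trans (≈-sym eq) (·-cong (·-cong (≈-sym û≈) (≈-refl {p})) (≈-sym v̂≈))))
      (absorbWordʳ satʳ v̂ v̂∈ (absorbWordˡ satˡ û û∈ p≼x))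

  maximum : ∀ I J p → ∃[ x ] p ∼[ I , J ] x × p ≼ x × Saturated I J x
  maximum I J p = saturate I J p (inversionsBound n) p (ℕ.m≤n+m _ (ℓ p)) (∼-reflexive ≈-refl) (≼-reflexive ≈-refl)

  ∼ε⇒∈⟨⟩ : ∀ {I x} → ε ∼[ I , I ] x → x ∈⟨ I ⟩
  ∼ε⇒∈⟨⟩ (u , v , u∈ , v∈ , eq) = ⟨⟩-cong eq (⟨⟩-· (⟨⟩-· u∈ ⟨⟩-ε) v∈)

  ∈⟨⟩⇒∼ε : ∀ {I J x} → x ∈⟨ I ⟩ → ε ∼[ I , J ] x
  ∈⟨⟩⇒∼ε {x = x} x∈ = x , ε , x∈ , ⟨⟩-ε , ≡⇒≈ (trans (List.++-identityʳ (x ++ ε)) (List.++-identityʳ x))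

  -- The 0-Hecke product

  infixr 7 _⋆ˡ_ _◁_
  infixl 7 _⋆ʳ_ _▷ʳ_

  _⋆ˡ_ : Fin n → W → W
  s ⋆ˡ w with ℓ w ℕ.<? ℓ (s ∷ w)
  ... | yes _ = s ∷ w
  ... | no  _ = w

  _⋆ʳ_ : W → Fin n → W
  w ⋆ʳ t with ℓ w ℕ.<? ℓ (w · ⟦ t ⟧)
  ... | yes _ = w · ⟦ t ⟧
  ... | no  _ = w

  ⋆-ascent : ∀ {s w} → s <ₗ w → s ⋆ˡ w ≡ s ∷ w
  ⋆-ascent {s} {w} l with ℓ w ℕ.<? ℓ (s ∷ w)
  ... | yes _ = refl
  ... | no ≮ = contradiction l ≮

  ⋆-descent : ∀ {s w} → ¬ s <ₗ w → s ⋆ˡ w ≡ w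
  ⋆-descent {s} {w} ≮ with ℓ w ℕ.<? ℓ (s ∷ w)
  ... | yes l = contradiction l ≮
  ... | no  _ = refl

  ⋆ʳ-ascent : ∀ {w t} → ℓ w < ℓ (w · ⟦ t ⟧) → w ⋆ʳ t ≡ w · ⟦ t ⟧
  ⋆ʳ-ascent {w} {t} l with ℓ w ℕ.<? ℓ (w · ⟦ t ⟧)
  ... | yes _ = refl
  ... | no ≮ = contradiction l ≮

  ⋆ʳ-descent : ∀ {w t} → ¬ ℓ w < ℓ (w · ⟦ t ⟧) → w ⋆ʳ t ≡ w
  ⋆ʳ-descent {w} {t} ≮ with ℓ w ℕ.<? ℓ (w · ⟦ t ⟧)
  ... | yes l = contradiction l ≮
  ... | no  _ = refl

  ⋆-cong : ∀ s {v w} → v ≈ w → s ⋆ˡ v ≈ s ⋆ˡ w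
  ⋆-cong s {v} {w} p with ℓ v ℕ.<? ℓ (s ∷ v)
  ... | yes l = ≈-trans (cons-cong s p) (≡⇒≈ (sym (⋆-ascent {s} {w} (<ₗ-cong {s} p l))))
  ... | no ≮ = ≈-trans p (≡⇒≈ (sym (⋆-descent {s} {w} (≮ ∘ <ₗ-cong {s} (≈-sym p)))))

  <ᵣ-cong : ∀ t {v w} → v ≈ w → ℓ v < ℓ (v · ⟦ t ⟧) → ℓ w < ℓ (w · ⟦ t ⟧)
  <ᵣ-cong t p = subst₂ _<_ (ℓ-cong p) (ℓ-cong (·-cong p (≈-refl {⟦ t ⟧})))

  ⋆ʳ-cong : ∀ t {v w} → v ≈ w → v ⋆ʳ t ≈ w ⋆ʳ t
  ⋆ʳ-cong t {v} {w} p with ℓ v ℕ.<? ℓ (v · ⟦ t ⟧)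
  ... | yes l = ≈-trans (·-cong p (≈-refl {⟦ t ⟧})) (≡⇒≈ (sym (⋆ʳ-ascent {w} {t} (<ᵣ-cong t p l))))
  ... | no ≮ = ≈-trans p (≡⇒≈ (sym (⋆ʳ-descent {w} {t} (≮ ∘ <ᵣ-cong t (≈-sym p)))))

  <ᵣ⇒≡ : ∀ {w t} → ℓ w < ℓ (w · ⟦ t ⟧) → ℓ (w · ⟦ t ⟧) ≡ suc (ℓ w)
  <ᵣ⇒≡ {w} {t} l = trans (ℓ-·-⟦⟧ w t) (trans (<ₗ⇒≡ {t} {w ⁻¹} (subst₂ _<_ (sym (ℓ-⁻¹ w)) (ℓ-·-⟦⟧ w t) l)) (cong suc (ℓ-⁻¹ w)))

  ≮ᵣ⇒≡ : ∀ {w t} → ¬ ℓ w < ℓ (w · ⟦ t ⟧) → ℓ w ≡ suc (ℓ (w · ⟦ t ⟧))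
  ≮ᵣ⇒≡ {w} {t} ≮ = trans (sym (ℓ-⁻¹ w)) (trans (≮ₗ⇒≡ {t} {w ⁻¹} (≮ ∘ subst₂ _<_ (ℓ-⁻¹ w) (sym (ℓ-·-⟦⟧ w t)))) (cong suc (sym (ℓ-·-⟦⟧ w t))))

  -- If at most one of the two letters ascends `w`, lengths decide. If both do but s w t is no
  -- longer than w t, the exchange condition gives s w = w t, and both sides equal this element.
  ⋆-⋆ʳ-comm : ∀ s w t → s ⋆ˡ (w ⋆ʳ t) ≈ (s ⋆ˡ w) ⋆ʳ t
  ⋆-⋆ʳ-comm s w t with ℓ w ℕ.<? ℓ (s ∷ w) | ℓ w ℕ.<? ℓ (w · ⟦ t ⟧)
  ... | no ≮ˡ | no ≮ʳ = ≡⇒≈ (trans (⋆-descent {s} {w} ≮ˡ) (sym (⋆ʳ-descent {w} {t} ≮ʳ)))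
  ... | no ≮ˡ | yes lʳ = ≡⇒≈ (trans (⋆-descent {s} {w · ⟦ t ⟧} λ l → ℕ.<⇒≱ l
      (ℕ.≤-trans (ℓ-subadditive (s ∷ w) ⟦ t ⟧) (ℕ.≤-trans (ℕ.+-monoʳ-≤ (ℓ (s ∷ w)) (inversions-≤-length ⟦ t ⟧))
      (ℕ.≤-trans (ℕ.≤-reflexive (trans (ℕ.+-comm (ℓ (s ∷ w)) 1) (sym (≮ₗ⇒≡ {s} {w} ≮ˡ)))) (ℕ.<⇒≤ lʳ)))))
      (sym (⋆ʳ-ascent {w} {t} lʳ)))
  ... | yes lˡ | no ≮ʳ = ≡⇒≈ (trans (⋆-ascent {s} {w} lˡ) (sym (⋆ʳ-descent {s ∷ w} {t} λ l → ℕ.<⇒≱ l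
      (ℕ.≤-trans (ℓ-subadditive ⟦ s ⟧ (w · ⟦ t ⟧)) (ℕ.≤-trans (ℕ.+-monoˡ-≤ (ℓ (w · ⟦ t ⟧)) (inversions-≤-length ⟦ s ⟧))
      (ℕ.≤-trans (ℕ.≤-reflexive (sym (≮ᵣ⇒≡ {w} {t} ≮ʳ))) (ℕ.<⇒≤ lˡ)))))))
  ... | yes lˡ | yes lʳ with ℓ (w · ⟦ t ⟧) ℕ.<? ℓ (s ∷ w · ⟦ t ⟧)
  ...   | yes l = ≡⇒≈ (sym (⋆ʳ-ascent {s ∷ w} {t} (subst (_< ℓ (s ∷ w · ⟦ t ⟧)) (trans (<ᵣ⇒≡ {w} {t} lʳ) (sym (<ₗ⇒≡ {s} {w} lˡ))) l)))
  ...   | no ≮ = ≈-trans (≈-sym (exchangeˡ s w t lˡ (≮ₗ⇒> {s} {w · ⟦ t ⟧} ≮)))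
    (≡⇒≈ (sym (⋆ʳ-descent {s ∷ w} {t} λ l → ≮ (subst (_< ℓ (s ∷ w · ⟦ t ⟧)) (trans (<ₗ⇒≡ {s} {w} lˡ) (sym (<ᵣ⇒≡ {w} {t} lʳ))) l))))

  _◁_ : W → W → W
  []      ◁ x = x
  (s ∷ u) ◁ x = s ⋆ˡ u ◁ x

  _▷ʳ_ : W → W → W
  x ▷ʳ []      = x
  x ▷ʳ (t ∷ w) = (x ⋆ʳ t) ▷ʳ w

  ◁-cong : ∀ u {x y} → x ≈ y → u ◁ x ≈ u ◁ y
  ◁-cong []      p = p
  ◁-cong (s ∷ u) p = ⋆-cong s (◁-cong u p)

  ▷ʳ-cong : ∀ w {x y} → x ≈ y → x ▷ʳ w ≈ y ▷ʳ w
  ▷ʳ-cong []      p = p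
  ▷ʳ-cong (t ∷ w) p = ▷ʳ-cong w (⋆ʳ-cong t p)

  ⋆-▷ʳ-comm : ∀ s x w → s ⋆ˡ (x ▷ʳ w) ≈ (s ⋆ˡ x) ▷ʳ w
  ⋆-▷ʳ-comm s x []      = ≈-refl
  ⋆-▷ʳ-comm s x (t ∷ w) = ≈-trans (⋆-▷ʳ-comm s (x ⋆ʳ t) w) (▷ʳ-cong w (⋆-⋆ʳ-comm s x t))

  ◁-▷ʳ-comm : ∀ u x w → u ◁ (x ▷ʳ w) ≈ (u ◁ x) ▷ʳ w
  ◁-▷ʳ-comm []      x w = ≈-refl
  ◁-▷ʳ-comm (s ∷ u) x w = ≈-trans (⋆-cong s (◁-▷ʳ-comm u x w)) (⋆-▷ʳ-comm s (u ◁ x) w)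

  ◁-reduced : ∀ {u} → Reduced u → u ◁ ε ≈ u
  ◁-reduced [] = ≈-refl
  ◁-reduced {s ∷ u} (a ∷ r) = ≈-trans (⋆-cong s (◁-reduced r))
    (≡⇒≈ (⋆-ascent {s} {u} (ℕ.≤-reflexive (sym (inversions-ascent a)))))

  ▷ʳ-tight : ∀ x w → ℓ (x · w) ≡ ℓ x + length w → x ▷ʳ w ≈ x · w
  ▷ʳ-tight x []      eq = ≡⇒≈ (sym (List.++-identityʳ x))
  ▷ʳ-tight x (t ∷ w) eq = ≈-trans (≡⇒≈ (cong (_▷ʳ w) (⋆ʳ-ascent {x} {t} l)))
    (≈-trans (▷ʳ-tight (x · ⟦ t ⟧) w (trans (ℓ-cong (assoc x ⟦ t ⟧ w))
      (trans eq (trans (ℕ.+-suc (ℓ x) (length w)) (cong (_+ length w) (sym (<ᵣ⇒≡ {x} {t} l))))))) (assoc x ⟦ t ⟧ w))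
    where
    l : ℓ x < ℓ (x · ⟦ t ⟧)
    l = ℕ.+-cancelʳ-≤ (length w) (suc (ℓ x)) (ℓ (x · ⟦ t ⟧)) (ℕ.≤-trans
      (ℕ.≤-reflexive (trans (sym (ℕ.+-suc (ℓ x) (length w))) (trans (sym eq) (ℓ-cong (≈-sym (assoc x ⟦ t ⟧ w))))))
      (ℕ.≤-trans (ℓ-subadditive (x · ⟦ t ⟧) w) (ℕ.+-monoʳ-≤ (ℓ (x · ⟦ t ⟧)) (inversions-≤-length w))))

  reducedForm : W → W
  reducedForm w = proj₁ (reduce w)

  reducedForm-reduced : ∀ w → Reduced (reducedForm w)
  reducedForm-reduced w = proj₁ (proj₂ (reduce w))

  reducedForm-≈ : ∀ w → w ≈ reducedForm w
  reducedForm-≈ w = proj₁ (proj₂ (proj₂ (reduce w)))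

  infixl 7 _*ₕ_
  _*ₕ_ : W → W → W
  u *ₕ w = reducedForm u ◁ w

  ▷ʳ-reducedForm : ∀ w → ε ▷ʳ reducedForm w ≈ w
  ▷ʳ-reducedForm w = ≈-trans
    (▷ʳ-tight ε (reducedForm w) (trans (inversions-reduced (reducedForm-reduced w)) (cong (_+ length (reducedForm w)) (sym ℓ-ε))))
    (≈-sym (reducedForm-≈ w))

  -- The product can be computed from a reduced word of either factor. The right-hand form respects
  -- `_≈_` in `u`, and left and right operations commute, which yields congruence and associativity.
  *ₕ-▷ʳ : ∀ u w → u *ₕ w ≈ u ▷ʳ reducedForm w
  *ₕ-▷ʳ u w = ≈-trans (◁-cong (reducedForm u) (≈-sym (▷ʳ-reducedForm w)))
    (≈-trans (◁-▷ʳ-comm (reducedForm u) ε (reducedForm w))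
    (▷ʳ-cong (reducedForm w) (≈-trans (◁-reduced (reducedForm-reduced u)) (≈-sym (reducedForm-≈ u)))))

  *ₕ-cong : ∀ {u u′ w w′} → u ≈ u′ → w ≈ w′ → u *ₕ w ≈ u′ *ₕ w′
  *ₕ-cong {u} {u′} {w} {w′} p q = ≈-trans (◁-cong (reducedForm u) q)
    (≈-trans (*ₕ-▷ʳ u w′) (≈-trans (▷ʳ-cong (reducedForm w′) p) (≈-sym (*ₕ-▷ʳ u′ w′))))

  *ₕ-assoc : ∀ u v w → (u *ₕ v) *ₕ w ≈ u *ₕ (v *ₕ w)
  *ₕ-assoc u v w = ≈-trans (*ₕ-▷ʳ (u *ₕ v) w)
    (≈-trans (≈-sym (◁-▷ʳ-comm (reducedForm u) v (reducedForm w)))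
             (◁-cong (reducedForm u) (≈-sym (*ₕ-▷ʳ v w))))

  *ₕ-identityʳ : ∀ w → w *ₕ ε ≈ w
  *ₕ-identityʳ w = ≈-trans (◁-reduced (reducedForm-reduced w)) (≈-sym (reducedForm-≈ w))

  ⟦⟧-*ₕ : ∀ s w → ⟦ s ⟧ *ₕ w ≈ s ⋆ˡ w
  ⟦⟧-*ₕ s w = ≈-trans (*ₕ-▷ʳ ⟦ s ⟧ w)
    (≈-trans (▷ʳ-cong (reducedForm w) (≡⇒≈ (sym (⋆-ascent {s} {ε} (<ₗ-ε s)))))
    (≈-trans (≈-sym (⋆-▷ʳ-comm s ε (reducedForm w))) (⋆-cong s (▷ʳ-reducedForm w))))

  -- The later modules work with an arbitrary calculus; this instance shows that one exists.
  calculus : Calculus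
  calculus = record
    { ℓ = ℓ
    ; ℓ-attained = ℓ-attained
    ; ℓ-minimal = ℓ-minimal
    ; _*_ = _*ₕ_
    ; *-monoid = record
      { isSemigroup = record
        { isMagma = record
          { isEquivalence = record { refl = ≈-refl ; sym = ≈-sym ; trans = ≈-trans }
          ; ∙-cong = *ₕ-cong }
        ; assoc = *ₕ-assoc }
      ; identity = (λ _ → ≈-refl) , *ₕ-identityʳ }
    ; *-ascent = λ s w l → ≈-trans (⟦⟧-*ₕ s w) (≡⇒≈ (⋆-ascent {s} {w} l))
    ; *-descent = λ s w ≮ → ≈-trans (⟦⟧-*ₕ s w) (≡⇒≈ (⋆-descent {s} {w} ≮))
    ; w₀ = λ I → proj₁ (maximum I I ε)
    ; w₀-∈ = λ I → ∼ε⇒∈⟨⟩ (proj₁ (proj₂ (maximum I I ε)))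
    ; w₀-longest = λ I u∈ → ≼⇒≤ (max-≼ I I ε (∈⟨⟩⇒∼ε u∈))
    ; max = λ I J p → proj₁ (maximum I J p)
    ; max-∈ = λ I J p → proj₁ (proj₂ (maximum I J p))
    ; max-≤ᴮ = λ I J p p∼x → ≼⇒Bruhat (max-≼ I J p p∼x)
    }
    where
    max-≼ : ∀ I J p {x} → p ∼[ I , J ] x → x ≼ proj₁ (maximum I J p)
    max-≼ I J p with maximum I J p
    ... | x , _ , p≼x , sat = saturated-max sat p≼x

-- Double cosets with W_I p = p = p W_J

map-range-injective : ∀ {f g : Value → Value} m k → map f (range m k) ≡ map g (range m k) →
  ∀ c → m ≤ c → c < m + k → f (pos c) ≡ g (pos c)
map-range-injective m zero    eq c m≤c c< = contradiction (subst (c <_) (ℕ.+-identityʳ m) c<) (ℕ.≤⇒≯ m≤c)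
map-range-injective m (suc k) eq c m≤c c< with ℕ.m≤n⇒m<n∨m≡n m≤c
... | inj₂ refl = List.∷-injectiveˡ eq
... | inj₁ m<c  = map-range-injective (suc m) k (List.∷-injectiveʳ eq) c m<c (subst (c <_) (ℕ.+-suc m k) c<)

transpose-moves : ∀ r s → transpose s r ≡ suc r → s ≡ r
transpose-moves r s eq with ℕ.<-cmp r s
... | tri≈ _ refl _ = refl
... | tri< r<s _ _ = contradiction (trans (sym (transpose-< r<s)) eq) (ℕ.<⇒≢ ℕ.≤-refl)
... | tri> _ _ s<r with ℕ.m≤n⇒m<n∨m≡n s<r
...   | inj₁ l    = contradiction (trans (sym (transpose-> l)) eq) (ℕ.<⇒≢ ℕ.≤-refl)
...   | inj₂ refl = contradiction (trans (sym (transpose-1+r s)) eq) (ℕ.<⇒≢ (ℕ.m≤n⇒m≤1+n ℕ.≤-refl))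

pos-injective : ∀ {a b} → pos a ≡ pos b → a ≡ b
pos-injective refl = refl

act-range-injective : ∀ {k} i j → i < k → j < k → act i (range 0 k) ≡ act j (range 0 k) → i ≡ j
act-range-injective {k} i j i< j< eq = go i j i< j< (map-range-injective 0 k (trans (sym (act-range i k i<)) (trans eq (act-range j k j<))))
  where
  go : ∀ i j → i < k → j < k → (∀ c → 0 ≤ c → c < k → actValue i (pos c) ≡ actValue j (pos c)) → i ≡ j
  go zero    zero    _  _  h = refl
  go zero    (suc j) i< j< h with () ← h 0 z≤n i<
  go (suc i) zero    i< j< h with () ← h 0 z≤n j<
  go (suc i) (suc j) i< j< h = cong suc (sym (transpose-moves i j
    (trans (sym (pos-injective (h i z≤n (ℕ.<-trans ℕ.≤-refl i<)))) (transpose-r i))))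

module DoubleCosets {n : ℕ} (𝒲 : CoxeterGroup.Calculus n) where

  open Coxeter n public
  private module C = CoxeterGroup.Calculus 𝒲
  open Algebroid 𝒲 public renaming (_∘_ to infixr 9 _⊙_)

  ⟦⟧-injective : ∀ {s t} → ⟦ s ⟧ ≈ ⟦ t ⟧ → s ≡ t
  ⟦⟧-injective {s} {t} eq = Fin.toℕ-injective
    (act-range-injective (toℕ s) (toℕ t) (Fin.toℕ<n s) (Fin.toℕ<n t) (window-cong eq))

  -- Both functions give the least length of a word for `w`. Thus inversion numbers compute the
  -- length of any calculus.
  ℓ≡ : ∀ w → C.ℓ w ≡ ℓ w
  ℓ≡ w with ℓ-attained w | C.ℓ-attained w
  ... | u , u≈ , lu | v , v≈ , lv = ℕ.≤-antisym
    (subst (C.ℓ w ≤_) lu (C.ℓ-minimal u≈)) (subst (ℓ w ≤_) lv (ℓ-minimal v≈))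

  -- Through this, maximality in the Bruhat order enters as a comparison of lengths.
  Bruhat-length : ∀ {x y} → x C.≤ᴮ y → x ≈ y ⊎ ℓ x < ℓ y
  Bruhat-length (reflexive p) = inj₁ p
  Bruhat-length (ascend {u} {v} {t} p _ l {w} eq) with Bruhat-length p
  ... | inj₁ u≈v = inj₂ (subst₂ _<_ (trans (ℓ≡ v) (sym (ℓ-cong u≈v))) (trans (ℓ≡ (v · t)) (ℓ-cong eq)) l)
  ... | inj₂ u<v = inj₂ (ℕ.<-trans u<v (subst₂ _<_ (ℓ≡ v) (trans (ℓ≡ (v · t)) (ℓ-cong eq)) l))

  LeftMinimal : Subset n → W → Set
  LeftMinimal I x = ∀ {s} → s ∈ I → s <ₗ x

  leftMinimal-≼ : ∀ {I x} → LeftMinimal I x → ∀ {v} → v ∈⟨ I ⟩ → x ≼ v · x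
  leftMinimal-≼ {I} {x} min (v̂ , v̂∈ , v̂≈) = ≼-trans (go v̂ v̂∈) (≼-reflexive (·-cong v̂≈ (≈-refl {x})))
    where
    go : ∀ v → All (_∈ I) v → x ≼ v · x
    go []      []       = ≼-reflexive ≈-refl
    go (s ∷ v) (i ∷ is) = lower (min i) (go v is)

  -- If `s` lengthened u but not u x, then the reflection u⁻¹ s u, which lies in W_I, would shorten
  -- x, against `leftMinimal-≼`.
  leftMinimal-ℓ : ∀ {I x} → LeftMinimal I x → ∀ {v} → v ∈⟨ I ⟩ → ℓ (v · x) ≡ ℓ v + ℓ x
  leftMinimal-ℓ {I} {x} min {v} (v̂ , v̂∈ , v̂≈) with reduceIn v̂ v̂∈
  ... | u , u∈ , ru , v̂≈u = trans (ℓ-cong (·-cong v≈u (≈-refl {x})))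
    (trans (go u∈ ru) (cong (_+ ℓ x) (trans (Reduced⇒tight ru) (ℓ-cong (≈-sym v≈u)))))
    where
    v≈u : v ≈ u
    v≈u = ≈-trans (≈-sym v̂≈) v̂≈u
    go : ∀ {u} → All (_∈ I) u → Reduced u → ℓ (u · x) ≡ length u + ℓ x
    go [] [] = refl
    go {s ∷ u} (i ∷ is) (a ∷ r) with ℓ (u · x) ℕ.<? ℓ (s ∷ u · x)
    ... | yes l = trans (<ₗ⇒≡ {s} {u · x} l) (cong suc (go is r))
    ... | no ≮ = contradiction (≼⇒≤ (leftMinimal-≼ min u⁻¹su∈))
        (ℕ.<⇒≱ (reflect-shorter {s} {u} (ℕ.≤-reflexive (sym (inversions-ascent a))) ≮ eq))
      where
      u⁻¹su∈ : u ⁻¹ · (s ∷ u) ∈⟨ I ⟩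
      u⁻¹su∈ = ⟨⟩-· (⟨⟩-⁻¹ (u , is , ≈-refl)) (s ∷ u , i ∷ is , ≈-refl)
      eq : u · ((u ⁻¹ · (s ∷ u)) · x) ≈ s ∷ u · x
      eq = ≈-trans (≈-sym (assoc u (u ⁻¹ · (s ∷ u)) x)) (·-cong
        (≈-trans (≈-sym (assoc u (u ⁻¹) (s ∷ u))) (·-cong (inverseʳ u) (≈-refl {s ∷ u}))) (≈-refl {x}))

  ε≼ : ∀ w → ε ≼ w
  ε≼ w = ≼-trans (go (reducedForm-reduced w)) (≼-reflexive (≈-sym (reducedForm-≈ w)))
    where
    go : ∀ {u} → Reduced u → ε ≼ u
    go [] = ≼-reflexive ≈-refl
    go {s ∷ u} (a ∷ r) = ≼-step (go r) (<ₗ⇒⋖ {s} {u} (ℕ.≤-reflexive (sym (inversions-ascent a))))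

  w₀-longest : ∀ I {u} → u ∈⟨ I ⟩ → ℓ u ≤ ℓ (C.w₀ I)
  w₀-longest I {u} u∈ = subst₂ _≤_ (ℓ≡ u) (ℓ≡ (C.w₀ I)) (C.w₀-longest I u∈)

  w₀-descents : ∀ {I s} → s ∈ I → ¬ s <ₗ C.w₀ I
  w₀-descents {I} {s} s∈ l = ℕ.<⇒≱ l (w₀-longest I (⟨⟩-· (⟨⟩-⟦⟧ s∈) (C.w₀-∈ I)))

  -- Starting from `ε`, which is below everything, `u` absorbs each letter of a word for the longest
  -- element. So that element lies below `u`, and lengths force equality.
  descents⇒w₀ : ∀ {I u} → u ∈⟨ I ⟩ → (∀ {s} → s ∈ I → ¬ s <ₗ u) → u ≈ C.w₀ I
  descents⇒w₀ {I} {u} u∈ sat with C.w₀-∈ I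
  ... | v , v∈ , v≈ with ≼-length (absorbWordˡ sat v v∈ (ε≼ u))
  ...   | inj₁ eq = ≈-sym (≈-trans (≈-sym v≈) (≈-trans (≡⇒≈ (sym (List.++-identityʳ v))) eq))
  ...   | inj₂ l  = contradiction (w₀-longest I u∈)
    (ℕ.<⇒≱ (subst (_< ℓ u) (ℓ-cong (≈-trans (≡⇒≈ (List.++-identityʳ v)) v≈)) l))

  longest⇒w₀ : ∀ {I u} → u ∈⟨ I ⟩ → ℓ (C.w₀ I) ≤ ℓ u → u ≈ C.w₀ I
  longest⇒w₀ {I} {u} u∈ l = descents⇒w₀ u∈ λ {s} s∈ l′ →
    ℕ.<⇒≱ l′ (ℕ.≤-trans (w₀-longest I (⟨⟩-· (⟨⟩-⟦⟧ s∈) u∈)) l)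

  -- x is the minimal element of a coset p with W_I p = p = p W_J.
  record Conjugates (J I : Subset n) (x : W) : Set where
    field
      left    : ∀ {s} → s ∈ I → ∃[ r ] r ∈ J × s ∷ x ≈ x · ⟦ r ⟧
      right   : ∀ {r} → r ∈ J → ∃[ s ] s ∈ I × s ∷ x ≈ x · ⟦ r ⟧
      minimal : LeftMinimal I x

  open Conjugates public

  module _ {J I x} (X : Conjugates J I x) where

    leftWord : ∀ v → All (_∈ I) v → ∃[ v′ ] All (_∈ J) v′ × length v′ ≡ length v × v · x ≈ x · v′
    leftWord []      []       = [] , [] , refl , ≡⇒≈ (sym (List.++-identityʳ x))
    leftWord (s ∷ v) (i ∷ is) with left X i | leftWord v is
    ... | r , r∈ , eq | v′ , v′∈ , len , eq′ = r ∷ v′ , r∈ ∷ v′∈ , cong suc len ,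
      ≈-trans (cons-cong s eq′) (≈-trans (·-cong eq (≈-refl {v′})) (assoc x ⟦ r ⟧ v′))

    rightWord : ∀ v → All (_∈ J) v → ∃[ v′ ] All (_∈ I) v′ × length v′ ≡ length v × v′ · x ≈ x · v
    rightWord []      []       = [] , [] , refl , ≡⇒≈ (sym (List.++-identityʳ x))
    rightWord (r ∷ v) (i ∷ is) with right X i | rightWord v is
    ... | s , s∈ , eq | v′ , v′∈ , len , eq′ = s ∷ v′ , s∈ ∷ v′∈ , cong suc len ,
      ≈-trans (cons-cong s eq′) (≈-trans (·-cong eq (≈-refl {v})) (assoc x ⟦ r ⟧ v))

    conjugateˡ : ∀ {v} → v ∈⟨ I ⟩ → ∃[ v′ ] v′ ∈⟨ J ⟩ × ℓ v′ ≤ ℓ v × v · x ≈ x · v′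
    conjugateˡ {v} (v̂ , v̂∈ , v̂≈) with reduceIn v̂ v̂∈
    ... | u , u∈ , ru , v̂≈u with leftWord u u∈
    ...   | v′ , v′∈ , len , eq = v′ , (v′ , v′∈ , ≈-refl)
      , subst (ℓ v′ ≤_) (trans len (trans (Reduced⇒tight ru) (ℓ-cong (≈-sym v≈u)))) (inversions-≤-length v′)
      , ≈-trans (·-cong v≈u (≈-refl {x})) eq
      where
      v≈u : v ≈ u
      v≈u = ≈-trans (≈-sym v̂≈) v̂≈u

    conjugateʳ : ∀ {v} → v ∈⟨ J ⟩ → ∃[ v′ ] v′ ∈⟨ I ⟩ × ℓ v′ ≤ ℓ v × v′ · x ≈ x · v
    conjugateʳ {v} (v̂ , v̂∈ , v̂≈) with reduceIn v̂ v̂∈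
    ... | u , u∈ , ru , v̂≈u with rightWord u u∈
    ...   | v′ , v′∈ , len , eq = v′ , (v′ , v′∈ , ≈-refl)
      , subst (ℓ v′ ≤_) (trans len (trans (Reduced⇒tight ru) (ℓ-cong (≈-sym v≈u)))) (inversions-≤-length v′)
      , ≈-trans eq (·-cong (≈-refl {x}) (≈-sym v≈u))
      where
      v≈u : v ≈ u
      v≈u = ≈-trans (≈-sym v̂≈) v̂≈u

    ℓ-w₀ : ℓ (C.w₀ I) ≡ ℓ (C.w₀ J)
    ℓ-w₀ with conjugateˡ (C.w₀-∈ I) | conjugateʳ (C.w₀-∈ J)
    ... | v , v∈ , lv , eqᵥ | u , u∈ , lu , eqᵤ with conjugateʳ v∈ | conjugateˡ u∈
    ...   | u′ , u′∈ , lu′ , equ′ | v′ , v′∈ , lv′ , eqv′ = ℕ.≤-antisym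
      (ℕ.≤-trans (ℕ.≤-reflexive (ℓ-cong (G.∙-cancelʳ x (C.w₀ I) u′ (≈-trans eqᵥ (≈-sym equ′)))))
        (ℕ.≤-trans lu′ (w₀-longest J v∈)))
      (ℕ.≤-trans (ℕ.≤-reflexive (ℓ-cong (cancelˡ x {C.w₀ J} {v′} (≈-trans (≈-sym eqᵤ) eqv′))))
        (ℕ.≤-trans lv′ (w₀-longest I u∈)))

    -- Conjugation by x identifies W_I with W_J and raises lengths in neither direction, so it takes
    -- the longest element to the longest element.
    conjugate-w₀ : C.w₀ I · x ≈ x · C.w₀ J
    conjugate-w₀ with conjugateˡ (C.w₀-∈ I)
    ... | v , v∈ , lv , eqᵥ with conjugateʳ v∈
    ...   | u , u∈ , lu , eqᵤ = ≈-trans eqᵥ (·-cong (≈-refl {x}) (longest⇒w₀ v∈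
      (subst (_≤ ℓ v) (trans (ℓ-cong (G.∙-cancelʳ x u (C.w₀ I) (≈-trans eqᵤ (≈-sym eqᵥ)))) ℓ-w₀) lu)))

    ℓ-w₀·x : ℓ (C.w₀ I · x) ≡ ℓ (C.w₀ I) + ℓ x
    ℓ-w₀·x = leftMinimal-ℓ (minimal X) (C.w₀-∈ I)

    ℓ-x·w₀ : ℓ (x · C.w₀ J) ≡ ℓ x + ℓ (C.w₀ J)
    ℓ-x·w₀ = trans (ℓ-cong (≈-sym conjugate-w₀)) (trans ℓ-w₀·x (trans (ℕ.+-comm _ (ℓ x)) (cong (ℓ x +_) ℓ-w₀)))

    ∼⇒mul : ∀ {y} → x ∼[ I , J ] y → ∃[ u ] u ∈⟨ I ⟩ × u · x ≈ y
    ∼⇒mul {y} (u , v , u∈ , v∈ , eq) with conjugateʳ v∈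
    ... | v′ , v′∈ , _ , eq′ = u · v′ , ⟨⟩-· u∈ v′∈ ,
      ≈-trans (assoc u v′ x) (≈-trans (·-cong (≈-refl {u}) eq′) (≈-trans (≈-sym (assoc u x v)) eq))

    -- Elements of the coset have the form u x with u in W_I and length ℓ u + ℓ x, so none is longer
    -- than this one.
    max≈ : C.max I J x ≈ C.w₀ I · x
    max≈ with ∼⇒mul (C.max-∈ I J x)
    ... | u , u∈ , eq with Bruhat-length (C.max-≤ᴮ I J x {C.w₀ I · x} (∼-mulˡ (C.w₀-∈ I) (∼-reflexive ≈-refl)))
    ...   | inj₁ eq′ = ≈-sym eq′
    ...   | inj₂ l   = contradiction
      (ℕ.≤-trans (ℕ.≤-reflexive (trans (ℓ-cong (≈-sym eq)) (leftMinimal-ℓ (minimal X) u∈)))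
        (ℕ.≤-trans (ℕ.+-monoˡ-≤ (ℓ x) (w₀-longest I u∈)) (ℕ.≤-reflexive (sym ℓ-w₀·x))))
      (ℕ.<⇒≱ l)

  -- With y = u x, minimality of x and of y gives ℓ y = ℓ u + ℓ x and ℓ x = ℓ (u⁻¹) + ℓ y, so u is
  -- trivial.
  Conjugates-distinct : ∀ {J I x y} → Conjugates J I x → Conjugates J I y → x ∼[ I , J ] y → x ≈ y
  Conjugates-distinct {x = x} {y} X Y x∼y with ∼⇒mul X x∼y
  ... | u , u∈ , ux≈y = ≈-trans (·-cong (≈-sym u≈ε) (≈-refl {x})) ux≈y
    where
    ℓy : ℓ y ≡ ℓ u + ℓ x
    ℓy = trans (ℓ-cong (≈-sym ux≈y)) (leftMinimal-ℓ (minimal X) u∈)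
    ℓx : ℓ x ≡ ℓ (u ⁻¹) + ℓ y
    ℓx = trans (ℓ-cong (≈-trans (·-cong (≈-sym (inverseˡ u)) (≈-refl {x}))
        (≈-trans (assoc (u ⁻¹) u x) (·-cong (≈-refl {u ⁻¹}) ux≈y))))
      (leftMinimal-ℓ (minimal Y) (⟨⟩-⁻¹ u∈))
    u≈ε : u ≈ ε
    u≈ε = ℓ≡0⇒≈ε (ℕ.n≤0⇒n≡0 (ℕ.+-cancelʳ-≤ (ℓ x) (ℓ u) 0 (ℕ.≤-trans (ℕ.≤-reflexive (sym ℓy))
      (ℕ.≤-trans (ℕ.m≤n+m (ℓ y) (ℓ (u ⁻¹))) (ℕ.≤-reflexive (sym ℓx))))))

  Conjugates-ε : ∀ {J} → Conjugates J J ε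
  Conjugates-ε = record
    { left = λ {s} s∈ → s , s∈ , ≈-refl ; right = λ {s} s∈ → s , s∈ , ≈-refl ; minimal = λ {s} _ → <ₗ-ε s }

  -- For minimality, write s x = x t with t in `J`. If `s` did not lengthen x y, the reflection x⁻¹
  -- s x = t would shorten y, against the minimality of y.
  Conjugates-· : ∀ {I J K x y} → Conjugates J I x → Conjugates K J y → Conjugates K I (x · y)
  Conjugates-· {I} {J} {K} {x} {y} X Y = record { left = l ; right = r ; minimal = m }
    where
    join : ∀ {s t r} → s ∷ x ≈ x · ⟦ t ⟧ → t ∷ y ≈ y · ⟦ r ⟧ → s ∷ x · y ≈ (x · y) · ⟦ r ⟧
    join {s} {t} {r} p q = ≈-trans (·-cong p (≈-refl {y})) (≈-trans (assoc x ⟦ t ⟧ y)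
      (≈-trans (·-cong (≈-refl {x}) q) (≈-sym (assoc x y ⟦ r ⟧))))
    l : ∀ {s} → s ∈ I → ∃[ r ] r ∈ K × s ∷ x · y ≈ (x · y) · ⟦ r ⟧
    l s∈ with left X s∈
    ... | t , t∈ , p with left Y t∈
    ...   | r , r∈ , q = r , r∈ , join p q
    r : ∀ {r} → r ∈ K → ∃[ s ] s ∈ I × s ∷ x · y ≈ (x · y) · ⟦ r ⟧
    r r∈ with right Y r∈
    ... | t , t∈ , q with right X t∈
    ...   | s , s∈ , p = s , s∈ , join p q
    m : LeftMinimal I (x · y)
    m {s} s∈ with left X s∈ | ℓ (x · y) ℕ.<? ℓ (s ∷ x · y)
    ... | _ | yes l = l
    ... | t , t∈ , p | no ≮ = contradiction (minimal Y t∈) (ℕ.<-asym (reflect-shorter {s} {x} (minimal X s∈) ≮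
      (≈-trans (≈-sym (assoc x ⟦ t ⟧ y)) (·-cong (≈-sym p) (≈-refl {y})))))

  open IsMonoid C.*-monoid using () renaming (∙-cong to *-cong; assoc to *-assoc; identityˡ to *-identityˡ)

  *-⟦⟧-ascent : ∀ {s w} → s <ₗ w → ⟦ s ⟧ C.* w ≈ s ∷ w
  *-⟦⟧-ascent {s} {w} l = C.*-ascent s w (subst₂ _<_ (sym (ℓ≡ w)) (sym (ℓ≡ (s ∷ w))) l)

  *-⟦⟧-descent : ∀ {s w} → ¬ s <ₗ w → ⟦ s ⟧ C.* w ≈ w
  *-⟦⟧-descent {s} {w} ≮ = C.*-descent s w (≮ ∘ subst₂ _<_ (ℓ≡ w) (ℓ≡ (s ∷ w)))

  *-cons : ∀ {s u} → s <ₗ u → ∀ v → (s ∷ u) C.* v ≈ ⟦ s ⟧ C.* (u C.* v)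
  *-cons {s} {u} l v = ≈-trans (*-cong (≈-sym (*-⟦⟧-ascent {s} {u} l)) (≈-refl {v})) (*-assoc ⟦ s ⟧ u v)

  *-additive : ∀ u v → ℓ (u · v) ≡ ℓ u + ℓ v → u C.* v ≈ u · v
  *-additive u v eq = ≈-trans (*-cong (reducedForm-≈ u) (≈-refl {v}))
    (≈-trans (go (reducedForm-reduced u) (trans (ℓ-cong (·-cong (≈-sym (reducedForm-≈ u)) (≈-refl {v})))
                   (trans eq (cong (_+ ℓ v) (ℓ-cong (reducedForm-≈ u))))))
             (·-cong (≈-sym (reducedForm-≈ u)) (≈-refl {v})))
    where
    go : ∀ {u} → Reduced u → ℓ (u · v) ≡ ℓ u + ℓ v → u C.* v ≈ u · v
    go [] _ = *-identityˡ v
    go {s ∷ u} (a ∷ r) eq = ≈-trans (*-cons {s} {u} (ℕ.≤-reflexive (sym a≡)) v)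
      (≈-trans (*-cong (≈-refl {⟦ s ⟧}) (go r uv≡)) (*-⟦⟧-ascent {s} {u · v} (ℕ.≤-reflexive (sym suv≡))))
      where
      a≡ : ℓ (s ∷ u) ≡ suc (ℓ u)
      a≡ = inversions-ascent a
      suv≡ : ℓ (s ∷ u · v) ≡ suc (ℓ (u · v))
      suv≡ with length-step s (u · v)
      ... | inj₁ eq′ = eq′
      ... | inj₂ eq′ = contradiction (ℓ-subadditive u v) (ℕ.<⇒≱ (ℕ.<⇒≤
        (ℕ.≤-reflexive (trans (cong suc (sym (trans eq (cong (_+ ℓ v) a≡)))) (sym eq′)))))
      uv≡ : ℓ (u · v) ≡ ℓ u + ℓ v
      uv≡ = ℕ.suc-injective (trans (sym suv≡) (trans eq (cong (_+ ℓ v) a≡)))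

  *-w₀-absorb : ∀ {J v} → v ∈⟨ J ⟩ → v C.* C.w₀ J ≈ C.w₀ J
  *-w₀-absorb {J} {v} (v̂ , v̂∈ , v̂≈) with reduceIn v̂ v̂∈
  ... | u , u∈ , ru , v̂≈u = ≈-trans (*-cong (≈-trans (≈-sym v̂≈) v̂≈u) (≈-refl {C.w₀ J})) (go u∈ ru)
    where
    go : ∀ {u} → All (_∈ J) u → Reduced u → u C.* C.w₀ J ≈ C.w₀ J
    go [] [] = *-identityˡ (C.w₀ J)
    go {s ∷ u} (i ∷ is) (a ∷ r) = ≈-trans (*-cons {s} {u} (ℕ.≤-reflexive (sym (inversions-ascent a))) (C.w₀ J))
      (≈-trans (*-cong (≈-refl {⟦ s ⟧}) (go is r)) (*-⟦⟧-descent {s} (w₀-descents i)))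

  Additive : Rel W 0ℓ
  Additive x y = ℓ (x · y) ≡ ℓ x + ℓ y

  module _ {I J K x y} (X : Conjugates J I x) (Y : Conjugates K J y) where

    private
      p̄ = C.max I J x
      q̄ = C.max J K y
      w = C.w₀ J

      p̄≈ : p̄ ≈ x · w
      p̄≈ = ≈-trans (max≈ X) (conjugate-w₀ X)

      q̄≈ : q̄ ≈ w · y
      q̄≈ = max≈ Y

      xwy≈ : x · (w · y) ≈ (x · y) · C.w₀ K
      xwy≈ = ≈-trans (·-cong (≈-refl {x}) (conjugate-w₀ Y)) (≈-sym (assoc x y (C.w₀ K)))

      ℓ-wy : ℓ (w · y) ≡ ℓ w + ℓ y
      ℓ-wy = ℓ-w₀·x Y

      product≈ : (p̄ · w ⁻¹) · q̄ ≈ x · (w · y)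
      product≈ = ·-cong (≈-trans (·-cong p̄≈ (≈-refl {w ⁻¹})) (≈-trans (assoc x w (w ⁻¹))
        (≈-trans (·-cong (≈-refl {x}) (inverseʳ w)) (≡⇒≈ (List.++-identityʳ x))))) q̄≈

      rearrange : ∀ a b c → (a + (b + c)) + b ≡ (a + b) + (b + c)
      rearrange a b c = trans (ℕ.+-assoc a (b + c) b) (trans (cong (a +_) (ℕ.+-comm (b + c) b)) (sym (ℕ.+-assoc a b (b + c))))

    -- With w the longest element of W_J, the maxima are x w and w y, and all three lengths add up
    -- along x w y.
    additive⇒reduced : Additive x y → IsReduced I J K x y
    additive⇒reduced xy = ≈-trans star≈ (≈-sym product≈) , (begin
      C.ℓ (p̄ C.* q̄) + C.ℓ w ≡⟨ cong₂ _+_ (trans (ℓ≡ _) (ℓ-cong star≈)) (ℓ≡ w) ⟩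
      ℓ (x · (w · y)) + ℓ w ≡⟨ cong (_+ ℓ w) (trans ℓ-xwy (cong (ℓ x +_) ℓ-wy)) ⟩
      (ℓ x + (ℓ w + ℓ y)) + ℓ w ≡⟨ rearrange (ℓ x) (ℓ w) (ℓ y) ⟩
      (ℓ x + ℓ w) + (ℓ w + ℓ y) ≡⟨ cong₂ _+_ (ℓ-x·w₀ X) ℓ-wy ⟨
      ℓ (x · w) + ℓ (w · y) ≡⟨ cong₂ _+_ (trans (ℓ≡ p̄) (ℓ-cong p̄≈)) (trans (ℓ≡ q̄) (ℓ-cong q̄≈)) ⟨
      C.ℓ p̄ + C.ℓ q̄ ∎)
      where
      open ≡-Reasoning
      ℓ-xwy : ℓ (x · (w · y)) ≡ ℓ x + ℓ (w · y)
      ℓ-xwy = begin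
        ℓ (x · (w · y)) ≡⟨ ℓ-cong xwy≈ ⟩
        ℓ ((x · y) · C.w₀ K) ≡⟨ ℓ-x·w₀ (Conjugates-· X Y) ⟩
        ℓ (x · y) + ℓ (C.w₀ K) ≡⟨ cong₂ _+_ xy (sym (ℓ-w₀ Y)) ⟩
        (ℓ x + ℓ y) + ℓ w ≡⟨ ℕ.+-assoc (ℓ x) (ℓ y) (ℓ w) ⟩
        ℓ x + (ℓ y + ℓ w) ≡⟨ cong (ℓ x +_) (trans (ℕ.+-comm (ℓ y) (ℓ w)) (sym ℓ-wy)) ⟩
        ℓ x + ℓ (w · y) ∎
      -- In the 0-Hecke product of x w and w y the two copies of w merge, because w absorbs elements
      -- of W_J.
      star≈ : p̄ C.* q̄ ≈ x · (w · y)
      star≈ = ≈-trans (*-cong p̄≈ q̄≈)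
        (≈-trans (*-cong (≈-sym (*-additive x w (ℓ-x·w₀ X))) (≈-sym (*-additive w y ℓ-wy)))
        (≈-trans (*-assoc x w (w C.* y))
        (≈-trans (*-cong (≈-refl {x}) (≈-trans (≈-sym (*-assoc w w y))
                   (≈-trans (*-cong (*-w₀-absorb (C.w₀-∈ J)) (≈-refl {y})) (*-additive w y ℓ-wy))))
                 (*-additive x (w · y) ℓ-xwy))))

    -- Reducedness makes x w y of length ℓ x + ℓ w + ℓ y. Moving w past y shows that this length is
    -- at most ℓ (x y) + ℓ w, and ℓ w cancels.
    reduced⇒additive : IsReduced I J K x y → Additive x y
    reduced⇒additive (star≈ , eq) = ℕ.≤-antisym (ℓ-subadditive x y)
      (ℕ.+-cancelʳ-≤ (ℓ w) (ℓ x + ℓ y) (ℓ (x · y)) (begin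
        (ℓ x + ℓ y) + ℓ w ≡⟨ trans (ℕ.+-assoc (ℓ x) (ℓ y) (ℓ w)) (cong (ℓ x +_) (ℕ.+-comm (ℓ y) (ℓ w))) ⟩
        ℓ x + (ℓ w + ℓ y) ≡⟨ ℕ.+-cancelʳ-≡ (ℓ w) (ℓ (x · (w · y))) (ℓ x + (ℓ w + ℓ y)) eq′ ⟨
        ℓ (x · (w · y)) ≡⟨ ℓ-cong xwy≈ ⟩
        ℓ ((x · y) · C.w₀ K) ≤⟨ ℓ-subadditive (x · y) (C.w₀ K) ⟩
        ℓ (x · y) + ℓ (C.w₀ K) ≡⟨ cong (ℓ (x · y) +_) (ℓ-w₀ Y) ⟨
        ℓ (x · y) + ℓ w ∎))
      where
      open ℕ.≤-Reasoning
      eq′ : ℓ (x · (w · y)) + ℓ w ≡ (ℓ x + (ℓ w + ℓ y)) + ℓ w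
      eq′ = trans (cong₂ _+_ (sym (trans (ℓ≡ _) (ℓ-cong (≈-trans star≈ product≈)))) (sym (ℓ≡ w)))
        (trans eq (trans (cong₂ _+_ (trans (ℓ≡ p̄) (trans (ℓ-cong p̄≈) (ℓ-x·w₀ X))) (trans (ℓ≡ q̄) (trans (ℓ-cong q̄≈) ℓ-wy)))
        (sym (rearrange (ℓ x) (ℓ w) (ℓ y)))))

    ⋆∼ : IsReduced I J K x y → x · y ∼[ I , K ] _⋆_ I J K x y
    ⋆∼ (star≈ , _) = ε , C.w₀ K , ⟨⟩-ε , C.w₀-∈ K , ≈-sym (≈-trans star≈ (≈-trans product≈ xwy≈))

    ∂⊙∂-additive : Additive x y → ∂ {J} {I} x ⊙ ∂ {K} y ≋ ∂ (x · y)
    ∂⊙∂-additive xy with isReduced? I J K x y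
    ... | yes red  = ≋-sym (∂-cong (⋆∼ red))
    ... | no  ¬red = contradiction (additive⇒reduced xy) ¬red

    ∂⊙∂-nonadditive : ¬ Additive x y → ∂ {J} {I} x ⊙ ∂ {K} y ≋ 0#
    ∂⊙∂-nonadditive ¬xy with isReduced? I J K x y
    ... | yes red  = contradiction (reduced⇒additive red) ¬xy
    ... | no  ¬red = ≋-refl

-- Composition in 𝒟

module Composition {n : ℕ} (𝒲 : CoxeterGroup.Calculus n) where

  open DoubleCosets 𝒲 public
  private module C = CoxeterGroup.Calculus 𝒲
  open IsMonoid C.*-monoid using () renaming (∙-cong to *-cong)

  ∼-sym : ∀ {I J x y} → x ∼[ I , J ] y → y ∼[ I , J ] x
  ∼-sym {x = x} {y} (u , v , u∈ , v∈ , eq) = u ⁻¹ , v ⁻¹ , ⟨⟩-⁻¹ u∈ , ⟨⟩-⁻¹ v∈ , (begin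
    (u ⁻¹ · y) · v ⁻¹ ≈⟨ ·-cong (·-cong (≈-refl {u ⁻¹}) eq) (≈-refl {v ⁻¹}) ⟨
    (u ⁻¹ · ((u · x) · v)) · v ⁻¹ ≈⟨ ·-cong (·-cong (≈-refl {u ⁻¹}) (assoc u x v)) (≈-refl {v ⁻¹}) ⟩
    (u ⁻¹ · (u · (x · v))) · v ⁻¹ ≈⟨ ·-cong (assoc (u ⁻¹) u (x · v)) (≈-refl {v ⁻¹}) ⟨
    ((u ⁻¹ · u) · (x · v)) · v ⁻¹ ≈⟨ ·-cong (·-cong (inverseˡ u) (≈-refl {x · v})) (≈-refl {v ⁻¹}) ⟩
    (x · v) · v ⁻¹ ≈⟨ assoc x v (v ⁻¹) ⟩
    x · (v · v ⁻¹) ≈⟨ ·-cong (≈-refl {x}) (inverseʳ v) ⟩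
    x · ε ≈⟨ ≡⇒≈ (List.++-identityʳ x) ⟩
    x ∎)
    where open ≈-Reasoning

  ∼-resp : ∀ {I J x y z} → x ∼[ I , J ] y → y ≈ z → x ∼[ I , J ] z
  ∼-resp (u , v , u∈ , v∈ , eq) p = u , v , u∈ , v∈ , ≈-trans eq p

  ∼-trans : ∀ {I J x y z} → x ∼[ I , J ] y → y ∼[ I , J ] z → x ∼[ I , J ] z
  ∼-trans p (u , v , u∈ , v∈ , eq) = ∼-resp (∼-mulʳ v∈ (∼-mulˡ u∈ p)) eq

  max-cong : ∀ {I J p q} → p ∼[ I , J ] q → C.max I J p ≈ C.max I J q
  max-cong {I} {J} {p} {q} p∼q
    with Bruhat-length (C.max-≤ᴮ I J p (∼-trans p∼q (C.max-∈ I J q)))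
       | Bruhat-length (C.max-≤ᴮ I J q (∼-trans (∼-sym p∼q) (C.max-∈ I J p)))
  ... | inj₁ eq | _       = ≈-sym eq
  ... | inj₂ _  | inj₁ eq = eq
  ... | inj₂ l  | inj₂ l′ = contradiction l (ℕ.<-asym l′)

  -- The maximal element is a normal form of its double coset, and equality in W is decidable.
  _∼?_ : ∀ {I J} p q → Dec (p ∼[ I , J ] q)
  _∼?_ {I} {J} p q with C.max I J p ≟ C.max I J q
  ... | yes eq = yes (∼-trans (∼-resp (C.max-∈ I J p) eq) (∼-sym (C.max-∈ I J q)))
  ... | no ¬eq = no (¬eq ∘ max-cong)

  IsReduced-cong : ∀ {I J K p p′ q q′} → p ∼[ I , J ] p′ → q ∼[ J , K ] q′ → IsReduced I J K p q → IsReduced I J K p′ q′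
  IsReduced-cong {I} {J} {K} {p} {p′} {q} {q′} pp qq (star , eq) =
    ≈-trans (≈-sym star≈) (≈-trans star (·-cong (·-cong p≈ (≈-refl {C.w₀ J ⁻¹})) q≈)) ,
    trans (cong (_+ C.ℓ (C.w₀ J)) (C-cong (≈-sym star≈))) (trans eq (cong₂ _+_ (C-cong p≈) (C-cong q≈)))
    where
    p≈ = max-cong pp
    q≈ = max-cong qq
    star≈ = *-cong p≈ q≈
    C-cong : ∀ {v w} → v ≈ w → C.ℓ v ≡ C.ℓ w
    C-cong {v} {w} v≈w = trans (ℓ≡ v) (trans (ℓ-cong v≈w) (sym (ℓ≡ w)))

  ∂⊙∂-cong : ∀ {I J K p p′ q q′} → p ∼[ I , J ] p′ → q ∼[ J , K ] q′ →
    ∂ {J} {I} p ⊙ ∂ {K} q ≋ ∂ {J} {I} p′ ⊙ ∂ {K} q′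
  ∂⊙∂-cong {I} {J} {K} {p} {p′} {q} {q′} pp qq with isReduced? I J K p q | isReduced? I J K p′ q′
  ... | yes _ | yes _  = ∂-cong (∼-reflexive (*-cong (max-cong pp) (max-cong qq)))
  ... | no _  | no _   = ≋-refl
  ... | yes r | no ¬r′ = contradiction (IsReduced-cong {p = p} {q = q} pp qq r) ¬r′
  ... | no ¬r | yes r′ = contradiction (IsReduced-cong {p = p′} {q = q′} (∼-sym pp) (∼-sym qq) r′) ¬r

  morphisms : Subset n → Subset n → AbelianGroup 0ℓ 0ℓ
  morphisms J I = record
    { Carrier = Morphism J I ; _≈_ = _≋_ ; _∙_ = _⊕_ ; ε = 0# ; _⁻¹ = ⊖_
    ; isAbelianGroup = record
      { isGroup = record
        { isMonoid = record
          { isSemigroup = record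
            { isMagma = record
              { isEquivalence = record { refl = ≋-refl ; sym = ≋-sym ; trans = ≋-trans }
              ; ∙-cong = ⊕-cong }
            ; assoc = ⊕-assoc }
          ; identity = ⊕-identityˡ , λ f → ≋-trans (⊕-comm f 0#) (⊕-identityˡ f) }
        ; inverse = ⊖-inverseˡ , λ f → ≋-trans (⊕-comm f (⊖ f)) (⊖-inverseˡ f)
        ; ⁻¹-cong = ⊖-cong }
      ; comm = ⊕-comm }
    }

  ⊕-medial : ∀ {J I} (f g h k : Morphism J I) → (f ⊕ g) ⊕ (h ⊕ k) ≋ (f ⊕ h) ⊕ (g ⊕ k)
  ⊕-medial {J} {I} = CommutativeSemigroupProperties.interchange (AbelianGroup.commutativeSemigroup (morphisms J I))

  ⊖-⊕ : ∀ {J I} (f g : Morphism J I) → (⊖ f) ⊕ (⊖ g) ≋ ⊖ (f ⊕ g)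
  ⊖-⊕ {J} {I} = AbelianGroupProperties.⁻¹-∙-comm (morphisms J I)

  ⊖-0# : ∀ {J I} → ⊖ 0# ≋ 0# {J} {I}
  ⊖-0# {J} {I} = GroupProperties.ε⁻¹≈ε (AbelianGroup.group (morphisms J I))

  ⊙-congʳ : ∀ {I J K} (f : Morphism J I) {g g′ : Morphism K J} → g ≋ g′ → f ⊙ g ≋ f ⊙ g′
  ⊙-congʳ (∂ p) (∂-cong q∼q′) = ∂⊙∂-cong (∼-reflexive ≈-refl) q∼q′
  ⊙-congʳ (∂ p) ≋-refl = ≋-refl
  ⊙-congʳ (∂ p) (≋-sym e) = ≋-sym (⊙-congʳ (∂ p) e)
  ⊙-congʳ (∂ p) (≋-trans e e′) = ≋-trans (⊙-congʳ (∂ p) e) (⊙-congʳ (∂ p) e′)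
  ⊙-congʳ (∂ p) (⊕-cong e e′) = ⊕-cong (⊙-congʳ (∂ p) e) (⊙-congʳ (∂ p) e′)
  ⊙-congʳ (∂ p) (⊖-cong e) = ⊖-cong (⊙-congʳ (∂ p) e)
  ⊙-congʳ (∂ p) (⊕-assoc f g h) = ⊕-assoc (∂ p ⊙ f) (∂ p ⊙ g) (∂ p ⊙ h)
  ⊙-congʳ (∂ p) (⊕-comm f g) = ⊕-comm (∂ p ⊙ f) (∂ p ⊙ g)
  ⊙-congʳ (∂ p) (⊕-identityˡ f) = ⊕-identityˡ (∂ p ⊙ f)
  ⊙-congʳ (∂ p) (⊖-inverseˡ f) = ⊖-inverseˡ (∂ p ⊙ f)
  ⊙-congʳ 0# e = ≋-refl
  ⊙-congʳ (f ⊕ f′) e = ⊕-cong (⊙-congʳ f e) (⊙-congʳ f′ e)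
  ⊙-congʳ (⊖ f) e = ⊖-cong (⊙-congʳ f e)

  ⊙-congˡ-∂ : ∀ {I J K} {p p′} → p ∼[ I , J ] p′ → (h : Morphism K J) → ∂ {J} {I} p ⊙ h ≋ ∂ {J} {I} p′ ⊙ h
  ⊙-congˡ-∂ e (∂ q) = ∂⊙∂-cong e (∼-reflexive ≈-refl)
  ⊙-congˡ-∂ e 0# = ≋-refl
  ⊙-congˡ-∂ e (g ⊕ h) = ⊕-cong (⊙-congˡ-∂ e g) (⊙-congˡ-∂ e h)
  ⊙-congˡ-∂ e (⊖ h) = ⊖-cong (⊙-congˡ-∂ e h)

  ⊙-congˡ : ∀ {I J K} {f f′ : Morphism J I} → f ≋ f′ → (h : Morphism K J) → f ⊙ h ≋ f′ ⊙ h
  ⊙-congˡ (∂-cong e) h = ⊙-congˡ-∂ e h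
  ⊙-congˡ ≋-refl h = ≋-refl
  ⊙-congˡ (≋-sym e) h = ≋-sym (⊙-congˡ e h)
  ⊙-congˡ (≋-trans e e′) h = ≋-trans (⊙-congˡ e h) (⊙-congˡ e′ h)
  ⊙-congˡ (⊕-cong e e′) h = ⊕-cong (⊙-congˡ e h) (⊙-congˡ e′ h)
  ⊙-congˡ (⊖-cong e) h = ⊖-cong (⊙-congˡ e h)
  ⊙-congˡ (⊕-assoc f g k) h = ⊕-assoc (f ⊙ h) (g ⊙ h) (k ⊙ h)
  ⊙-congˡ (⊕-comm f g) h = ⊕-comm (f ⊙ h) (g ⊙ h)
  ⊙-congˡ (⊕-identityˡ f) h = ⊕-identityˡ (f ⊙ h)
  ⊙-congˡ (⊖-inverseˡ f) h = ⊖-inverseˡ (f ⊙ h)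

  ⊙-cong : ∀ {I J K} {f f′ : Morphism J I} {g g′ : Morphism K J} → f ≋ f′ → g ≋ g′ → f ⊙ g ≋ f′ ⊙ g′
  ⊙-cong {f = f} {g′ = g′} e e′ = ≋-trans (⊙-congʳ f e′) (⊙-congˡ e g′)

  ⊙-distribˡ : ∀ {I J K} (f : Morphism J I) (g h : Morphism K J) → f ⊙ (g ⊕ h) ≋ f ⊙ g ⊕ f ⊙ h
  ⊙-distribˡ (∂ p) g h = ≋-refl
  ⊙-distribˡ 0# g h = ≋-sym (⊕-identityˡ 0#)
  ⊙-distribˡ (f ⊕ f′) g h = ≋-trans (⊕-cong (⊙-distribˡ f g h) (⊙-distribˡ f′ g h))
    (⊕-medial (f ⊙ g) (f ⊙ h) (f′ ⊙ g) (f′ ⊙ h))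
  ⊙-distribˡ (⊖ f) g h = ≋-trans (⊖-cong (⊙-distribˡ f g h)) (≋-sym (⊖-⊕ (f ⊙ g) (f ⊙ h)))

  -- The combinations on which the composition of two basis elements is decided by `Additive`. The
  -- predicate concerns the formal expression, so it is carried along `_≋_` separately, in
  -- `Spanned`.
  data Span {J I} : Morphism J I → Set where
    basis : ∀ {x} → Conjugates J I x → Span (∂ x)
    0ˢ    : Span 0#
    _⊕ˢ_  : ∀ {f g} → Span f → Span g → Span (f ⊕ g)
    ⊖ˢ_   : ∀ {f} → Span f → Span (⊖ f)

  Additive? : ∀ x y → Dec (Additive x y)
  Additive? x y = ℓ (x · y) ℕ.≟ ℓ x + ℓ y

  Additive-assocˡ : ∀ {x y z} → Additive y z → Additive x (y · z) → Additive x y × Additive (x · y) z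
  Additive-assocˡ {x} {y} {z} yz xyz = xy , trans (ℓ-cong (assoc x y z)) (trans xyz′ (cong (_+ ℓ z) (sym xy)))
    where
    xyz′ : ℓ (x · (y · z)) ≡ (ℓ x + ℓ y) + ℓ z
    xyz′ = trans xyz (trans (cong (ℓ x +_) yz) (sym (ℕ.+-assoc (ℓ x) (ℓ y) (ℓ z))))
    xy : Additive x y
    xy = ℕ.≤-antisym (ℓ-subadditive x y) (ℕ.+-cancelʳ-≤ (ℓ z) (ℓ x + ℓ y) (ℓ (x · y))
      (ℕ.≤-trans (ℕ.≤-reflexive (trans (sym xyz′) (ℓ-cong (≈-sym (assoc x y z))))) (ℓ-subadditive (x · y) z)))

  Additive-assocʳ : ∀ {x y z} → Additive x y → Additive (x · y) z → Additive y z × Additive x (y · z)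
  Additive-assocʳ {x} {y} {z} xy xyz = yz , trans (ℓ-cong (≈-sym (assoc x y z))) (trans xyz′ (cong (ℓ x +_) (sym yz)))
    where
    xyz′ : ℓ ((x · y) · z) ≡ ℓ x + (ℓ y + ℓ z)
    xyz′ = trans xyz (trans (cong (_+ ℓ z) xy) (ℕ.+-assoc (ℓ x) (ℓ y) (ℓ z)))
    yz : Additive y z
    yz = ℕ.≤-antisym (ℓ-subadditive y z) (ℕ.+-cancelˡ-≤ (ℓ x) (ℓ y + ℓ z) (ℓ (y · z))
      (ℕ.≤-trans (ℕ.≤-reflexive (trans (sym xyz′) (ℓ-cong (assoc x y z)))) (ℓ-subadditive x (y · z))))

  -- Either bracketing gives the basis element of x y z if all three lengths add, and zero
  -- otherwise.
  ∂-assoc : ∀ {I J K L x y z} → Conjugates J I x → Conjugates K J y → Conjugates L K z →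
    (∂ {J} {I} x ⊙ ∂ {K} y) ⊙ ∂ {L} z ≋ ∂ {J} {I} x ⊙ (∂ {K} {J} y ⊙ ∂ {L} {K} z)
  ∂-assoc {x = x} {y} {z} X Y Z with Additive? x y | Additive? y z
  ... | no ¬xy | no ¬yz = ≋-trans (⊙-congˡ (∂⊙∂-nonadditive X Y ¬xy) (∂ z))
    (≋-sym (⊙-congʳ (∂ x) (∂⊙∂-nonadditive Y Z ¬yz)))
  ... | no ¬xy | yes yz = ≋-trans (⊙-congˡ (∂⊙∂-nonadditive X Y ¬xy) (∂ z))
    (≋-sym (≋-trans (⊙-congʳ (∂ x) (∂⊙∂-additive Y Z yz))
      (∂⊙∂-nonadditive X (Conjugates-· Y Z) (¬xy ∘ proj₁ ∘ Additive-assocˡ {x} {y} {z} yz))))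
  ... | yes xy | no ¬yz = ≋-trans (⊙-congˡ (∂⊙∂-additive X Y xy) (∂ z))
    (≋-trans (∂⊙∂-nonadditive (Conjugates-· X Y) Z (¬yz ∘ proj₁ ∘ Additive-assocʳ {x} {y} {z} xy))
      (≋-sym (⊙-congʳ (∂ x) (∂⊙∂-nonadditive Y Z ¬yz))))
  ... | yes xy | yes yz with Additive? x (y · z)
  ...   | yes xyz = ≋-trans (⊙-congˡ (∂⊙∂-additive X Y xy) (∂ z))
    (≋-trans (∂⊙∂-additive (Conjugates-· X Y) Z (proj₂ (Additive-assocˡ {x} {y} {z} yz xyz)))
    (≋-trans (∂-cong (∼-reflexive (assoc x y z)))
    (≋-sym (≋-trans (⊙-congʳ (∂ x) (∂⊙∂-additive Y Z yz)) (∂⊙∂-additive X (Conjugates-· Y Z) xyz)))))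
  ...   | no ¬xyz = ≋-trans (⊙-congˡ (∂⊙∂-additive X Y xy) (∂ z))
    (≋-trans (∂⊙∂-nonadditive (Conjugates-· X Y) Z (¬xyz ∘ proj₂ ∘ Additive-assocʳ {x} {y} {z} xy))
    (≋-sym (≋-trans (⊙-congʳ (∂ x) (∂⊙∂-additive Y Z yz)) (∂⊙∂-nonadditive X (Conjugates-· Y Z) ¬xyz))))

  ⊙-assoc : ∀ {I J K L} {f : Morphism J I} {g : Morphism K J} {h : Morphism L K} →
    Span f → Span g → Span h → (f ⊙ g) ⊙ h ≋ f ⊙ (g ⊙ h)
  ⊙-assoc 0ˢ         sg sh = ≋-refl
  ⊙-assoc (sf ⊕ˢ sf′) sg sh = ⊕-cong (⊙-assoc sf sg sh) (⊙-assoc sf′ sg sh)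
  ⊙-assoc (⊖ˢ sf)    sg sh = ⊖-cong (⊙-assoc sf sg sh)
  ⊙-assoc (basis X)  0ˢ sh = ≋-refl
  ⊙-assoc (basis X)  (sg ⊕ˢ sg′) sh = ⊕-cong (⊙-assoc (basis X) sg sh) (⊙-assoc (basis X) sg′ sh)
  ⊙-assoc (basis X)  (⊖ˢ sg) sh = ⊖-cong (⊙-assoc (basis X) sg sh)
  ⊙-assoc {f = f} {g} {h} (basis X)  (basis Y) sh = go sh
    where
    -- `f ⊙ g` is stuck on `isReduced?`, so linearity in the last argument is proved for a general
    -- left factor.
    ⊙0 : ∀ {A B D} (k : Morphism A B) → k ⊙ 0# {D} ≋ 0#
    ⊙0 (∂ p) = ≋-refl
    ⊙0 0# = ≋-refl
    ⊙0 (k ⊕ k′) = ≋-trans (⊕-cong (⊙0 k) (⊙0 k′)) (⊕-identityˡ 0#)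
    ⊙0 (⊖ k) = ≋-trans (⊖-cong (⊙0 k)) ⊖-0#
    ⊙⊖ : ∀ {A B D} (k : Morphism A B) (l : Morphism D A) → k ⊙ (⊖ l) ≋ ⊖ (k ⊙ l)
    ⊙⊖ (∂ p) l = ≋-refl
    ⊙⊖ 0# l = ≋-sym ⊖-0#
    ⊙⊖ (k ⊕ k′) l = ≋-trans (⊕-cong (⊙⊖ k l) (⊙⊖ k′ l)) (⊖-⊕ (k ⊙ l) (k′ ⊙ l))
    ⊙⊖ (⊖ k) l = ⊖-cong (⊙⊖ k l)
    go : ∀ {h} → Span h → (f ⊙ g) ⊙ h ≋ f ⊙ (g ⊙ h)
    go (basis Z) = ∂-assoc X Y Z
    go 0ˢ = ⊙0 (f ⊙ g)
    go (_⊕ˢ_ {h} {h′} sh sh′) = ≋-trans (⊙-distribˡ (f ⊙ g) h h′) (⊕-cong (go sh) (go sh′))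
    go (⊖ˢ_ {h} sh) = ≋-trans (⊙⊖ (f ⊙ g) h) (⊖-cong (go sh))

  ⊙-identityˡ : ∀ {I J} {f : Morphism J I} → Span f → idᴰ ⊙ f ≋ f
  ⊙-identityˡ (basis {x} X) = ∂⊙∂-additive Conjugates-ε X (cong (_+ ℓ x) (sym ℓ-ε))
  ⊙-identityˡ 0ˢ = ≋-refl
  ⊙-identityˡ (sf ⊕ˢ sg) = ⊕-cong (⊙-identityˡ sf) (⊙-identityˡ sg)
  ⊙-identityˡ (⊖ˢ sf) = ⊖-cong (⊙-identityˡ sf)

  ⊙-identityʳ : ∀ {I J} {f : Morphism J I} → Span f → f ⊙ idᴰ ≋ f
  ⊙-identityʳ (basis {x} X) = ≋-trans
    (∂⊙∂-additive X Conjugates-ε (trans (ℓ-cong (≡⇒≈ (List.++-identityʳ x))) (sym (trans (cong (ℓ x +_) ℓ-ε) (ℕ.+-identityʳ (ℓ x))))))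
    (∂-cong (∼-reflexive (≡⇒≈ (List.++-identityʳ x))))
  ⊙-identityʳ 0ˢ = ≋-refl
  ⊙-identityʳ (sf ⊕ˢ sg) = ⊕-cong (⊙-identityʳ sf) (⊙-identityʳ sg)
  ⊙-identityʳ (⊖ˢ sf) = ⊖-cong (⊙-identityʳ sf)

  -- Recognition of atomic cosets

  ⟦⟧∈⟨⟩⇒∈ : ∀ {J s} → ⟦ s ⟧ ∈⟨ J ⟩ → s ∈ J
  ⟦⟧∈⟨⟩⇒∈ {J} {s} (v , v∈ , v≈) with reduceIn v v∈
  ... | u , u∈ , ru , v≈u = go u∈ (trans (Reduced⇒tight ru) (trans (ℓ-cong (≈-trans (≈-sym v≈u) v≈))
      (trans (<ₗ⇒≡ {s} {ε} (<ₗ-ε s)) (cong suc ℓ-ε)))) (≈-trans (≈-sym v≈u) v≈)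
    where
    go : ∀ {u} → All (_∈ J) u → length u ≡ 1 → u ≈ ⟦ s ⟧ → s ∈ J
    go (r∈ ∷ []) _ eq = subst (_∈ J) (⟦⟧-injective eq) r∈

  module _ {J s t x} (X : Conjugates J ((J ∪ ⁅ s ⁆) - t) x)
    (s∉J : s ∉ J) (t∈M : t ∈ J ∪ ⁅ s ⁆) (x∈M : x ∈⟨ J ∪ ⁅ s ⁆ ⟩) (ℓx≢0 : ℓ x ≢ 0) where

    private
      M = J ∪ ⁅ s ⁆
      I = M - t
      wM = C.w₀ M
      wJ = C.w₀ J

      split : ∀ {r} → r ∈ M → r ≡ t ⊎ r ∈ I
      split {r} r∈ with r Fin.≟ t
      ... | yes eq = inj₁ eq
      ... | no ≢ = inj₂ (x∈p∧x≢y⇒x∈p-y r∈ ≢)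

      J⊆M : ∀ {r} → r ∈ J → r ∈ M
      J⊆M r∈ = x∈p∪q⁺ (inj₁ r∈)

      t≮x : ¬ t <ₗ x
      t≮x l = ℓx≢0 (ℕ.m+n≡0⇒n≡0 (ℓ (x ⁻¹)) (trans
        (sym (leftMinimal-ℓ {M} {x} (λ {r} r∈ → minimalM r (split r∈)) (⟨⟩-⁻¹ x∈M)))
        (trans (ℓ-cong (inverseˡ x)) ℓ-ε)))
        where
        minimalM : ∀ r → r ≡ t ⊎ r ∈ I → r <ₗ x
        minimalM r (inj₁ refl) = l
        minimalM r (inj₂ r∈) = minimal X r∈

      xwJ∈M : x · wJ ∈⟨ M ⟩
      xwJ∈M with C.w₀-∈ J
      ... | v , v∈ , v≈ = ⟨⟩-· x∈M (v , All.map J⊆M v∈ , v≈)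

      descents : ∀ {r} → r ∈ M → ¬ r <ₗ x · wJ
      descents {r} r∈ l with split r∈
      ... | inj₁ refl = ℕ.<-asym l (subst (ℓ (t ∷ x · wJ) <_) (sym (ℓ-x·w₀ X))
        (ℕ.≤-<-trans (ℓ-subadditive (t ∷ x) wJ) (ℕ.+-monoˡ-< (ℓ wJ) (≮ₗ⇒> {t} {x} t≮x))))
      ... | inj₂ r∈I with left X r∈I
      ...   | r′ , r′∈ , eq = ℕ.<-asym l (subst₂ _<_
        (ℓ-cong (≈-sym (≈-trans (·-cong eq (≈-refl {wJ})) (assoc x ⟦ r′ ⟧ wJ)))) (sym (ℓ-x·w₀ X))
        (ℕ.≤-<-trans (ℓ-subadditive x (r′ ∷ wJ)) (ℕ.+-monoʳ-< (ℓ x) (≮ₗ⇒> {r′} {wJ} (w₀-descents r′∈)))))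

      -- All of `M` are left descents of x w_J. For elements of `I` this is because conjugation by x
      -- takes them into `J`. For `t` it holds since x would otherwise be minimal for all of `M`,
      -- although x lies in W_M and is not trivial.
      xwJ≈wM : x · wJ ≈ wM
      xwJ≈wM = descents⇒w₀ xwJ∈M descents

      s∈M : s ∈ M
      s∈M = x∈p∪q⁺ (inj₂ (x∈⁅x⁆ s))

      wM∈ : wM ∈⟨ M ⟩
      wM∈ = C.w₀-∈ M

      wM⁻¹≈ : wM ⁻¹ ≈ wM
      wM⁻¹≈ = longest⇒w₀ (⟨⟩-⁻¹ wM∈) (ℕ.≤-reflexive (sym (ℓ-⁻¹ wM)))

      wMs∈ : wM · ⟦ s ⟧ ∈⟨ M ⟩
      wMs∈ = ⟨⟩-· wM∈ (⟨⟩-⟦⟧ s∈M)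

      conjugate-∈I : ∀ {r} → r ∈ I → r ∷ wM · ⟦ s ⟧ ≈ wM → s ∈ J
      conjugate-∈I {r} r∈ eq with left X r∈
      ... | r′ , r′∈ , rx≈ = ⟦⟧∈⟨⟩⇒∈ (⟨⟩-cong s≈ (⟨⟩-· (⟨⟩-⁻¹ r′wJ∈) (C.w₀-∈ J)))
        where
        r′wJ∈ : r′ ∷ wJ ∈⟨ J ⟩
        r′wJ∈ = ⟨⟩-· (⟨⟩-⟦⟧ r′∈) (C.w₀-∈ J)
        eq′ : x · ((r′ ∷ wJ) · ⟦ s ⟧) ≈ x · wJ
        eq′ = begin
          x · ((r′ ∷ wJ) · ⟦ s ⟧) ≈⟨ assoc x ⟦ r′ ⟧ (wJ · ⟦ s ⟧) ⟨
          (x · ⟦ r′ ⟧) · (wJ · ⟦ s ⟧) ≈⟨ ·-cong rx≈ (≈-refl {wJ · ⟦ s ⟧}) ⟨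
          r ∷ x · (wJ · ⟦ s ⟧) ≈⟨ cons-cong r (assoc x wJ ⟦ s ⟧) ⟨
          r ∷ (x · wJ) · ⟦ s ⟧ ≈⟨ cons-cong r (·-cong xwJ≈wM (≈-refl {⟦ s ⟧})) ⟩
          r ∷ wM · ⟦ s ⟧ ≈⟨ eq ⟩
          wM ≈⟨ xwJ≈wM ⟨
          x · wJ ∎
          where open ≈-Reasoning
        s≈ : (r′ ∷ wJ) ⁻¹ · wJ ≈ ⟦ s ⟧
        s≈ = begin
          (r′ ∷ wJ) ⁻¹ · wJ ≈⟨ ·-cong (≈-refl {(r′ ∷ wJ) ⁻¹}) (cancelˡ x eq′) ⟨
          (r′ ∷ wJ) ⁻¹ · ((r′ ∷ wJ) · ⟦ s ⟧) ≈⟨ assoc ((r′ ∷ wJ) ⁻¹) (r′ ∷ wJ) ⟦ s ⟧ ⟨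
          ((r′ ∷ wJ) ⁻¹ · (r′ ∷ wJ)) · ⟦ s ⟧ ≈⟨ ·-cong (inverseˡ (r′ ∷ wJ)) (≈-refl {⟦ s ⟧}) ⟩
          ⟦ s ⟧ ∎
          where open ≈-Reasoning

    -- w_M s is not longest, so some r in `M` brings it back to w_M, that is r = w_M s w_M. If r
    -- were in `I`, conjugation by x would put s into W_J. So r is `t`.
    conjugate-wM : ⟦ t ⟧ ≈ wM · ⟦ s ⟧ · wM
    conjugate-wM with Fin.any? (λ r → (r ∈? M) ×-dec (ℓ (wM · ⟦ s ⟧) ℕ.<? ℓ (r ∷ wM · ⟦ s ⟧)))
    ... | no none = contradiction
      (trans (sym (<ₗ⇒≡ {s} {ε} (<ₗ-ε s))) (trans (ℓ-cong {⟦ s ⟧} {ε} (cancelˡ wM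
        (≈-trans (descents⇒w₀ wMs∈ (λ r∈ l → none (_ , r∈ , l))) (≡⇒≈ (sym (List.++-identityʳ wM)))))) ℓ-ε)) λ ()
    ... | yes (r , r∈ , l) = ≈-trans (r≈ (split r∈)) (begin
      ⟦ r ⟧ ≈⟨ ≡⇒≈ (List.++-identityʳ ⟦ r ⟧) ⟨
      ⟦ r ⟧ · ε ≈⟨ cons-cong r (inverseʳ (wM · ⟦ s ⟧)) ⟨
      (r ∷ (wM · ⟦ s ⟧) · (wM · ⟦ s ⟧) ⁻¹) ≈⟨ ·-cong rwMs≈ (≈-refl {(wM · ⟦ s ⟧) ⁻¹}) ⟩
      wM · (wM · ⟦ s ⟧) ⁻¹ ≈⟨ ≡⇒≈ (cong (wM ++_) (List.reverse-++ wM ⟦ s ⟧)) ⟩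
      wM · (s ∷ wM ⁻¹) ≈⟨ assoc wM ⟦ s ⟧ (wM ⁻¹) ⟨
      (wM · ⟦ s ⟧) · wM ⁻¹ ≈⟨ ·-cong (≈-refl {wM · ⟦ s ⟧}) wM⁻¹≈ ⟩
      (wM · ⟦ s ⟧) · wM ∎)
      where
      open ≈-Reasoning
      rwMs≈ : r ∷ wM · ⟦ s ⟧ ≈ wM
      rwMs≈ = longest⇒w₀ (⟨⟩-· (⟨⟩-⟦⟧ r∈) wMs∈) (ℕ.≤-trans
        (ℕ.≤-reflexive (≮ᵣ⇒≡ {wM} {s} (λ l′ → ℕ.<⇒≱ l′ (w₀-longest M wMs∈)))) l)
      r≈ : r ≡ t ⊎ r ∈ I → ⟦ t ⟧ ≈ ⟦ r ⟧
      r≈ (inj₁ refl) = ≈-refl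
      r≈ (inj₂ r∈I) = contradiction (conjugate-∈I r∈I rwMs≈) s∉J

    atomic-∼ : x ∼[ I , J ] wM
    atomic-∼ = ε , wJ , ⟨⟩-ε , C.w₀-∈ J , xwJ≈wM

-- Sequences and subsets

-- Compositions of n + 1, generated along the recursion of `toSubset`: `new` corresponds to
-- `outside`, `grow` to `inside`. Unlike the fields of `Sequence`, this can be eliminated by
-- induction.
data Composes : ℕ → List ℕ → Set where
  one  : Composes 0 (1 ∷ [])
  new  : ∀ {n xs} → Composes n xs → Composes (suc n) (1 ∷ xs)
  grow : ∀ {n x xs} → Composes n (suc x ∷ xs) → Composes (suc n) (suc (suc x) ∷ xs)

composes : ∀ n {xs} → All NonZero xs → sum xs ≡ suc n → Composes n xs
composes zero    {suc zero ∷ []}          (_ ∷ [])     _  = one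
composes zero    {suc zero ∷ suc _ ∷ _}   _            ()
composes zero    {suc zero ∷ zero ∷ _}    (_ ∷ record { nonZero = () } ∷ _)
composes zero    {zero ∷ _}               (record { nonZero = () } ∷ _)
composes zero    {suc (suc _) ∷ _}        _            ()
composes (suc n) {suc zero ∷ xs}          (_ ∷ ps)     eq = new (composes n ps (ℕ.suc-injective eq))
composes (suc n) {suc (suc x) ∷ xs}       (_ ∷ ps)     eq = grow (composes n (_ ∷ ps) (ℕ.suc-injective eq))

composes-positive : ∀ {n xs} → Composes n xs → All NonZero xs
composes-positive one      = _ ∷ []
composes-positive (new c)  = _ ∷ composes-positive c
composes-positive (grow c) with composes-positive c
... | _ ∷ ps = _ ∷ ps

composes-sum : ∀ {n xs} → Composes n xs → sum xs ≡ suc n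
composes-sum one      = refl
composes-sum (new c)  = cong suc (composes-sum c)
composes-sum (grow c) = cong suc (composes-sum c)

sequence : ∀ {n} xs → Composes n xs → Sequence n
sequence xs c = record { entries = xs ; positive = composes-positive c ; total = composes-sum c }

entries-composes : ∀ {n} (a : Sequence n) → Composes n (entries a)
entries-composes {n} record { entries = xs ; positive = ps ; total = eq } =
  -- Positivity and total are irrelevant fields, recovered here by deciding them.
  composes n (recompute (All.all? ℕ.nonZero? xs) ps) (recompute (sum xs ℕ.≟ suc n) eq)

entries-injective : ∀ {n} {a b : Sequence n} → entries a ≡ entries b → a ≡ b
entries-injective refl = refl

toSubset : ∀ n → List ℕ → Subset n
toSubset zero    _                  = []
toSubset (suc n) (suc (suc x) ∷ xs) = inside ∷ toSubset n (suc x ∷ xs)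
toSubset (suc n) (_ ∷ xs)           = outside ∷ toSubset n xs
toSubset (suc n) []                 = outside ∷ toSubset n []

classSizes-toSubset : ∀ {n xs} → Composes n xs → classSizes (toSubset n xs) ≡ xs
classSizes-toSubset one      = refl
classSizes-toSubset (new c)  = cong (1 ∷_) (classSizes-toSubset c)
classSizes-toSubset (grow c) rewrite classSizes-toSubset c = refl

classSizes-composes : ∀ {n} (J : Subset n) → Composes n (classSizes J)
classSizes-composes []            = one
classSizes-composes (outside ∷ J) = new (classSizes-composes J)
classSizes-composes (inside  ∷ J) with classSizes J | classSizes-composes J
... | _ | one    = grow one
... | _ | new c  = grow (new c)
... | _ | grow c = grow (grow c)

toSubset-classSizes : ∀ {n} (J : Subset n) → toSubset n (classSizes J) ≡ J
toSubset-classSizes []            = refl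
toSubset-classSizes (outside ∷ J) = cong (outside ∷_) (toSubset-classSizes J)
toSubset-classSizes (inside  ∷ J) with classSizes J | classSizes-composes J | toSubset-classSizes J
... | _ | one    | eq = cong (inside ∷_) eq
... | _ | new c  | eq = cong (inside ∷_) eq
... | _ | grow c | eq = cong (inside ∷_) eq

separators : ∀ {n} → Subset n → List (Fin n)
separators {n} J = filter (λ s → ¬? (s ∈? J)) (allFin n)

data Nth {A : Set} : List A → ℕ → A → Set where
  zero : ∀ {x xs} → Nth (x ∷ xs) zero x
  suc  : ∀ {x xs i y} → Nth xs i y → Nth (x ∷ xs) (suc i) y

Nth-map : ∀ {A B : Set} (f : A → B) {xs i x} → Nth xs i x → Nth (map f xs) i (f x)
Nth-map f zero    = zero
Nth-map f (suc p) = suc (Nth-map f p)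

Nth⇒lookup : ∀ {A : Set} {xs : List A} {i x} → Nth xs i x → ∃[ d ] toℕ d ≡ i × lookup xs d ≡ x
Nth⇒lookup zero    = zero , refl , refl
Nth⇒lookup (suc p) with Nth⇒lookup p
... | d , refl , refl = suc d , refl , refl

filter-map-suc : ∀ {n} b (J : Subset n) ss →
  filter (λ s → ¬? (s ∈? (b ∷ J))) (map suc ss) ≡ map suc (filter (λ s → ¬? (s ∈? J)) ss)
filter-map-suc b J []       = refl
filter-map-suc b J (s ∷ ss) with s ∈? J
... | yes _ = filter-map-suc b J ss
... | no  _ = cong (suc s ∷_) (filter-map-suc b J ss)

separators-outside : ∀ {n} (J : Subset n) → separators (outside ∷ J) ≡ zero ∷ map suc (separators J)
separators-outside {n} J = cong (zero ∷_)
  (trans (cong (filter _) (sym (List.map-tabulate (λ s → s) suc))) (filter-map-suc outside J (allFin n)))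

separators-inside : ∀ {n} (J : Subset n) → separators (inside ∷ J) ≡ map suc (separators J)
separators-inside {n} J = trans (cong (filter _) (sym (List.map-tabulate (λ s → s) suc))) (filter-map-suc inside J (allFin n))

separators-length : ∀ {n xs} → Composes n xs → suc (length (separators (toSubset n xs))) ≡ length xs
separators-length one = refl
separators-length {suc n} {_ ∷ xs} (new c) =
  trans (cong (suc ∘ length) (separators-outside (toSubset n xs)))
    (cong suc (trans (cong suc (List.length-map suc (separators (toSubset n xs)))) (separators-length c)))
separators-length {suc n} {suc (suc x) ∷ xs} (grow c) =
  trans (cong (suc ∘ length) (separators-inside (toSubset n (suc x ∷ xs))))
    (trans (cong suc (List.length-map suc (separators (toSubset n (suc x ∷ xs))))) (separators-length c))

merge : ℕ → List ℕ → List ℕ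
merge zero    (x ∷ y ∷ v) = x + y ∷ v
merge (suc i) (x ∷ v)     = x ∷ merge i v
merge _       v           = v

minus-⊥ : ∀ {n} (J : Subset n) → J ─ ⊥ ≡ J
minus-⊥ []      = refl
minus-⊥ (b ∷ J) = cong (b ∷_) (minus-⊥ J)

-- Merging two classes adds the element of S ∖ J separating them to J.
record Cut {n} (J M : Subset n) (i : ℕ) : Set where
  field
    s       : Fin n
    nth     : Nth (separators J) i s
    s∉J     : s ∉ J
    s∈M     : s ∈ M
    insert≡ : J ∪ ⁅ s ⁆ ≡ M
    delete≡ : M - s ≡ J

cut-outside : ∀ {n i} {J M : Subset n} → Cut J M i → Cut (outside ∷ J) (outside ∷ M) (suc i)
cut-outside {i = i} {J} {M} c = record
  { s = suc s ; nth = subst (λ l → Nth l (suc i) (suc s)) (sym (separators-outside J)) (suc (Nth-map suc nth))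
  ; s∉J = λ { (thereᵛ p) → s∉J p } ; s∈M = thereᵛ s∈M
  ; insert≡ = cong (outside ∷_) insert≡ ; delete≡ = cong (outside ∷_) delete≡ }
  where open Cut c

cut-inside : ∀ {n i} {J M : Subset n} → Cut J M i → Cut (inside ∷ J) (inside ∷ M) i
cut-inside {i = i} {J} {M} c = record
  { s = suc s ; nth = subst (λ l → Nth l i (suc s)) (sym (separators-inside J)) (Nth-map suc nth)
  ; s∉J = λ { (thereᵛ p) → s∉J p } ; s∈M = thereᵛ s∈M
  ; insert≡ = cong (inside ∷_) insert≡ ; delete≡ = cong (inside ∷_) delete≡ }
  where open Cut c

cut-zero : ∀ {n} (J : Subset n) → Cut (outside ∷ J) (inside ∷ J) 0
cut-zero J = record
  { s = zero ; nth = subst (λ l → Nth l 0 zero) (sym (separators-outside J)) zero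
  ; s∉J = λ () ; s∈M = hereᵛ
  ; insert≡ = cong (inside ∷_) (∪-identityʳ J) ; delete≡ = cong (outside ∷_) (minus-⊥ J) }

cut : ∀ {n xs} → Composes n xs → ∀ i → suc i < length xs → Cut (toSubset n xs) (toSubset n (merge i xs)) i
cut one i (s≤s ())
cut (new {n} c) zero l = go c
  where
  go : ∀ {xs} → Composes n xs → Cut (outside ∷ toSubset n xs) (toSubset (suc n) (merge 0 (1 ∷ xs))) 0
  go one      = cut-zero []
  go (new {n} {xs} _)  = cut-zero (outside ∷ toSubset n xs)
  go (grow {n} {x} {xs} _) = cut-zero (inside ∷ toSubset n (suc x ∷ xs))
cut (new c) (suc i) (s≤s l) = cut-outside (cut c i l)
cut (grow {xs = y ∷ v} c) zero l = cut-inside (cut c zero l)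
cut (grow {xs = []} c) zero (s≤s ())
cut (grow c) (suc i) l = cut-inside (cut c (suc i) l)

merge-composes : ∀ {n xs} → Composes n xs → ∀ i → suc i < length xs → Composes n (merge i xs)
merge-composes one i (s≤s ())
merge-composes (new one)      zero l = grow one
merge-composes (new (new c))  zero l = grow (new c)
merge-composes (new (grow c)) zero l = grow (grow c)
merge-composes (new c) (suc i) (s≤s l) = new (merge-composes c i l)
merge-composes (grow {xs = y ∷ v} c) zero l = grow (merge-composes c zero l)
merge-composes (grow {xs = []} c) zero (s≤s ())
merge-composes (grow c) (suc i) l = grow (merge-composes c (suc i) l)

-- The points j and j + 1 of {0,…,n} belong to the same class.
data Inner : List ℕ → ℕ → Set where
  inn : ∀ {x xs j} → suc j < x → Inner (x ∷ xs) j
  out : ∀ {x xs j} → Inner xs j → Inner (x ∷ xs) (x + j)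

Inner-grow : ∀ {x xs j} → Inner (suc x ∷ xs) j → Inner (suc (suc x) ∷ xs) (suc j)
Inner-grow (inn l) = inn (s≤s l)
Inner-grow (out p) = out p

Inner-shrink : ∀ {x xs j} → Inner (suc (suc x) ∷ xs) (suc j) → Inner (suc x ∷ xs) j
Inner-shrink (inn (s≤s l)) = inn l
Inner-shrink (out p)       = out p

∈⇒Inner : ∀ {n xs} → Composes n xs → ∀ {s} → s ∈ toSubset n xs → Inner xs (toℕ s)
∈⇒Inner one      ()
∈⇒Inner (new c)  (thereᵛ p) = out (∈⇒Inner c p)
∈⇒Inner (grow c) hereᵛ      = inn (s≤s (s≤s z≤n))
∈⇒Inner (grow c) (thereᵛ p) = Inner-grow (∈⇒Inner c p)

Inner⇒∈ : ∀ {n xs} → Composes n xs → ∀ s → Inner xs (toℕ s) → s ∈ toSubset n xs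
Inner⇒∈ (new c)  zero    (inn (s≤s ()))
Inner⇒∈ (new c)  (suc s) (inn (s≤s ()))
Inner⇒∈ (new c)  (suc s) (out p) = thereᵛ (Inner⇒∈ c s p)
Inner⇒∈ (grow c) zero    p       = hereᵛ
Inner⇒∈ (grow c) (suc s) p       = thereᵛ (Inner⇒∈ c s (Inner-shrink p))

Inner-< : ∀ {n xs} → Composes n xs → ∀ {j} → Inner xs j → j < n
Inner-< one (inn (s≤s ()))
Inner-< one (out ())
Inner-< (new c) (inn (s≤s ()))
Inner-< (new c) (out p) = s≤s (Inner-< c p)
Inner-< (grow c) {zero}  p = s≤s z≤n
Inner-< (grow c) {suc j} p = s≤s (Inner-< c (Inner-shrink p))

Swap-merge : ∀ {i v w} → Swap i v w → merge i v ≡ merge i w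
Swap-merge (here {x} {y} {v}) = cong (_∷ v) (ℕ.+-comm x y)
Swap-merge (there {x = x} p)  = cong (x ∷_) (Swap-merge p)

Step-merge : ∀ {i v w} → Step i v w → merge i v ≡ merge i w
Step-merge fix      = refl
Step-merge (swap p) = Swap-merge p

Swap-length : ∀ {i v w} → Swap i v w → suc i < length v × suc i < length w
Swap-length here      = s≤s (s≤s z≤n) , s≤s (s≤s z≤n)
Swap-length (there p) with Swap-length p
... | l , l′ = s≤s l , s≤s l′

Step-length : ∀ {i v w} → Step i v w → suc i < length v × suc i < length w
Step-length fix      = s≤s (s≤s z≤n) , s≤s (s≤s z≤n)
Step-length (swap p) = Swap-length p

Swap⇒swapAt : ∀ {i v w} → Swap i v w → w ≡ swapAt i v
Swap⇒swapAt here          = refl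
Swap⇒swapAt (there {x = x} p) = cong (x ∷_) (Swap⇒swapAt p)

swapAt⇒Swap : ∀ i v → suc i < length v → Swap i v (swapAt i v)
swapAt⇒Swap zero    (x ∷ y ∷ v) l       = here
swapAt⇒Swap (suc i) (x ∷ v)     (s≤s l) = there (swapAt⇒Swap i v l)
swapAt⇒Swap zero    (x ∷ [])    (s≤s ())

-- The effect of ∂ᵢ on the sizes n₁,…,n_k; n₀ is fixed.
stepSizes : ℕ → List ℕ → List ℕ
stepSizes zero    v = v
stepSizes (suc i) v = swapAt i v

Step⇒stepSizes : ∀ {i x v w} → Step i (x ∷ v) w → w ≡ x ∷ stepSizes i v
Step⇒stepSizes fix               = refl
Step⇒stepSizes (swap (there {x = x} p)) = cong (x ∷_) (Swap⇒swapAt p)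

stepSizes⇒Step : ∀ i {x v} → i < length v → Step i (x ∷ v) (x ∷ stepSizes i v)
stepSizes⇒Step zero    {v = y ∷ v} l = fix
stepSizes⇒Step (suc i)             l = swap (there (swapAt⇒Swap i _ l))

sum-swapAt : ∀ i v → sum (swapAt i v) ≡ sum v
sum-swapAt zero    []          = refl
sum-swapAt zero    (x ∷ [])    = refl
sum-swapAt zero    (x ∷ y ∷ v) = x+y+z≡y+x+z y x (sum v)
sum-swapAt (suc i) []          = refl
sum-swapAt (suc i) (x ∷ v)     = cong (x +_) (sum-swapAt i v)

composes-stepSizes : ∀ {n x v} i → Composes n (x ∷ v) → Composes n (x ∷ stepSizes i v)
composes-stepSizes zero    c = c
composes-stepSizes {n} {x} {v} (suc i) c with composes-positive c
... | p ∷ ps = composes n (p ∷ All-swapAt i ps) (trans (cong (x +_) (sum-swapAt i v)) (composes-sum c))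

Swap-irrelevant : ∀ {i v w} (p q : Swap i v w) → p ≡ q
Swap-irrelevant here      here      = refl
Swap-irrelevant (there p) (there q) = cong there (Swap-irrelevant p q)

⟶-irrelevant : ∀ {n i} {a b : Sequence n} (e e′ : a ⟶[ i ] b) → e ≡ e′
⟶-irrelevant (step p) (step q) = cong step (go p q)
  where
  go : ∀ {i v w} (p q : Step i v w) → p ≡ q
  go fix      fix      = refl
  go (swap p) (swap q) = cong swap (Swap-irrelevant p q)

-- Moving blocks

infixr 5 _▹_ _▹ˢ_

-- Letters are plain numbers here, because block words are assembled by shifting. `letters` turns
-- them into letters of W once they are known to be bounded.
_▹_ : List ℕ → List Value → List Value
[]      ▹ v = v
(i ∷ w) ▹ v = act i (w ▹ v)

_▹ˢ_ : List ℕ → List Value → List Value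
[]      ▹ˢ v = v
(i ∷ w) ▹ˢ v = swapAt i (w ▹ˢ v)

▹-++ : ∀ u w v → (u ++ w) ▹ v ≡ u ▹ w ▹ v
▹-++ []      w v = refl
▹-++ (i ∷ u) w v = cong (act i) (▹-++ u w v)

▹ˢ-++ : ∀ u w v → (u ++ w) ▹ˢ v ≡ u ▹ˢ w ▹ˢ v
▹ˢ-++ []      w v = refl
▹ˢ-++ (i ∷ u) w v = cong (swapAt i) (▹ˢ-++ u w v)

▹-suc : ∀ w v → map suc w ▹ v ≡ w ▹ˢ v
▹-suc []      v = refl
▹-suc (i ∷ w) v = cong (swapAt i) (▹-suc w v)

shift : ℕ → List ℕ → List ℕ
shift m = map (m +_)

swapAt-prefix : ∀ {A : Set} (p : List A) i v → swapAt (length p + i) (p ++ v) ≡ p ++ swapAt i v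
swapAt-prefix []      i v = refl
swapAt-prefix (a ∷ p) i v = cong (a ∷_) (swapAt-prefix p i v)

▹ˢ-shift : ∀ p w v → shift (length p) w ▹ˢ (p ++ v) ≡ p ++ (w ▹ˢ v)
▹ˢ-shift p []      v = refl
▹ˢ-shift p (i ∷ w) v = trans (cong (swapAt (length p + i)) (▹ˢ-shift p w v)) (swapAt-prefix p i (w ▹ˢ v))

data Rises : List ℕ → List Value → Set where
  []  : ∀ {v} → Rises [] v
  _∷_ : ∀ {i w v} → Ascent i (w ▹ v) → Rises w v → Rises (i ∷ w) v

data Risesˢ : List ℕ → List Value → Set where
  []  : ∀ {v} → Risesˢ [] v
  _∷_ : ∀ {i w v} → AscentAt i (w ▹ˢ v) → Risesˢ w v → Risesˢ (i ∷ w) v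

rises-inversions : ∀ {w v} → Rises w v → inversions (w ▹ v) ≡ length w + inversions v
rises-inversions []      = refl
rises-inversions (a ∷ r) = trans (inversions-ascent a) (cong suc (rises-inversions r))

rises-++ : ∀ {u w v} → Rises u (w ▹ v) → Rises w v → Rises (u ++ w) v
rises-++ [] s = s
rises-++ {i ∷ u} {w} {v} (a ∷ r) s = subst (Ascent i) (sym (▹-++ u w v)) a ∷ rises-++ r s

risesˢ-++ : ∀ {u w v} → Risesˢ u (w ▹ˢ v) → Risesˢ w v → Risesˢ (u ++ w) v
risesˢ-++ [] s = s
risesˢ-++ {i ∷ u} {w} {v} (a ∷ r) s = subst (AscentAt i) (sym (▹ˢ-++ u w v)) a ∷ risesˢ-++ r s

rises-suc : ∀ {w v} → Risesˢ w v → Rises (map suc w) v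
rises-suc [] = []
rises-suc {i ∷ w} {v} (a ∷ r) = swap (subst (AscentAt i) (sym (▹-suc w v)) a) ∷ rises-suc r

ascentAt-prefix : ∀ p {i v} → AscentAt i v → AscentAt (length p + i) (p ++ v)
ascentAt-prefix []      a = a
ascentAt-prefix (_ ∷ p) a = there (ascentAt-prefix p a)

risesˢ-shift : ∀ p {w v} → Risesˢ w v → Risesˢ (shift (length p) w) (p ++ v)
risesˢ-shift p [] = []
risesˢ-shift p {i ∷ w} {v} (a ∷ r) =
  subst (AscentAt (length p + i)) (sym (▹ˢ-shift p w v)) (ascentAt-prefix p a) ∷ risesˢ-shift p r

moveRight : ℕ → List ℕ
moveRight zero    = []
moveRight (suc q) = shift 1 (moveRight q) ++ 0 ∷ []

moveLeft : ℕ → List ℕ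
moveLeft zero    = []
moveLeft (suc p) = 0 ∷ shift 1 (moveLeft p)

moveRight-▹ : ∀ a B r → moveRight (length B) ▹ˢ (a ∷ B ++ r) ≡ B ++ a ∷ r
moveRight-▹ a []      r = refl
moveRight-▹ a (b ∷ B) r = trans (▹ˢ-++ (shift 1 (moveRight (length B))) (0 ∷ []) _)
  (trans (▹ˢ-shift (b ∷ []) (moveRight (length B)) (a ∷ B ++ r)) (cong (b ∷_) (moveRight-▹ a B r)))

moveLeft-▹ : ∀ P a r → moveLeft (length P) ▹ˢ (P ++ a ∷ r) ≡ a ∷ P ++ r
moveLeft-▹ []      a r = refl
moveLeft-▹ (p ∷ P) a r = cong (swapAt 0)
  (trans (▹ˢ-shift (p ∷ []) (moveLeft (length P)) (P ++ a ∷ r)) (cong (p ∷_) (moveLeft-▹ P a r)))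

moveRight-rises : ∀ {a B} r → All (a ≺_) B → Risesˢ (moveRight (length B)) (a ∷ B ++ r)
moveRight-rises r [] = []
moveRight-rises {B = b ∷ B} r (p ∷ ps) = risesˢ-++ (risesˢ-shift (b ∷ []) (moveRight-rises r ps)) (here p ∷ [])

moveLeft-rises : ∀ {P a} r → All (_≺ a) P → Risesˢ (moveLeft (length P)) (P ++ a ∷ r)
moveLeft-rises r [] = []
moveLeft-rises {p ∷ P} {a} r (q ∷ qs) =
  subst (AscentAt 0) (sym (trans (▹ˢ-shift (p ∷ []) (moveLeft (length P)) (P ++ a ∷ r)) (cong (p ∷_) (moveLeft-▹ P a r)))) (here q)
  ∷ risesˢ-shift (p ∷ []) (moveLeft-rises r qs)

-- Words act from the right end, so the last entry of the first block is the first to cross the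
-- second block.
swapBlocks : ℕ → ℕ → List ℕ
swapBlocks zero    q = []
swapBlocks (suc p) q = moveRight q ++ shift 1 (swapBlocks p q)

swapBlocks-▹ : ∀ A B r → swapBlocks (length A) (length B) ▹ˢ (A ++ B ++ r) ≡ B ++ A ++ r
swapBlocks-▹ []      B r = refl
swapBlocks-▹ (a ∷ A) B r = trans (▹ˢ-++ (moveRight (length B)) _ _)
  (trans (cong (moveRight (length B) ▹ˢ_)
    (trans (▹ˢ-shift (a ∷ []) (swapBlocks (length A) (length B)) (A ++ B ++ r)) (cong (a ∷_) (swapBlocks-▹ A B r))))
  (moveRight-▹ a B (A ++ r)))

swapBlocks-rises : ∀ {A B} r → All (λ a → All (a ≺_) B) A →
  Risesˢ (swapBlocks (length A) (length B)) (A ++ B ++ r)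
swapBlocks-rises r [] = []
swapBlocks-rises {a ∷ A} {B} r (p ∷ ps) = risesˢ-++
  (subst (Risesˢ (moveRight (length B))) (sym (trans (▹ˢ-shift (a ∷ []) (swapBlocks (length A) (length B)) (A ++ B ++ r)) (cong (a ∷_) (swapBlocks-▹ A B r))))
    (moveRight-rises (A ++ r) p))
  (risesˢ-shift (a ∷ []) (swapBlocks-rises r ps))

negateAt : ℕ → List ℕ
negateAt m = map suc (moveRight m) ++ 0 ∷ map suc (moveLeft m)

negateAt-▹ : ∀ P a r → negateAt (length P) ▹ (P ++ a ∷ r) ≡ P ++ negate a ∷ r
negateAt-▹ P a r = trans (▹-++ (map suc (moveRight (length P))) _ _)
  (trans (▹-suc (moveRight (length P)) _)
  (trans (cong (λ z → moveRight (length P) ▹ˢ act 0 z) (trans (▹-suc (moveLeft (length P)) _) (moveLeft-▹ P a r)))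
  (moveRight-▹ (negate a) P r)))

data Positive : Value → Set where
  isPos : ∀ {c} → Positive (pos c)

negate-≺ : ∀ {a b} → Positive a → Positive b → negate a ≺ b
negate-≺ isPos isPos = neg≺pos

-- On its way to the front a passes smaller entries, there it is positive, and on its way back -a
-- passes positive entries. Each step is an ascent.
negateAt-rises : ∀ {P a} r → All Positive P → Positive a → All (_≺ a) P → Rises (negateAt (length P)) (P ++ a ∷ r)
negateAt-rises {P} {pos c} r pP pa@isPos P≺a = rises-++
  (subst (Rises (map suc (moveRight (length P)))) (sym (cong (act 0) front))
    (rises-suc (moveRight-rises r (All.map (negate-≺ pa) pP))))
  (subst (Ascent 0) (sym front) flip ∷ rises-suc (moveLeft-rises r P≺a))
  where
  front : map suc (moveLeft (length P)) ▹ (P ++ pos c ∷ r) ≡ pos c ∷ P ++ r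
  front = trans (▹-suc (moveLeft (length P)) _) (moveLeft-▹ P (pos c) r)

opposite : List Value → List Value
opposite A = reverse (map negate A)

-- The first entry of the block is negated and moved behind the rest of the block before the rest is
-- treated alike; this also reverses the order, as `opposite` demands.
flipBlock : ℕ → ℕ → List ℕ
flipBlock m zero    = []
flipBlock m (suc p) = flipBlock m p ++ map suc (shift m (moveRight p)) ++ negateAt m

flipBlock-move : ∀ P a A r →
  (map suc (shift (length P) (moveRight (length A))) ++ negateAt (length P)) ▹ (P ++ a ∷ A ++ r)
    ≡ P ++ A ++ negate a ∷ r
flipBlock-move P a A r = trans (▹-++ (map suc (shift (length P) (moveRight (length A)))) _ _)
  (trans (cong (map suc (shift (length P) (moveRight (length A))) ▹_) (negateAt-▹ P a (A ++ r)))
  (trans (▹-suc (shift (length P) (moveRight (length A))) _)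
  (trans (▹ˢ-shift P (moveRight (length A)) _) (cong (P ++_) (moveRight-▹ (negate a) A r)))))

flipBlock-▹ : ∀ P A r → flipBlock (length P) (length A) ▹ (P ++ A ++ r) ≡ P ++ opposite A ++ r
flipBlock-▹ P []      r = refl
flipBlock-▹ P (a ∷ A) r = trans (▹-++ (flipBlock (length P) (length A)) _ _)
  (trans (cong (flipBlock (length P) (length A) ▹_) (flipBlock-move P a A r))
  (trans (flipBlock-▹ P A (negate a ∷ r)) (cong (P ++_) (trans
    (sym (List.++-assoc (opposite A) (negate a ∷ []) r))
    (cong (_++ r) (sym (List.unfold-reverse (negate a) (map negate A))))))))

flipBlock-rises : ∀ {P A} r → All Positive P → All Positive A → All (λ a → All (_≺ a) P) A →
  Rises (flipBlock (length P) (length A)) (P ++ A ++ r)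
flipBlock-rises r pP [] [] = []
flipBlock-rises {P} {a ∷ A} r pP (pa ∷ pA) (q ∷ qs) = rises-++
  (subst (Rises (flipBlock (length P) (length A))) (sym (flipBlock-move P a A r)) (flipBlock-rises (negate a ∷ r) pP pA qs))
  (rises-++ (subst (Rises (map suc (shift (length P) (moveRight (length A))))) (sym (negateAt-▹ P a (A ++ r)))
      (rises-suc (risesˢ-shift P (moveRight-rises r (All.map (negate-≺ pa) pA)))))
    (negateAt-rises (A ++ r) pP pa q))

opposite-involutive : ∀ A → opposite (opposite A) ≡ A
opposite-involutive A = begin
  reverse (map negate (reverse (map negate A))) ≡⟨ cong reverse (List.reverse-map negate (map negate A)) ⟩
  reverse (reverse (map negate (map negate A))) ≡⟨ List.reverse-involutive _ ⟩
  map negate (map negate A) ≡⟨ List.map-∘ A ⟨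
  map (negate ∘ negate) A ≡⟨ List.map-cong negate-involutive A ⟩
  map (λ a → a) A ≡⟨ List.map-id A ⟩
  A ∎
  where open ≡-Reasoning

length-opposite : ∀ A → length (opposite A) ≡ length A
length-opposite A = trans (List.length-reverse (map negate A)) (List.length-map negate A)

swapBlocksAt : ℕ → List ℕ → List ℕ
swapBlocksAt zero    (x ∷ y ∷ v) = swapBlocks x y
swapBlocksAt (suc i) (x ∷ v)     = shift x (swapBlocksAt i v)
swapBlocksAt _       _           = []

-- A reduced word for the minimal element w_M w_J of the i-th atomic coset at J.
block : ℕ → List ℕ → List ℕ
-- n₀ = `x` counts the point 0, which has no entry in the window; hence only x - 1 entries precede
-- the block.
block zero    (x ∷ y ∷ v) = flipBlock (x ∸ 1) y
block (suc i) (x ∷ v)     = shift x (swapBlocksAt i v)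
block _       _           = []

Between : ℕ → ℕ → ℕ → Set
Between m q i = m ≤ i × suc i < m + q

shift-between : ∀ {m q} k {w} → All (Between m q) w → All (Between (k + m) q) (shift k w)
shift-between {m} {q} k ps = All.map⁺ (All.map (λ { {i} (l , u) → ℕ.+-monoʳ-≤ k l ,
  subst₂ _≤_ (trans (ℕ.+-suc k (suc i)) (cong suc (ℕ.+-suc k i))) (sym (ℕ.+-assoc k m q)) (ℕ.+-monoʳ-≤ k u) }) ps)

between-⊆ : ∀ {m q m′ q′ w} → m′ ≤ m → m + q ≤ m′ + q′ → All (Between m q) w → All (Between m′ q′) w
between-⊆ l u = All.map λ { (a , b) → ℕ.≤-trans l a , ℕ.≤-trans b u }

moveRight-between : ∀ q → All (Between 0 (suc q)) (moveRight q)
moveRight-between zero    = []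
moveRight-between (suc q) = All.++⁺ (between-⊆ z≤n ℕ.≤-refl (shift-between 1 (moveRight-between q)))
  ((z≤n , s≤s (s≤s z≤n)) ∷ [])

moveLeft-between : ∀ p → All (Between 0 (suc p)) (moveLeft p)
moveLeft-between zero    = []
moveLeft-between (suc p) = (z≤n , s≤s (s≤s z≤n)) ∷ between-⊆ z≤n ℕ.≤-refl (shift-between 1 (moveLeft-between p))

swapBlocks-between : ∀ p q → All (Between 0 (p + q)) (swapBlocks p q)
swapBlocks-between zero    q = []
swapBlocks-between (suc p) q = All.++⁺ (between-⊆ z≤n (s≤s (ℕ.m≤n+m q p)) (moveRight-between q))
  (between-⊆ z≤n ℕ.≤-refl (shift-between 1 (swapBlocks-between p q)))

negateAt-between : ∀ m → All (Between 0 (suc (suc m))) (negateAt m)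
negateAt-between m = All.++⁺ (between-⊆ z≤n ℕ.≤-refl (shift-between 1 (moveRight-between m)))
  ((z≤n , s≤s (s≤s z≤n)) ∷ between-⊆ z≤n ℕ.≤-refl (shift-between 1 (moveLeft-between m)))

flipBlock-between : ∀ m p → All (Between 0 (suc m + p)) (flipBlock m p)
flipBlock-between m zero    = []
flipBlock-between m (suc p) = All.++⁺ (between-⊆ z≤n (s≤s (ℕ.+-monoʳ-≤ m (ℕ.n≤1+n p))) (flipBlock-between m p))
  (All.++⁺ (between-⊆ z≤n (s≤s (ℕ.≤-reflexive (cong (_+ suc p) (ℕ.+-identityʳ m))))
      (shift-between 1 (shift-between m (moveRight-between p))))
    (between-⊆ z≤n (s≤s (subst (suc m ≤_) (sym (ℕ.+-suc m p)) (s≤s (ℕ.m≤m+n m p)))) (negateAt-between m)))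

shift-inner : ∀ {x v} w → All (Inner v) w → All (Inner (x ∷ v)) (shift x w)
shift-inner w ps = All.map⁺ (All.map out ps)

swapBlocksAt-inner : ∀ i v → suc i < length v → All (Inner (merge i v)) (swapBlocksAt i v)
swapBlocksAt-inner zero    (x ∷ y ∷ v) _       = All.map (inn ∘ proj₂) (swapBlocks-between x y)
swapBlocksAt-inner (suc i) (x ∷ v)     (s≤s l) = shift-inner (swapBlocksAt i v) (swapBlocksAt-inner i v l)
swapBlocksAt-inner zero    (x ∷ [])    (s≤s ())

block-inner : ∀ i {x v} → NonZero x → i < length v → All (Inner (merge i (x ∷ v))) (block i (x ∷ v))
block-inner zero    {suc x} {y ∷ v} _ _ = All.map (inn ∘ proj₂) (flipBlock-between x y)
block-inner (suc i) {x}     {v}     _ l = shift-inner (swapBlocksAt i v) (swapBlocksAt-inner i v l)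

-- ivl o ns (pos c) lists the values occupied by block c + 1 when n₀ = o + 1.
interval : ℕ → List ℕ → ℕ → List Value
interval o []       c       = []
interval o (x ∷ ns) zero    = range o x
interval o (x ∷ ns) (suc c) = interval (o + x) ns c

ivl : ℕ → List ℕ → Value → List Value
ivl o ns (pos c) = interval o ns c
ivl o ns (neg c) = opposite (interval o ns c)

ivl-negate : ∀ o ns l → ivl o ns (negate l) ≡ opposite (ivl o ns l)
ivl-negate o ns (pos c) = refl
ivl-negate o ns (neg c) = sym (opposite-involutive (interval o ns c))

range-positive : ∀ m k → All Positive (range m k)
range-positive m zero    = []
range-positive m (suc k) = isPos ∷ range-positive (suc m) k

interval-positive : ∀ o ns c → All Positive (interval o ns c)
interval-positive o []       c       = []
interval-positive o (x ∷ ns) zero    = range-positive o x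
interval-positive o (x ∷ ns) (suc c) = interval-positive (o + x) ns c

interval-≻ : ∀ o ns c {d} → d < o → All (pos d ≺_) (interval o ns c)
interval-≻ o []       c       d<o = []
interval-≻ o (x ∷ ns) zero    d<o = range-≻ o x d<o
interval-≻ o (x ∷ ns) (suc c) d<o = interval-≻ (o + x) ns c (ℕ.≤-trans d<o (ℕ.m≤m+n o x))

infix 4 _≪_

_≪_ : Rel (List Value) 0ℓ
A ≪ B = ∀ {a b} → a ∈ᴸ A → b ∈ᴸ B → a ≺ b

≪⇒All : ∀ {A B} → A ≪ B → All (λ a → All (a ≺_) B) A
≪⇒All A≪B = All.tabulate λ a∈ → All.tabulate (A≪B a∈)

∈-opposite : ∀ {A a} → a ∈ᴸ opposite A → ∃[ b ] b ∈ᴸ A × a ≡ negate b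
∈-opposite a∈ = Membership.∈-map⁻ negate (Any.reverse⁻ a∈)

opposite-≪ : ∀ {A B} → A ≪ B → opposite B ≪ opposite A
opposite-≪ A≪B b∈ a∈ with ∈-opposite b∈ | ∈-opposite a∈
... | b , b∈ , refl | a , a∈ , refl = negate-antitone (A≪B a∈ b∈)

interval-≪ : ∀ o ns {c d} → c < d → interval o ns c ≪ interval o ns d
interval-≪ o (x ∷ ns) {suc c} {suc d} (s≤s c<d) = interval-≪ (o + x) ns c<d
interval-≪ o (x ∷ ns) {zero}  {suc d} _ {a} a∈ b∈ with All.lookup (range-positive o x) a∈ | All.lookup (range-bounded o x) a∈
... | isPos | l = All.lookup (interval-≻ (o + x) ns d l) b∈

-- Labels are ordered as their blocks are. This is why an ascent of the arrangement makes every
-- letter of the block word an ascent.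
ivl-≪ : ∀ o ns {l m} → l ≺ m → ivl o ns l ≪ ivl o ns m
ivl-≪ o ns (pos≺pos c<d) = interval-≪ o ns c<d
ivl-≪ o ns (neg≺neg d<c) = opposite-≪ (interval-≪ o ns d<c)
ivl-≪ o ns (neg≺pos {c} {d}) a∈ b∈ with ∈-opposite a∈
... | e , e∈ , refl = negate-≺ (All.lookup (interval-positive o ns c) e∈) (All.lookup (interval-positive o ns d) b∈)

size : List ℕ → Value → ℕ
size ns l = length (ivl 0 ns l)

length-interval : ∀ o p ns c → length (interval o ns c) ≡ length (interval p ns c)
length-interval o p []       c       = refl
length-interval o p (x ∷ ns) zero    = trans (length-range o x) (sym (length-range p x))
length-interval o p (x ∷ ns) (suc c) = length-interval (o + x) (p + x) ns c

length-ivl : ∀ o ns l → length (ivl o ns l) ≡ size ns l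
length-ivl o ns (pos c) = length-interval o 0 ns c
length-ivl o ns (neg c) = trans (length-opposite (interval o ns c))
  (trans (length-interval o 0 ns c) (sym (length-opposite (interval 0 ns c))))

size-negate : ∀ ns l → size ns (negate l) ≡ size ns l
size-negate ns l = trans (cong length (ivl-negate 0 ns l)) (length-opposite (ivl 0 ns l))

sizes-act : ∀ ns i L → map (size ns) (act i L) ≡ stepSizes i (map (size ns) L)
sizes-act ns zero    []      = refl
sizes-act ns zero    (l ∷ L) = cong (_∷ map (size ns) L) (size-negate ns l)
sizes-act ns (suc i) L       = map-swapAt (size ns) i L

-- The window of the element of W carrying the blocks to the arrangement L.
expand : ℕ → List ℕ → List Value → List Value
expand o ns L = range 0 o ++ concatMap (ivl o ns) L

module _ (o : ℕ) (ns : List ℕ) where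

  private
    B = ivl o ns
    len = size ns

  swapBlocksAt-▹ : ∀ i L → swapBlocksAt i (map len L) ▹ˢ concatMap B L ≡ concatMap B (swapAt i L)
  swapBlocksAt-▹ zero    []          = refl
  swapBlocksAt-▹ zero    (l ∷ [])    = refl
  swapBlocksAt-▹ zero    (l ∷ m ∷ L) =
    trans (cong₂ (λ p q → swapBlocks p q ▹ˢ concatMap B (l ∷ m ∷ L)) (sym (length-ivl o ns l)) (sym (length-ivl o ns m)))
          (swapBlocks-▹ (B l) (B m) (concatMap B L))
  swapBlocksAt-▹ (suc i) []          = refl
  swapBlocksAt-▹ (suc i) (l ∷ L)     =
    trans (cong (λ p → shift p (swapBlocksAt i (map len L)) ▹ˢ concatMap B (l ∷ L)) (sym (length-ivl o ns l)))
    (trans (▹ˢ-shift (B l) (swapBlocksAt i (map len L)) (concatMap B L)) (cong (B l ++_) (swapBlocksAt-▹ i L)))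

  swapBlocksAt-rises : ∀ {i L} → AscentAt i L → Risesˢ (swapBlocksAt i (map len L)) (concatMap B L)
  swapBlocksAt-rises {L = l ∷ m ∷ L} (here l≺m) =
    subst₂ (λ p q → Risesˢ (swapBlocks p q) (concatMap B (l ∷ m ∷ L))) (length-ivl o ns l) (length-ivl o ns m)
      (swapBlocks-rises (concatMap B L) (≪⇒All (ivl-≪ o ns l≺m)))
  swapBlocksAt-rises {suc i} {l ∷ L} (there a) =
    subst (λ p → Risesˢ (shift p (swapBlocksAt i (map len L))) (concatMap B (l ∷ L))) (length-ivl o ns l)
      (risesˢ-shift (B l) (swapBlocksAt-rises a))

  shift-suc : ∀ m w → shift (suc m) w ≡ map suc (shift m w)
  shift-suc m w = List.map-∘ w

  -- `expand` intertwines letter `i` of type B_k with a word of type B_n. Windows of products of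
  -- atomic generators are computed from this alone.
  block-▹ : ∀ i L → i < length L → block i (suc o ∷ map len L) ▹ expand o ns L ≡ expand o ns (act i L)
  block-▹ zero (l ∷ L) _ =
    trans (cong₂ (λ p q → flipBlock p q ▹ expand o ns (l ∷ L)) (sym (length-range 0 o)) (sym (length-ivl o ns l)))
    (trans (flipBlock-▹ (range 0 o) (B l) (concatMap B L))
      (cong (λ z → range 0 o ++ z ++ concatMap B L) (sym (ivl-negate o ns l))))
  block-▹ (suc i) L _ =
    trans (cong (_▹ expand o ns L) (shift-suc o (swapBlocksAt i (map len L))))
    (trans (▹-suc (shift o (swapBlocksAt i (map len L))) (expand o ns L))
    (trans (cong (λ p → shift p (swapBlocksAt i (map len L)) ▹ˢ expand o ns L) (sym (length-range 0 o)))
    (trans (▹ˢ-shift (range 0 o) (swapBlocksAt i (map len L)) (concatMap B L))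
      (cong (range 0 o ++_) (swapBlocksAt-▹ i L)))))

  block-rises : ∀ {i L} → Ascent i L → Rises (block i (suc o ∷ map len L)) (expand o ns L)
  block-rises {L = pos c ∷ L} flip =
    subst₂ (λ p q → Rises (flipBlock p q) (expand o ns (pos c ∷ L))) (length-range 0 o) (length-ivl o ns (pos c))
      (flipBlock-rises (concatMap B L) (range-positive 0 o) (interval-positive o ns c)
        (All.tabulate λ a∈ → All.tabulate λ b∈ → range≪ b∈ a∈))
    where
    range≪ : range 0 o ≪ interval o ns c
    range≪ b∈ a∈ with All.lookup (range-positive 0 o) b∈ | All.lookup (range-bounded 0 o) b∈
    ... | isPos | l = All.lookup (interval-≻ o ns c l) a∈
  block-rises {suc i} {L} (swap a) =
    subst (λ w → Rises w (expand o ns L)) (sym (shift-suc o (swapBlocksAt i (map len L))))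
    (rises-suc (subst (λ p → Risesˢ (shift p (swapBlocksAt i (map len L))) (expand o ns L)) (length-range 0 o)
      (risesˢ-shift (range 0 o) (swapBlocksAt-rises a))))

-- Minimal elements of the cosets

data ConsecutiveAt : ℕ → ℕ → List Value → Set where
  up    : ∀ {c v} → ConsecutiveAt zero c (pos c ∷ pos (suc c) ∷ v)
  down  : ∀ {c v} → ConsecutiveAt zero c (neg (suc c) ∷ neg c ∷ v)
  there : ∀ {p c a v} → ConsecutiveAt p c v → ConsecutiveAt (suc p) c (a ∷ v)

-- Exchanging the values c and c + 1 has the same effect on these two entries as exchanging their
-- positions, so the ascent becomes a descent. In a negated block they occur as in `down`.
consecutive-ascent : ∀ {p c v} → ConsecutiveAt p c v →
  AscentAt p v × AscentAt p (swapAt p (map (actValue (suc c)) v))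
consecutive-ascent (up {c})   rewrite transpose-r c | transpose-1+r c =
  here (pos≺pos ℕ.≤-refl) , here (pos≺pos ℕ.≤-refl)
consecutive-ascent (down {c}) rewrite transpose-r c | transpose-1+r c =
  here (neg≺neg ℕ.≤-refl) , here (neg≺neg ℕ.≤-refl)
consecutive-ascent (there q) with consecutive-ascent q
... | a , d = there a , there d

consecutive-++ˡ : ∀ {p c v} w → ConsecutiveAt p c v → ConsecutiveAt p c (v ++ w)
consecutive-++ˡ w up        = up
consecutive-++ˡ w down      = down
consecutive-++ˡ w (there q) = there (consecutive-++ˡ w q)

consecutive-++ʳ : ∀ u {p c v} → ConsecutiveAt p c v → ConsecutiveAt (length u + p) c (u ++ v)
consecutive-++ʳ []      q = q
consecutive-++ʳ (_ ∷ u) q = there (consecutive-++ʳ u q)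

range-consecutive : ∀ m k p → suc p < k → ConsecutiveAt p (m + p) (range m k)
range-consecutive m (suc (suc k)) zero    _ = subst (λ c → ConsecutiveAt 0 c (range m (suc (suc k)))) (sym (ℕ.+-identityʳ m)) up
range-consecutive m (suc k)       (suc p) (s≤s l) =
  there (subst (λ c → ConsecutiveAt p c (range (suc m) k)) (sym (ℕ.+-suc m p)) (range-consecutive (suc m) k p l))
range-consecutive m (suc zero) zero (s≤s ())

opposite-∷ : ∀ a A → opposite (a ∷ A) ≡ opposite A ++ negate a ∷ []
opposite-∷ a A = List.unfold-reverse (negate a) (map negate A)

opposite-range-consecutive : ∀ m k p → suc p < k →
  ∃[ c ] m ≤ c × suc c < m + k × ConsecutiveAt p c (opposite (range m k))
opposite-range-consecutive m (suc k) p (s≤s l) with ℕ.m≤n⇒m<n∨m≡n l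
... | inj₁ l′ with opposite-range-consecutive (suc m) k p l′
...   | c , m<c , c< , q = c , ℕ.<⇒≤ m<c , subst (suc c <_) (sym (ℕ.+-suc m k)) c<
  , subst (ConsecutiveAt p c) (sym (opposite-∷ (pos m) (range (suc m) k))) (consecutive-++ˡ _ q)
opposite-range-consecutive m (suc .(suc p)) p (s≤s l) | inj₂ refl =
  m , ℕ.≤-refl , subst₂ _≤_ (ℕ.+-comm m 2) refl (ℕ.+-monoʳ-≤ m (s≤s (s≤s z≤n)))
  , subst (ConsecutiveAt p m) (sym shape) (subst (λ q → ConsecutiveAt q m (A ++ neg (suc m) ∷ neg m ∷ [])) p≡ (consecutive-++ʳ A down))
  where
  A = opposite (range (suc (suc m)) p)
  p≡ : length A + 0 ≡ p
  p≡ = trans (ℕ.+-identityʳ (length A)) (trans (length-opposite (range (suc (suc m)) p)) (length-range (suc (suc m)) p))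
  shape : opposite (range m (suc (suc p))) ≡ A ++ neg (suc m) ∷ neg m ∷ []
  shape = trans (opposite-∷ (pos m) (range (suc m) (suc p)))
    (trans (cong (_++ neg m ∷ []) (opposite-∷ (pos (suc m)) (range (suc (suc m)) p))) (List.++-assoc A _ _))

interval-consecutive : ∀ o ns e p → suc p < length (interval o ns e) →
  ∃[ j ] Inner ns j × ConsecutiveAt p (o + j) (interval o ns e)
interval-consecutive o (x ∷ ns) zero    p l =
  p , inn (subst (suc p <_) (length-range o x) l) , range-consecutive o x p (subst (suc p <_) (length-range o x) l)
interval-consecutive o (x ∷ ns) (suc e) p l with interval-consecutive (o + x) ns e p l
... | j , i , q = x + j , out i , subst (λ c → ConsecutiveAt p c (interval (o + x) ns e)) (ℕ.+-assoc o x j) q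

opposite-interval-consecutive : ∀ o ns e p → suc p < length (interval o ns e) →
  ∃[ j ] Inner ns j × ConsecutiveAt p (o + j) (opposite (interval o ns e))
opposite-interval-consecutive o (x ∷ ns) zero    p l with opposite-range-consecutive o x p (subst (suc p <_) (length-range o x) l)
... | c , o≤c , c< , q = c ∸ o , inn (ℕ.+-cancelˡ-< o _ _ (subst (_< o + x) (sym (trans (ℕ.+-suc o (c ∸ o)) (cong suc o+))) c<))
  , subst (λ c → ConsecutiveAt p c (opposite (range o x))) (sym o+) q
  where
  o+ : o + (c ∸ o) ≡ c
  o+ = ℕ.m+[n∸m]≡n o≤c
opposite-interval-consecutive o (x ∷ ns) (suc e) p l with opposite-interval-consecutive (o + x) ns e p l
... | j , i , q = x + j , out i , subst (λ c → ConsecutiveAt p c (opposite (interval (o + x) ns e))) (ℕ.+-assoc o x j) q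

blocks-consecutive : ∀ o ns L {j} → Inner (map (size ns) L) j →
  ∃[ i ] Inner ns i × ConsecutiveAt j (o + i) (concatMap (ivl o ns) L)
blocks-consecutive o ns (pos e ∷ L) {j} (inn l)
  with interval-consecutive o ns e j (subst (suc j <_) (sym (length-ivl o ns (pos e))) l)
... | i , p , q = i , p , consecutive-++ˡ _ q
blocks-consecutive o ns (neg e ∷ L) {j} (inn l)
  with opposite-interval-consecutive o ns e j
    (subst (suc j <_) (trans (sym (length-ivl o ns (neg e))) (length-opposite (interval o ns e))) l)
... | i , p , q = i , p , consecutive-++ˡ _ q
blocks-consecutive o ns (l ∷ L) (out {j = j} p) with blocks-consecutive o ns L p
... | i , p′ , q = i , p′ , subst (λ z → ConsecutiveAt (z + j) (o + i) (concatMap (ivl o ns) (l ∷ L))) (length-ivl o ns l) (consecutive-++ʳ (ivl o ns l) q)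

-- A letter inside a class of the target swaps consecutive values, which lie
-- inside a class of the source.
expand-conjugates : ∀ o ns L {i} → Inner (suc o ∷ map (size ns) L) i →
  ∃[ r ] Inner (suc o ∷ ns) r × Ascent i (expand o ns L) × Descent i (map (actValue r) (expand o ns L))
expand-conjugates (suc o) ns L {zero} (inn l) = 0 , inn l , flip , flip
expand-conjugates zero ns L {zero} (inn (s≤s ()))
expand-conjugates o ns L {suc p} (inn (s≤s l))
  with consecutive-ascent (consecutive-++ˡ (concatMap (ivl o ns) L) (range-consecutive 0 o p l))
... | a , d = suc p , inn (s≤s l) , swap a , swap d
expand-conjugates o ns L (out {j = j} p) with blocks-consecutive o ns L p
... | i , p′ , q with consecutive-ascent (subst (λ z → ConsecutiveAt (z + j) (o + i) (expand o ns L)) (length-range 0 o)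
      (consecutive-++ʳ (range 0 o) q))
...   | a , d = suc o + i , out p′ , swap a , swap d

range-++ : ∀ m a b → range m (a + b) ≡ range m a ++ range (m + a) b
range-++ m zero    b = cong (λ z → range z b) (sym (ℕ.+-identityʳ m))
range-++ m (suc a) b = cong (pos m ∷_) (trans (range-++ (suc m) a b) (cong (λ z → range (suc m) a ++ range z b) (sym (ℕ.+-suc m a))))

ivl-tail : ∀ o x ns m k → concatMap (ivl o (x ∷ ns)) (range (suc m) k) ≡ concatMap (ivl (o + x) ns) (range m k)
ivl-tail o x ns m zero    = refl
ivl-tail o x ns m (suc k) = cong (interval (o + x) ns m ++_) (ivl-tail o x ns (suc m) k)

concatMap-ivl : ∀ o ns → concatMap (ivl o ns) (range 0 (length ns)) ≡ range o (sum ns)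
concatMap-ivl o []       = refl
concatMap-ivl o (x ∷ ns) = trans
  (cong (range o x ++_) (trans (ivl-tail o x ns 0 (length ns)) (concatMap-ivl (o + x) ns)))
  (sym (range-++ o x (sum ns)))

expand-range : ∀ o ns → expand o ns (range 0 (length ns)) ≡ range 0 (o + sum ns)
expand-range o ns = trans (cong (range 0 o ++_) (concatMap-ivl o ns)) (sym (range-++ 0 o (sum ns)))

size-tail : ∀ x ns m k → map (size (x ∷ ns)) (range (suc m) k) ≡ map (size ns) (range m k)
size-tail x ns m zero    = refl
size-tail x ns m (suc k) = cong₂ _∷_ (length-interval x 0 ns m) (size-tail x ns (suc m) k)

sizes-range : ∀ ns → map (size ns) (range 0 (length ns)) ≡ ns
sizes-range []       = refl
sizes-range (x ∷ ns) = cong₂ _∷_ (length-range 0 x) (trans (size-tail x ns 0 (length ns)) (sizes-range ns))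

interval-nonempty : ∀ o {ns} → All NonZero ns → ∀ {c} → c < length ns → ∃[ a ] ∃[ A ] interval o ns c ≡ a ∷ A
interval-nonempty o {suc x ∷ ns} (_ ∷ ps) {zero}  _       = _ , _ , refl
interval-nonempty o {x ∷ ns}     (_ ∷ ps) {suc c} (s≤s l) = interval-nonempty (o + x) ps l

ivl-nonempty : ∀ o {ns} → All NonZero ns → ∀ {l} → magnitude l < length ns → ∃[ a ] ∃[ A ] ivl o ns l ≡ a ∷ A
ivl-nonempty o      ps {pos c} l< = interval-nonempty o ps l<
ivl-nonempty o {ns} ps {neg c} l< with interval o ns c | interval-nonempty o ps l< | opposite (interval o ns c) | length-opposite (interval o ns c)
... | _ | _ , _ , refl | b ∷ B | _ = b , B , refl

_≟ᵛ_ : (a b : Value) → Dec (a ≡ b)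
pos a ≟ᵛ pos b with a ℕ.≟ b
... | yes refl = yes refl
... | no a≢b   = no λ { refl → a≢b refl }
neg a ≟ᵛ neg b with a ℕ.≟ b
... | yes refl = yes refl
... | no a≢b   = no λ { refl → a≢b refl }
pos a ≟ᵛ neg b = no λ ()
neg a ≟ᵛ pos b = no λ ()

≪-head : ∀ {A B a A′ b B′ X Y} → A ≪ B → A ≡ a ∷ A′ → B ≡ b ∷ B′ → A ++ X ≢ B ++ Y
≪-head A≪B refl refl eq = ≺-irrefl (subst (_≺ _) (List.∷-injectiveˡ eq) (A≪B (Any.here refl) (Any.here refl)))

-- Blocks are nonempty, and distinct labels have blocks separated by `_≪_`. So the first entry of
-- the list determines the first label.
concatMap-ivl-injective : ∀ o {ns} → All NonZero ns → ∀ {L M} →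
  All (λ a → magnitude a < length ns) L → All (λ a → magnitude a < length ns) M →
  concatMap (ivl o ns) L ≡ concatMap (ivl o ns) M → L ≡ M
concatMap-ivl-injective o ps [] [] eq = refl
concatMap-ivl-injective o {ns} ps {M = m ∷ M} [] (m< ∷ _) eq with ivl o ns m | ivl-nonempty o ps {m} m<
... | _ | _ , _ , refl with () ← eq
concatMap-ivl-injective o {ns} ps {L = l ∷ L} (l< ∷ _) [] eq with ivl o ns l | ivl-nonempty o ps {l} l<
... | _ | _ , _ , refl with () ← eq
concatMap-ivl-injective o {ns} ps {l ∷ L} {m ∷ M} (l< ∷ ls) (m< ∷ ms) eq with l ≟ᵛ m
... | yes refl = cong (l ∷_) (concatMap-ivl-injective o ps ls ms (List.++-cancelˡ (ivl o ns l) _ _ eq))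
... | no l≢m with ≺-connex l m l≢m | ivl-nonempty o ps {l} l< | ivl-nonempty o ps {m} m<
...   | inj₁ l≺m | _ , _ , p | _ , _ , q = contradiction eq (≪-head (ivl-≪ o ns l≺m) p q)
...   | inj₂ m≺l | _ , _ , p | _ , _ , q = contradiction (sym eq) (≪-head (ivl-≪ o ns m≺l) q p)

expand-injective : ∀ o {ns} → All NonZero ns → ∀ {L M} →
  Window (length ns) L → Window (length ns) M → expand o ns L ≡ expand o ns M → L ≡ M
expand-injective o ps U V eq = concatMap-ivl-injective o ps (bounded U) (bounded V) (List.++-cancelˡ (range 0 o) _ _ eq)

letters : ∀ {n} (w : List ℕ) → All (_< n) w → List (Fin n)
letters []      []       = []
letters (i ∷ w) (p ∷ ps) = fromℕ< p ∷ letters w ps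

letters-▷ : ∀ {n} w (ps : All (_< n) w) v → letters w ps ▷ v ≡ w ▹ v
letters-▷ []      []       v = refl
letters-▷ (i ∷ w) (p ∷ ps) v = cong₂ act (Fin.toℕ-fromℕ< p) (letters-▷ w ps v)

letters-All : ∀ {n} {P : ℕ → Set} {Q : Fin n → Set} → (∀ s → P (toℕ s) → Q s) →
  ∀ {w} (ps : All (_< n) w) → All P w → All Q (letters w ps)
letters-All f []       []       = []
letters-All {P = P} f (p ∷ ps) (q ∷ qs) = f _ (subst P (sym (Fin.toℕ-fromℕ< p)) q) ∷ letters-All f ps qs

length-stepSizes : ∀ i v → length (stepSizes i v) ≡ length v
length-stepSizes zero    v = refl
length-stepSizes (suc i) v = length-swapAt i v

stepSizes-involutive : ∀ i v → stepSizes i (stepSizes i v) ≡ v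
stepSizes-involutive zero    v = refl
stepSizes-involutive (suc i) v = swapAt-involutive i v

-- Atomic generators with fixed n₀ = o + 1 and their products in W

module Blocks {n : ℕ} (𝒲 : CoxeterGroup.Calculus n) (o : ℕ) where

  open Composition 𝒲
  private module C = CoxeterGroup.Calculus 𝒲

  Sizes : List ℕ → Set
  Sizes ns = Composes n (suc o ∷ ns)

  subset : List ℕ → Subset n
  subset ns = toSubset n (suc o ∷ ns)

  positive-sizes : ∀ {ns} → Sizes ns → All NonZero ns
  positive-sizes c with composes-positive c
  ... | _ ∷ ps = ps

  expand-identity : ∀ {ns} → Sizes ns → expand o ns (range 0 (length ns)) ≡ range 0 n
  expand-identity {ns} c = trans (expand-range o ns) (cong (range 0) (ℕ.suc-injective (composes-sum c)))

  block-innerᴹ : ∀ {ns} → Sizes ns → ∀ i → i < length ns → All (Inner (merge i (suc o ∷ ns))) (block i (suc o ∷ ns))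
  block-innerᴹ c i l = block-inner i _ l

  block-bounded : ∀ {ns} → Sizes ns → ∀ i → i < length ns → All (_< n) (block i (suc o ∷ ns))
  block-bounded c i l = All.map (Inner-< (merge-composes c i (s≤s l))) (block-innerᴹ c i l)

  generator : ∀ {ns} → Sizes ns → ∀ i → i < length ns → W
  generator c i l = letters _ (block-bounded c i l)

  -- Here ns are the sizes of the source blocks, arranged according to L.
  module _ {ns ms} (i : ℕ) {L} (U : Window (length ns) L) (ms≡ : ms ≡ map (size ns) L) (c : Sizes ms) (l : i < length ms) where

    private
      l′ : i < length L
      l′ = subst (i <_) (trans (cong length ms≡) (List.length-map (size ns) L)) l

    generator-▷ : generator c i l ▷ expand o ns L ≡ expand o ns (act i L)
    generator-▷ = trans (letters-▷ _ (block-bounded c i l) _)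
      (trans (cong (λ z → block i (suc o ∷ z) ▹ expand o ns L) ms≡) (block-▹ o ns i L l′))

    generator-inversions : Ascent i L →
      inversions (generator c i l ▷ expand o ns L) ≡ length (block i (suc o ∷ ms)) + inversions (expand o ns L)
    generator-inversions a = trans (cong inversions (letters-▷ _ (block-bounded c i l) _))
      (rises-inversions (subst (λ z → Rises (block i (suc o ∷ z)) (expand o ns L)) (sym ms≡) (block-rises o ns a)))

  module _ {ns} (c : Sizes ns) (i : ℕ) (l : i < length ns) where

    private
      k = length ns
      x = generator c i l
      U₀ = range-window k

      U₁ : Window k (act i (range 0 k))
      U₁ = act-window i U₀

      c′ : Sizes (stepSizes i ns)
      c′ = composes-stepSizes i c

      l′ : i < length (stepSizes i ns)
      l′ = subst (i <_) (sym (length-stepSizes i ns)) l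

      sizes₁ : stepSizes i ns ≡ map (size ns) (act i (range 0 k))
      sizes₁ = sym (trans (sizes-act ns i (range 0 k)) (cong (stepSizes i) (sizes-range ns)))

    generator-window : window x ≡ expand o ns (act i (range 0 k))
    generator-window = trans (cong (x ▷_) (sym (expand-identity c))) (generator-▷ {ns} i U₀ (sym (sizes-range ns)) c l)

    generator-ℓ : ℓ x ≡ length (block i (suc o ∷ ns))
    generator-ℓ = trans (cong (λ v → inversions (x ▷ v)) (sym (expand-identity c)))
      (trans (generator-inversions {ns} i U₀ (sym (sizes-range ns)) c l (range-ascent k i l))
      (trans (cong (λ v → length (block i (suc o ∷ ns)) + inversions v) (expand-identity c))
      (trans (cong (length (block i (suc o ∷ ns)) +_) (inversions-range 0 n)) (ℕ.+-identityʳ _))))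

    -- Letter `i` of type B_k is an involution on arrangements. This makes the `right` half of
    -- `Conjugates` a consequence of the `left` half at the other end.
    generator-inverse : generator c′ i l′ · x ≈ ε
    generator-inverse = window-injective (trans (▷-++ (generator c′ i l′) x (range 0 n))
      (trans (cong (generator c′ i l′ ▷_) generator-window)
      (trans (generator-▷ {ns} i U₁ sizes₁ c′ l′)
      (trans (cong (expand o ns) (act-involutive i (range 0 k))) (expand-identity c)))))

    generator-ℓ≢0 : ℓ x ≢ 0
    generator-ℓ≢0 eq = ¬ascent×descent (range-ascent k i l) (subst (Ascent i) (sym fixed) (range-ascent k i l))
      where
      fixed : act i (range 0 k) ≡ range 0 k
      fixed = expand-injective o (positive-sizes c) U₁ U₀
        (trans (sym generator-window) (trans (window-cong (ℓ≡0⇒≈ε {x} eq)) (sym (expand-identity c))))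

    generator-left : ∀ {s} → s ∈ subset (stepSizes i ns) →
      ∃[ r ] r ∈ subset ns × s ∷ x ≈ x · ⟦ r ⟧ × s <ₗ x
    generator-left {s} s∈ with expand-conjugates o ns (act i (range 0 k))
        (subst (λ z → Inner (suc o ∷ z) (toℕ s)) sizes₁ (∈⇒Inner c′ s∈))
    ... | j , p , a , d = r , Inner⇒∈ c r (subst (Inner (suc o ∷ ns)) (sym r≡) p)
      , commutes s x r a′ (subst₂ (λ j v → Descent (toℕ s) (map (actValue j) v)) (sym r≡) (sym generator-window) d)
      , ℕ.≤-reflexive (sym (inversions-ascent a′))
      where
      r = fromℕ< (Inner-< c p)
      r≡ : toℕ r ≡ j
      r≡ = Fin.toℕ-fromℕ< (Inner-< c p)
      a′ : Ascent (toℕ s) (window x)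
      a′ = subst (Ascent (toℕ s)) (sym generator-window) a

  -- The letters are built from the proofs `c` and `l`, so two generators are compared through their
  -- windows.
  generator-cong : ∀ {ns ms} (eq : ns ≡ ms) (c : Sizes ns) (d : Sizes ms) i (l : i < length ns) (l′ : i < length ms) →
    window (generator c i l) ≡ window (generator d i l′)
  generator-cong refl c d i l l′ = trans (letters-▷ _ (block-bounded c i l) _) (sym (letters-▷ _ (block-bounded d i l′) _))

  generator-conjugates : ∀ {ns} (c : Sizes ns) i (l : i < length ns) →
    Conjugates (subset ns) (subset (stepSizes i ns)) (generator c i l)
  generator-conjugates {ns} c i l = record
    { left = λ s∈ → let r , r∈ , eq , _ = generator-left c i l s∈ in r , r∈ , eq
    ; right = rightᵍ
    ; minimal = λ s∈ → proj₂ (proj₂ (proj₂ (generator-left c i l s∈)))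
    }
    where
    x = generator c i l
    c′ = composes-stepSizes i c
    l′ = subst (i <_) (sym (length-stepSizes i ns)) l
    y = generator c′ i l′
    yx≈ε : y · x ≈ ε
    yx≈ε = generator-inverse c i l
    xy≈ε : x · y ≈ ε
    xy≈ε = ≈-trans (·-cong (G.inverseʳ-unique y x yx≈ε) (≈-refl {y})) (inverseˡ y)
    rightᵍ : ∀ {r} → r ∈ subset ns → ∃[ s ] s ∈ subset (stepSizes i ns) × s ∷ x ≈ x · ⟦ r ⟧
    rightᵍ {r} r∈ with generator-left c′ i l′ (subst (λ z → r ∈ subset z) (sym (stepSizes-involutive i ns)) r∈)
    ... | s , s∈ , eq , _ = s , s∈ , (begin
      s ∷ x ≈⟨ ·-cong xy≈ε (≈-refl {s ∷ x}) ⟨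
      (x · y) · (s ∷ x) ≈⟨ assoc x y (s ∷ x) ⟩
      x · (y · (s ∷ x)) ≈⟨ ·-cong (≈-refl {x}) (assoc y ⟦ s ⟧ x) ⟨
      x · ((y · ⟦ s ⟧) · x) ≈⟨ ·-cong (≈-refl {x}) (·-cong eq (≈-refl {x})) ⟨
      x · (r ∷ y · x) ≈⟨ ·-cong (≈-refl {x}) (cons-cong r yx≈ε) ⟩
      x · ⟦ r ⟧ ∎)
      where open ≈-Reasoning

  module Products {ns} (c : Sizes ns) where

    k = length ns

    sizes : List (Fin k) → List ℕ
    sizes w = map (size ns) (window w)

    sizes-∷ : ∀ s w → sizes (s ∷ w) ≡ stepSizes (toℕ s) (sizes w)
    sizes-∷ s w = sizes-act ns (toℕ s) (window w)

    sizes-composes : ∀ w → Sizes (sizes w)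
    sizes-composes []      = subst Sizes (sym (sizes-range ns)) c
    sizes-composes (s ∷ w) = subst Sizes (sym (sizes-∷ s w)) (composes-stepSizes (toℕ s) (sizes-composes w))

    <-sizes : ∀ s w → toℕ s < length (sizes w)
    <-sizes s w = subst (toℕ s <_) (sym (trans (List.length-map (size ns) (window w)) (length≡ (isWindow w)))) (Fin.toℕ<n s)

    factor : ∀ s w → W
    factor s w = generator (sizes-composes w) (toℕ s) (<-sizes s w)

    product : List (Fin k) → W
    product []      = ε
    product (s ∷ w) = factor s w · product w

    window-product : ∀ w → window (product w) ≡ expand o ns (window w)
    window-product []      = sym (expand-identity c)
    window-product (s ∷ w) = trans (▷-++ (factor s w) (product w) (range 0 n))
      (trans (cong (factor s w ▷_) (window-product w))
        (generator-▷ {ns} (toℕ s) (isWindow w) refl (sizes-composes w) (<-sizes s w)))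

    product-injective : ∀ {u w} → product u ≈ product w → window u ≡ window w
    product-injective {u} {w} eq = expand-injective o (positive-sizes c) (isWindow u) (isWindow w)
      (trans (sym (window-product u)) (trans (window-cong eq) (window-product w)))

    product-cong : ∀ {u w} → window u ≡ window w → product u ≈ product w
    product-cong {u} {w} eq = window-injective
      (trans (window-product u) (trans (cong (expand o ns) eq) (sym (window-product w))))

    factor-conjugates : ∀ s w → Conjugates (subset (sizes w)) (subset (sizes (s ∷ w))) (factor s w)
    factor-conjugates s w = subst (λ z → Conjugates (subset (sizes w)) (subset z) (factor s w)) (sym (sizes-∷ s w))
      (generator-conjugates (sizes-composes w) (toℕ s) (<-sizes s w))

    product-conjugates : ∀ w → Conjugates (subset (sizes [])) (subset (sizes w)) (product w)
    product-conjugates []      = Conjugates-ε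
    product-conjugates (s ∷ w) = Conjugates-· (factor-conjugates s w) (product-conjugates w)

    -- By `block-rises` each letter of the factor adds one inversion to the window of `product w`,
    -- and the factor has as many letters as its length.
    ascent⇒additive : ∀ s w → Ascent (toℕ s) (window w) → Additive (factor s w) (product w)
    ascent⇒additive s w a = trans (cong inversions (trans (▷-++ (factor s w) (product w) (range 0 n)) (cong (factor s w ▷_) (window-product w))))
      (trans (generator-inversions {ns} (toℕ s) (isWindow w) refl (sizes-composes w) (<-sizes s w) a)
        (cong₂ _+_ (sym (generator-ℓ (sizes-composes w) (toℕ s) (<-sizes s w))) (cong inversions (sym (window-product w)))))

    -- From `s ∷ w` the letter ascends back to the arrangement of `w`, so `product (s ∷ w)` is
    -- strictly shorter than `product w`.
    descent⇒nonadditive : ∀ s w → Descent (toℕ s) (window w) → ¬ Additive (factor s w) (product w)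
    descent⇒nonadditive s w d eq = ℕ.<⇒≱ (ℕ.m<n+m (ℓ (product (s ∷ w))) (ℕ.n≢0⇒n>0 (generator-ℓ≢0 (sizes-composes (s ∷ w)) (toℕ s) (<-sizes s (s ∷ w)))))
      (ℕ.≤-trans (ℕ.≤-reflexive (trans (sym (ascent⇒additive s (s ∷ w) d)) (ℓ-cong (product-cong {s ∷ s ∷ w} {w} (act-involutive (toℕ s) (window w))))))
      (ℕ.≤-trans (ℕ.m≤n+m (ℓ (product w)) (ℓ (factor s w))) (ℕ.≤-reflexive (sym eq))))

-- The functor

module Preadditive {Obj : Set} {Gen : Obj → Obj → Set}
  (R : ∀ {a b} → Rel (Presentation.Term Gen a b) 0ℓ) where

  open Presentation Gen public using (Term; gen; id; 0#; _⊕_; ⊖_) renaming (_∘_ to infixr 9 _⊚_)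
  private module P = Presentation Gen
  open P public using (rel; ≋-refl; ≋-sym; ≋-trans; ∘-cong; ∘-assoc; identityˡ; identityʳ; ⊕-cong; ⊖-cong; distribˡ; distribʳ)

  infix 4 _≋_
  _≋_ : ∀ {a b} → Rel (Term a b) 0ℓ
  _≋_ = P._≋_ R

  terms : Obj → Obj → AbelianGroup 0ℓ 0ℓ
  terms a b = record
    { Carrier = Term a b ; _≈_ = _≋_ ; _∙_ = _⊕_ ; ε = 0# ; _⁻¹ = ⊖_
    ; isAbelianGroup = record
      { isGroup = record
        { isMonoid = record
          { isSemigroup = record
            { isMagma = record
              { isEquivalence = record { refl = ≋-refl ; sym = ≋-sym ; trans = ≋-trans }
              ; ∙-cong = ⊕-cong }
            ; assoc = P.⊕-assoc }
          ; identity = P.⊕-identityˡ , λ f → ≋-trans (P.⊕-comm f 0#) (P.⊕-identityˡ f) }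
        ; inverse = P.⊖-inverseˡ , λ f → ≋-trans (P.⊕-comm f (⊖ f)) (P.⊖-inverseˡ f)
        ; ⁻¹-cong = ⊖-cong }
      ; comm = P.⊕-comm }
    }

  module _ {a b : Obj} where
    open GroupProperties (AbelianGroup.group (terms a b)) public using (identityˡ-unique; inverseˡ-unique)

  zeroʳ : ∀ {a b c} (f : Term b c) → f ⊚ 0# {a} ≋ 0#
  zeroʳ f = identityˡ-unique _ _ (≋-trans (≋-sym (distribˡ f 0# 0#)) (∘-cong ≋-refl (P.⊕-identityˡ 0#)))

  zeroˡ : ∀ {a b c} (g : Term a b) → 0# {b} {c} ⊚ g ≋ 0#
  zeroˡ g = identityˡ-unique _ _ (≋-trans (≋-sym (distribʳ g 0# 0#)) (∘-cong (P.⊕-identityˡ 0#) ≋-refl))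

  ⊚-⊖ : ∀ {a b c} (f : Term b c) (g : Term a b) → f ⊚ (⊖ g) ≋ ⊖ (f ⊚ g)
  ⊚-⊖ f g = inverseˡ-unique _ _ (≋-trans (≋-sym (distribˡ f (⊖ g) g)) (≋-trans (∘-cong ≋-refl (P.⊖-inverseˡ g)) (zeroʳ f)))

  ⊖-⊚ : ∀ {a b c} (f : Term b c) (g : Term a b) → (⊖ f) ⊚ g ≋ ⊖ (f ⊚ g)
  ⊖-⊚ f g = inverseˡ-unique _ _ (≋-trans (≋-sym (distribʳ g (⊖ f) f)) (≋-trans (∘-cong (P.⊖-inverseˡ f) ≋-refl) (zeroˡ g)))

~-length : ∀ {k} {u w : List (Fin k)} → u ~ w → length u ≡ length w
~-length ~-refl         = refl
~-length (~-sym p)      = sym (~-length p)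
~-length (~-trans p q)  = trans (~-length p) (~-length q)
~-length (~-cons s p)   = cong suc (~-length p)
~-length (~-far _ _ _)  = refl
~-length (~-adj _ _ _ _)  = refl
~-length (~-four _ _ _ _) = refl

~-window : ∀ {k} {u w : List (Fin k)} → u ~ w → window u ≡ window w
~-window {k} p = Words.window-cong k (Words.~⇒≈ k p)

Tight : ∀ {k} → List (Fin k) → Set
Tight w = length w ≡ inversions (window w)

tight : ∀ {k} {w : List (Fin k)} → Reduced w → Tight w
tight r = sym (inversions-reduced r)

reduced : ∀ {k} (w : List (Fin k)) → Tight w → Reduced w
reduced {k} = Coxeter.tight⇒Reduced k

words : ∀ k → ℕ → List (List (Fin k))
words k zero    = [] ∷ []
words k (suc m) = [] ∷ concatMap (λ s → map (s ∷_) (words k m)) (allFin k)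

∈-words : ∀ {k} (w : List (Fin k)) m → length w ≤ m → w ∈ᴸ words k m
∈-words []      zero    _       = Any.here refl
∈-words []      (suc m) _       = Any.here refl
∈-words {k} (s ∷ w) (suc m) (s≤s l) = Any.there (Membership.∈-concatMap⁺ (λ s → map (s ∷_) (words k m))
  (lose (Membership.∈-allFin s) (Membership.∈-map⁺ (s ∷_) (∈-words w m l))))

length-inversionsBound : ∀ {k} {w : List (Fin k)} → Tight w → length w ≤ inversionsBound k
length-inversionsBound {k} {w} t = subst₂ _≤_ (sym t) (cong inversionsBound (length≡ (isWindow w))) (inversions-≤ (window w))

module Functor {n : ℕ} (𝒲 : CoxeterGroup.Calculus n) where

  open Composition 𝒲
  private
    module C = CoxeterGroup.Calculus 𝒲
    module L = LNC n
  open Preadditive {Sequence n} {λ a b → Σ[ i ∈ ℕ ] a ⟶[ i ] b} (L.Relation)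
    using (Term; gen; id; _⊚_)
    renaming (_≋_ to infix 4 _≋ᴸ_; 0# to 0ᴸ; _⊕_ to infixl 6 _⊕ᴸ_; ⊖_ to ⊖ᴸ_)

  F₀ : Sequence n → Subset n
  F₀ a = toSubset n (entries a)

  moveWord : ∀ {xs} → Composes n xs → ∀ i → suc i < length xs → W
  moveWord {suc o ∷ ns} c i l = Blocks.generator 𝒲 o c i (s≤s⁻¹ l)

  edgeWord : ∀ {a b} i → a ⟶[ i ] b → W
  edgeWord {a} i (step e) = moveWord (entries-composes a) i (proj₁ (Step-length e))

  F : ∀ {a b} → Term a b → Morphism (F₀ a) (F₀ b)
  F (gen (i , e)) = ∂ (edgeWord i e)
  F id            = idᴰ
  F (f ⊚ g)       = F f ⊙ F g
  F 0ᴸ            = 0#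
  F (f ⊕ᴸ g)      = F f ⊕ F g
  F (⊖ᴸ f)        = ⊖ F f

  edge-conjugates : ∀ {a b} i (e : a ⟶[ i ] b) → Conjugates (F₀ a) (F₀ b) (edgeWord i e)
  edge-conjugates {a} {b} i (step e) = go (entries-composes a) (proj₁ (Step-length e)) e
    where
    go : ∀ {xs ys} (c : Composes n xs) (l : suc i < length xs) → Step i xs ys →
      Conjugates (toSubset n xs) (toSubset n ys) (moveWord c i l)
    go {suc o ∷ ns} c l e = subst (λ ys → Conjugates (toSubset n (suc o ∷ ns)) (toSubset n ys) (moveWord c i l))
      (sym (Step⇒stepSizes e)) (Blocks.generator-conjugates 𝒲 o c i (s≤s⁻¹ l))

  -- Merging at `i` gives the same `M` from both ends of the edge. The element removed at the source
  -- is s, the one removed at the target is `t`, and `conjugate-wM` relates the two.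
  edge-atomic : ∀ {a b} i (e : a ⟶[ i ] b) → IsAtomic (F₀ a) i (F₀ b) (edgeWord i e)
  edge-atomic {a} {b} i (step e)
    with cut (entries-composes a) i (proj₁ (Step-length e)) | cut (entries-composes b) i (proj₂ (Step-length e))
  ... | record { s = s ; nth = nth ; s∉J = s∉J ; insert≡ = insert≡ } | record { s = t ; s∈M = t∈M ; delete≡ = delete≡ }
    with Nth⇒lookup nth
  ... | d , d≡i , refl = d , d≡i , t
    , conjugate-wM X s∉J t∈ x∈ x≢0 , I≡ , subst (λ z → x ∼[ z , F₀ a ] C.w₀ M) (sym I≡) (atomic-∼ X s∉J t∈ x∈ x≢0)
    where
    x = edgeWord {a} {b} i (step e)
    M = F₀ a ∪ ⁅ lookup (separators (F₀ a)) d ⁆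
    M≡ : toSubset n (merge i (entries b)) ≡ M
    M≡ = trans (cong (toSubset n) (sym (Step-merge e))) (sym insert≡)
    t∈ : t ∈ M
    t∈ = subst (t ∈_) M≡ t∈M
    I≡ : F₀ b ≡ M - t
    I≡ = trans (sym delete≡) (cong (_- t) M≡)
    X : Conjugates (F₀ a) (M - t) x
    X = subst (λ z → Conjugates (F₀ a) z x) I≡ (edge-conjugates {a} {b} i (step e))
    x∈ : x ∈⟨ M ⟩
    x∈ = subst (x ∈⟨_⟩) (sym insert≡) (go (entries-composes a) (proj₁ (Step-length e)))
      where
      go : ∀ {xs} (c : Composes n xs) (l : suc i < length xs) → moveWord c i l ∈⟨ toSubset n (merge i xs) ⟩
      go {suc o ∷ ns} c l = _ , letters-All (Inner⇒∈ (merge-composes c i l)) (Blocks.block-bounded 𝒲 o c i (s≤s⁻¹ l))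
        (Blocks.block-innerᴹ 𝒲 o c i (s≤s⁻¹ l)) , ≈-refl
    x≢0 : ℓ x ≢ 0
    x≢0 = go (entries-composes a) (proj₁ (Step-length e))
      where
      go : ∀ {xs} (c : Composes n xs) (l : suc i < length xs) → ℓ (moveWord c i l) ≢ 0
      go {suc o ∷ ns} c l = Blocks.generator-ℓ≢0 𝒲 o c i (s≤s⁻¹ l)

  F-inAD : ∀ {a b} (f : Term a b) → InAD (F f)
  F-inAD (gen (i , e)) = atomic i (edge-atomic i e)
  F-inAD id            = id∈
  F-inAD (f ⊚ g)       = ∘∈ (F-inAD f) (F-inAD g)
  F-inAD 0ᴸ            = 0∈
  F-inAD (f ⊕ᴸ g)      = ⊕∈ (F-inAD f) (F-inAD g)
  F-inAD (⊖ᴸ f)        = ⊖∈ (F-inAD f)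

  Spanned : ∀ {J I} → Morphism J I → Set
  Spanned f = ∃[ g ] f ≋ g × Span g

  ⊙-spanned : ∀ {I J K} {f : Morphism J I} {g : Morphism K J} → Span f → Span g → Spanned (f ⊙ g)
  ⊙-spanned (basis {x} X) (basis {y} Y) with Additive? x y
  ... | yes xy = _ , ∂⊙∂-additive X Y xy , basis (Conjugates-· X Y)
  ... | no ¬xy = _ , ∂⊙∂-nonadditive X Y ¬xy , 0ˢ
  ⊙-spanned (basis X) 0ˢ = _ , ≋-refl , 0ˢ
  ⊙-spanned (basis X) (sf ⊕ˢ sg) with ⊙-spanned (basis X) sf | ⊙-spanned (basis X) sg
  ... | _ , e , s | _ , e′ , s′ = _ , ⊕-cong e e′ , s ⊕ˢ s′
  ⊙-spanned (basis X) (⊖ˢ sf) with ⊙-spanned (basis X) sf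
  ... | _ , e , s = _ , ⊖-cong e , ⊖ˢ s
  ⊙-spanned 0ˢ h = _ , ≋-refl , 0ˢ
  ⊙-spanned (sf ⊕ˢ sg) h with ⊙-spanned sf h | ⊙-spanned sg h
  ... | _ , e , s | _ , e′ , s′ = _ , ⊕-cong e e′ , s ⊕ˢ s′
  ⊙-spanned (⊖ˢ sf) h with ⊙-spanned sf h
  ... | _ , e , s = _ , ⊖-cong e , ⊖ˢ s

  F-spanned : ∀ {a b} (f : Term a b) → Spanned (F f)
  F-spanned (gen (i , e)) = _ , ≋-refl , basis (edge-conjugates i e)
  F-spanned id            = _ , ≋-refl , basis Conjugates-ε
  F-spanned (f ⊚ g) with F-spanned f | F-spanned g
  ... | _ , e , s | _ , e′ , s′ with ⊙-spanned s s′
  ...   | _ , e″ , s″ = _ , ≋-trans (⊙-cong e e′) e″ , s″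
  F-spanned 0ᴸ            = _ , ≋-refl , 0ˢ
  F-spanned (f ⊕ᴸ g) with F-spanned f | F-spanned g
  ... | _ , e , s | _ , e′ , s′ = _ , ⊕-cong e e′ , s ⊕ˢ s′
  F-spanned (⊖ᴸ f) with F-spanned f
  ... | _ , e , s = _ , ⊖-cong e , ⊖ˢ s

  F-identityʳ : ∀ {a b} (f : Term a b) → F f ⊙ idᴰ ≋ F f
  F-identityʳ f with F-spanned f
  ... | _ , e , s = ≋-trans (⊙-congˡ e idᴰ) (≋-trans (⊙-identityʳ s) (≋-sym e))

  F-identityˡ : ∀ {a b} (f : Term a b) → idᴰ ⊙ F f ≋ F f
  F-identityˡ f with F-spanned f
  ... | _ , e , s = ≋-trans (⊙-congʳ idᴰ e) (≋-trans (⊙-identityˡ s) (≋-sym e))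

  F-assoc : ∀ {a b c d} (f : Term c d) (g : Term b c) (h : Term a b) → (F f ⊙ F g) ⊙ F h ≋ F f ⊙ (F g ⊙ F h)
  F-assoc f g h with F-spanned f | F-spanned g | F-spanned h
  ... | _ , e , s | _ , e′ , s′ | _ , e″ , s″ = ≋-trans (⊙-cong (⊙-cong e e′) e″)
    (≋-trans (⊙-assoc s s′ s″) (≋-sym (⊙-cong e (⊙-cong e′ e″))))

  -- Monomials carry indices `toℕ s`, on which `suc` cannot be matched; hence the equation for `j`.
  braid₃ : ∀ {a b c b′ c′ z} i j → 1 ≤ i → j ≡ suc i →
    (e₁ : a ⟶[ i ] b) (e₂ : b  ⟶[ j ] c)  (e₃ : c  ⟶[ i ] z)
    (f₁ : a ⟶[ j ] b′) (f₂ : b′ ⟶[ i ] c′) (f₃ : c′ ⟶[ j ] z) →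
    L.∂ i e₃ ⊚ L.∂ j e₂ ⊚ L.∂ i e₁ ≋ᴸ L.∂ j f₃ ⊚ L.∂ i f₂ ⊚ L.∂ j f₁
  braid₃ i _ l refl e₁ e₂ e₃ f₁ f₂ f₃ = L.rel (L.braid₃ i l e₁ e₂ e₃ f₁ f₂ f₃)

  braid₄ : ∀ {a b c d b′ c′ d′ z} i j → i ≡ 0 → j ≡ 1 →
    (e₁ : a ⟶[ j ] b)  (e₂ : b  ⟶[ i ] c)  (e₃ : c  ⟶[ j ] d)  (e₄ : d  ⟶[ i ] z)
    (f₁ : a ⟶[ i ] b′) (f₂ : b′ ⟶[ j ] c′) (f₃ : c′ ⟶[ i ] d′) (f₄ : d′ ⟶[ j ] z) →
    L.∂ i e₄ ⊚ L.∂ j e₃ ⊚ L.∂ i e₂ ⊚ L.∂ j e₁ ≋ᴸ L.∂ j f₄ ⊚ L.∂ i f₃ ⊚ L.∂ j f₂ ⊚ L.∂ i f₁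
  braid₄ _ _ refl refl e₁ e₂ e₃ e₄ f₁ f₂ f₃ f₄ = L.rel (L.braid₄ e₁ e₂ e₃ e₄ f₁ f₂ f₃ f₄)

  -- Words in the generators of type B_k index the monomials with source (o + 1, ns).
  module Monomials (o : ℕ) {ns : List ℕ} (c : Composes n (suc o ∷ ns)) where

    open Blocks.Products 𝒲 o c

    target : List (Fin k) → Sequence n
    target w = sequence (suc o ∷ sizes w) (sizes-composes w)

    edgeTo : ∀ s w → target w ⟶[ toℕ s ] target (s ∷ w)
    edgeTo s w = step (subst (λ v → Step (toℕ s) (suc o ∷ sizes w) (suc o ∷ v)) (sym (sizes-∷ s w))
      (stepSizes⇒Step (toℕ s) (<-sizes s w)))

    -- The end object is given through an equation because words with the same window have targets
    -- that are equal only propositionally.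
    monomial : ∀ w {b} → target w ≡ b → Term (target []) b
    monomial []      refl = id
    monomial (s ∷ w) refl = L.∂ (toℕ s) (edgeTo s w) ⊚ monomial w refl

    target-cong : ∀ {u w} → window u ≡ window w → target u ≡ target w
    target-cong eq = entries-injective (cong (λ v → suc o ∷ map (size ns) v) eq)

    target-step : ∀ {s w b} → target w ⟶[ toℕ s ] b → target (s ∷ w) ≡ b
    target-step {s} {w} (step e) = entries-injective (trans (cong (suc o ∷_) (sizes-∷ s w)) (sym (Step⇒stepSizes e)))

    monomial-∷ : ∀ s w {d b} (p : target w ≡ d) (q : target (s ∷ w) ≡ b) (e : d ⟶[ toℕ s ] b) →
      monomial (s ∷ w) q ≡ L.∂ (toℕ s) e ⊚ monomial w p
    monomial-∷ s w refl refl e = cong (λ e → L.∂ (toℕ s) e ⊚ monomial w refl) (⟶-irrelevant (edgeTo s w) e)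

    letter : ∀ {w i b} → target w ⟶[ i ] b → ∃[ s ] toℕ {k} s ≡ i
    letter {w} {i} (step e) = fromℕ< i<k , Fin.toℕ-fromℕ< i<k
      where
      i<k : i < k
      i<k = subst (i <_) (trans (List.length-map (size ns) (window w)) (length≡ (isWindow w))) (s≤s⁻¹ (proj₁ (Step-length e)))

    -- Each braid move is a defining relation applied to the front of the monomial, so a derivation
    -- in `_~_` translates step by step.
    monomial-cong : ∀ {u w} → u ~ w → ∀ {b} (p : target u ≡ b) (q : target w ≡ b) → monomial u p ≋ᴸ monomial w q
    monomial-cong ~-refl refl refl = L.≋-refl
    monomial-cong (~-sym r) p q = L.≋-sym (monomial-cong r q p)
    monomial-cong (~-trans {u = u} {v} r r′) p q =
      L.≋-trans (monomial-cong r p mid) (monomial-cong r′ mid q)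
      where mid = trans (target-cong {v} {u} (~-window (~-sym r))) p
    monomial-cong (~-cons s {u} {w} r) refl q
      rewrite monomial-∷ s w (target-cong {w} {u} (~-window (~-sym r))) q (edgeTo s u) =
      L.∘-cong L.≋-refl (monomial-cong r refl (target-cong {w} {u} (~-window (~-sym r))))
    -- The rewrite lets the last edge of the second word end at the target of the first, as the
    -- relation requires a common end.
    monomial-cong (~-far s t {w} f) refl q
      rewrite monomial-∷ t (s ∷ w) refl q (subst (target (s ∷ w) ⟶[ toℕ t ]_) q (edgeTo t (s ∷ w))) =
      L.≋-trans (L.≋-sym (L.∘-assoc _ _ _))
      (L.≋-trans (L.∘-cong (L.rel (L.commute (toℕ s) (toℕ t) f _ _ _ _)) L.≋-refl) (L.∘-assoc _ _ _))
    monomial-cong (~-adj s t {w} l eq) refl q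
      rewrite monomial-∷ t (s ∷ t ∷ w) refl q (subst (target (s ∷ t ∷ w) ⟶[ toℕ t ]_) q (edgeTo t (s ∷ t ∷ w))) =
      L.≋-trans (L.≋-sym assoc₃)
      (L.≋-trans (L.∘-cong (braid₃ (toℕ s) (toℕ t) l eq _ _ _ _ _ _) L.≋-refl) assoc₃)
      where
      assoc₃ : ∀ {a b c d e} {f : Term d e} {g : Term c d} {h : Term b c} {m : Term a b} →
        (f ⊚ g ⊚ h) ⊚ m ≋ᴸ f ⊚ g ⊚ h ⊚ m
      assoc₃ = L.≋-trans (L.∘-assoc _ _ _) (L.∘-cong L.≋-refl (L.∘-assoc _ _ _))
    monomial-cong (~-four s t {w} eq eq′) refl q
      rewrite monomial-∷ t (s ∷ t ∷ s ∷ w) refl q (subst (target (s ∷ t ∷ s ∷ w) ⟶[ toℕ t ]_) q (edgeTo t (s ∷ t ∷ s ∷ w))) =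
      L.≋-trans (L.≋-sym assoc₄)
      (L.≋-trans (L.∘-cong (braid₄ (toℕ s) (toℕ t) eq eq′ _ _ _ _ _ _ _ _) L.≋-refl) assoc₄)
      where
      assoc₄ : ∀ {a b c d e x} {f : Term e x} {f′ : Term d e} {g : Term c d} {h : Term b c} {m : Term a b} →
        (f ⊚ f′ ⊚ g ⊚ h) ⊚ m ≋ᴸ f ⊚ f′ ⊚ g ⊚ h ⊚ m
      assoc₄ = L.≋-trans (L.∘-assoc _ _ _) (L.∘-cong L.≋-refl (L.≋-trans (L.∘-assoc _ _ _) (L.∘-cong L.≋-refl (L.∘-assoc _ _ _))))

    factor≈ : ∀ s w → edgeWord (toℕ s) (edgeTo s w) ≈ factor s w
    factor≈ s w = window-injective (Blocks.generator-cong 𝒲 o refl _ (sizes-composes w) (toℕ s) _ (<-sizes s w))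

    F-monomial : ∀ {w} → Reduced w → ∀ {b} (q : target w ≡ b) → F (monomial w q) ≋ ∂ (product w)
    F-monomial [] refl = ≋-refl
    F-monomial {s ∷ w} (a ∷ r) refl = ≋-trans (⊙-cong (∂-cong (∼-reflexive (factor≈ s w))) (F-monomial r refl))
      (∂⊙∂-additive (factor-conjugates s w) (product-conjugates w) (ascent⇒additive s w a))

    -- The letter in front of the longest reduced suffix is a descent of it, and there the lengths
    -- do not add.
    F-monomial-0 : ∀ w → ¬ Reduced w → ∀ {b} (q : target w ≡ b) → F (monomial w q) ≋ 0#
    F-monomial-0 [] ¬r refl = contradiction [] ¬r
    F-monomial-0 (s ∷ w) ¬r refl with length w ℕ.≟ inversions (window w)
    ... | no ¬t = ⊙-congʳ (∂ _) (F-monomial-0 w (¬t ∘ tight) refl)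
    ... | yes t with ascent? (toℕ s) (isWindow w) (Fin.toℕ<n s)
    ...   | inj₁ a = contradiction (a ∷ reduced w t) ¬r
    ...   | inj₂ d = ≋-trans (⊙-cong (∂-cong (∼-reflexive (factor≈ s w))) (F-monomial (reduced w t) refl))
      (∂⊙∂-nonadditive (factor-conjugates s w) (product-conjugates w) (descent⇒nonadditive s w d))

    F-monomial-cong : ∀ {u w} → u ~ w → ∀ {b} (p : target u ≡ b) (q : target w ≡ b) → F (monomial u p) ≋ F (monomial w q)
    F-monomial-cong {u} {w} r p q with length u ℕ.≟ inversions (window u)
    ... | yes t = ≋-trans (F-monomial (reduced u t) p) (≋-trans
      (∂-cong (∼-reflexive (product-cong {u} {w} (~-window r))))
      (≋-sym (F-monomial (reduced w (trans (sym (~-length r)) (trans t (cong inversions (~-window r))))) q)))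
    ... | no ¬t = ≋-trans (F-monomial-0 u (¬t ∘ tight) p) (≋-sym (F-monomial-0 w
      (λ r′ → ¬t (trans (~-length r) (trans (tight r′) (cong inversions (sym (~-window r)))))) q))

    prepend : ∀ {s i w d b} → toℕ s ≡ i → (e : d ⟶[ i ] b) → (p : target w ≡ d) →
      Σ[ q ∈ target (s ∷ w) ≡ b ] monomial (s ∷ w) q ≡ L.∂ i e ⊚ monomial w p
    prepend {s} {w = w} refl e refl = target-step {s} {w} e , monomial-∷ s w refl (target-step {s} {w} e) e

    -- Both sides are rewritten as monomials of words in the letters of B_k, so that the relation
    -- follows from `F-monomial-cong` or from `F-monomial-0`. `F-identityʳ` accounts for the
    -- identity in which every monomial ends.
    F-relation : ∀ {a b} {f g : Term a b} → target [] ≡ a → L.Relation f g → F f ≋ F g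
    F-relation refl (L.square {b = b} i e₁ e₂) =
      let s , s≡ = letter {[]} e₁
          q₁ , m₁ = prepend {s} {w = []} s≡ e₁ refl
          q₂ , m₂ = prepend {s} {w = s ∷ []} s≡ e₂ q₁
      in ≋-trans (⊙-congʳ (F (L.∂ i e₂)) (≋-sym (F-identityʳ (L.∂ i e₁))))
      (subst (λ f → F f ≋ 0#) (trans m₂ (cong (L.∂ i e₂ ⊚_) m₁))
        (F-monomial-0 (s ∷ s ∷ []) (λ { (a ∷ a′ ∷ []) → ¬ascent×descent a′ a }) q₂))
    F-relation refl (L.commute i j f e₁ e₂ f₁ f₂) =
      let s , s≡ = letter {[]} f₁
          t , t≡ = letter {[]} e₁
          p₁ , m₁ = prepend {t} {w = []} t≡ e₁ refl
          q₁ , n₁ = prepend {s} {w = []} s≡ f₁ refl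
          p₂ , m₂ = prepend {s} {w = t ∷ []} s≡ e₂ p₁
          q₂ , n₂ = prepend {t} {w = s ∷ []} t≡ f₂ q₁
      in ≋-trans (⊙-congʳ (F (L.∂ i e₂)) (≋-sym (F-identityʳ (L.∂ j e₁))))
      (≋-trans (subst₂ (λ f g → F f ≋ F g) (trans m₂ (cong (L.∂ i e₂ ⊚_) m₁)) (trans n₂ (cong (L.∂ j f₂ ⊚_) n₁))
        (F-monomial-cong (~-far s t {[]} (subst₂ Far (sym s≡) (sym t≡) f)) p₂ q₂))
      (⊙-congʳ (F (L.∂ j f₂)) (F-identityʳ (L.∂ i f₁))))
    F-relation refl (L.braid₃ i l e₁ e₂ e₃ f₁ f₂ f₃) =
      let s , s≡ = letter {[]} e₁
          t , t≡ = letter {[]} f₁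
          p₁ , m₁ = prepend {s} {w = []} s≡ e₁ refl
          q₁ , n₁ = prepend {t} {w = []} t≡ f₁ refl
          p₂ , m₂ = prepend {t} {w = s ∷ []} t≡ e₂ p₁
          q₂ , n₂ = prepend {s} {w = t ∷ []} s≡ f₂ q₁
          p₃ , m₃ = prepend {s} {w = t ∷ s ∷ []} s≡ e₃ p₂
          q₃ , n₃ = prepend {t} {w = s ∷ t ∷ []} t≡ f₃ q₂
      in ≋-trans (⊙-congʳ (F (L.∂ i e₃)) (⊙-congʳ (F (L.∂ (suc i) e₂)) (≋-sym (F-identityʳ (L.∂ i e₁)))))
      (≋-trans (subst₂ (λ f g → F f ≋ F g)
          (trans m₃ (cong (L.∂ i e₃ ⊚_) (trans m₂ (cong (L.∂ (suc i) e₂ ⊚_) m₁))))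
          (trans n₃ (cong (L.∂ (suc i) f₃ ⊚_) (trans n₂ (cong (L.∂ i f₂ ⊚_) n₁))))
        (F-monomial-cong (~-adj s t {[]} (subst (1 ≤_) (sym s≡) l) (trans t≡ (cong suc (sym s≡)))) p₃ q₃))
      (⊙-congʳ (F (L.∂ (suc i) f₃)) (⊙-congʳ (F (L.∂ i f₂)) (F-identityʳ (L.∂ (suc i) f₁)))))
    F-relation refl (L.braid₄ e₁ e₂ e₃ e₄ f₁ f₂ f₃ f₄) =
      let s , s≡ = letter {[]} f₁
          t , t≡ = letter {[]} e₁
          p₁ , m₁ = prepend {t} {w = []} t≡ e₁ refl
          q₁ , n₁ = prepend {s} {w = []} s≡ f₁ refl
          p₂ , m₂ = prepend {s} {w = t ∷ []} s≡ e₂ p₁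
          q₂ , n₂ = prepend {t} {w = s ∷ []} t≡ f₂ q₁
          p₃ , m₃ = prepend {t} {w = s ∷ t ∷ []} t≡ e₃ p₂
          q₃ , n₃ = prepend {s} {w = t ∷ s ∷ []} s≡ f₃ q₂
          p₄ , m₄ = prepend {s} {w = t ∷ s ∷ t ∷ []} s≡ e₄ p₃
          q₄ , n₄ = prepend {t} {w = s ∷ t ∷ s ∷ []} t≡ f₄ q₃
      in ≋-trans (⊙-congʳ (F (L.∂ 0 e₄)) (⊙-congʳ (F (L.∂ 1 e₃)) (⊙-congʳ (F (L.∂ 0 e₂)) (≋-sym (F-identityʳ (L.∂ 1 e₁))))))
      (≋-trans (subst₂ (λ f g → F f ≋ F g)
          (trans m₄ (cong (L.∂ 0 e₄ ⊚_) (trans m₃ (cong (L.∂ 1 e₃ ⊚_) (trans m₂ (cong (L.∂ 0 e₂ ⊚_) m₁))))))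
          (trans n₄ (cong (L.∂ 1 f₄ ⊚_) (trans n₃ (cong (L.∂ 0 f₃ ⊚_) (trans n₂ (cong (L.∂ 1 f₂ ⊚_) n₁))))))
        (F-monomial-cong (~-four s t {[]} s≡ t≡) p₄ q₄))
      (⊙-congʳ (F (L.∂ 1 f₄)) (⊙-congʳ (F (L.∂ 0 f₃)) (⊙-congʳ (F (L.∂ 1 f₂)) (F-identityʳ (L.∂ 0 f₁))))))

-- Fullness and faithfulness

module Isomorphism {n : ℕ} (𝒲 : CoxeterGroup.Calculus n) where

  open Composition 𝒲
  open Functor 𝒲
  private
    module C = CoxeterGroup.Calculus 𝒲
    module L = LNC n
    module M = Monomials
  open Preadditive {Sequence n} {λ a b → Σ[ i ∈ ℕ ] a ⟶[ i ] b} (L.Relation)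
    using (Term; gen; id; _⊚_; zeroʳ; zeroˡ; ⊚-⊖; ⊖-⊚)
    renaming (_≋_ to infix 4 _≋ᴸ_; 0# to 0ᴸ; _⊕_ to infixl 6 _⊕ᴸ_; ⊖_ to ⊖ᴸ_)

  source : ∀ a → Σ[ o ∈ ℕ ] Σ[ ns ∈ List ℕ ] Σ[ c ∈ Composes n (suc o ∷ ns) ] M.target o c [] ≡ a
  source a = go refl (entries-composes a)
    where
    go : ∀ {xs} → xs ≡ entries a → Composes n xs → Σ[ o ∈ ℕ ] Σ[ ns ∈ List ℕ ] Σ[ c ∈ Composes n (suc o ∷ ns) ] M.target o c [] ≡ a
    go {suc o ∷ ns} eq c = o , ns , c , entries-injective (trans (cong (suc o ∷_) (sizes-range ns)) eq)

  F-cong : ∀ {a b} {f g : Term a b} → f ≋ᴸ g → F f ≋ F g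
  F-cong {a} (L.rel r) = let o , ns , c , eq = source a in M.F-relation o c eq r
  F-cong L.≋-refl = ≋-refl
  F-cong (L.≋-sym e) = ≋-sym (F-cong e)
  F-cong (L.≋-trans e e′) = ≋-trans (F-cong e) (F-cong e′)
  F-cong (L.∘-cong e e′) = ⊙-cong (F-cong e) (F-cong e′)
  F-cong (L.∘-assoc f g h) = F-assoc f g h
  F-cong (L.identityˡ f) = F-identityˡ f
  F-cong (L.identityʳ f) = F-identityʳ f
  F-cong (L.⊕-cong e e′) = ⊕-cong (F-cong e) (F-cong e′)
  F-cong (L.⊖-cong e) = ⊖-cong (F-cong e)
  F-cong (L.⊕-assoc f g h) = ⊕-assoc (F f) (F g) (F h)
  F-cong (L.⊕-comm f g) = ⊕-comm (F f) (F g)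
  F-cong (L.⊕-identityˡ f) = ⊕-identityˡ (F f)
  F-cong (L.⊖-inverseˡ f) = ⊖-inverseˡ (F f)
  F-cong (L.distribˡ f g h) = ⊙-distribˡ (F f) (F g) (F h)
  F-cong (L.distribʳ h f g) = ≋-refl

  module Faithful (o : ℕ) {ns : List ℕ} (c : Composes n (suc o ∷ ns)) where

    open Blocks.Products 𝒲 o c using (k; product; product-conjugates; product-injective)
    open Monomials o c

    data MonomialSpan {b} : Term (target []) b → Set where
      monomialˢ : ∀ {w} → Reduced w → (q : target w ≡ b) → MonomialSpan (monomial w q)
      0ˢ        : MonomialSpan 0ᴸ
      _⊕ˢ_      : ∀ {f g} → MonomialSpan f → MonomialSpan g → MonomialSpan (f ⊕ᴸ g)
      ⊖ˢ_       : ∀ {f} → MonomialSpan f → MonomialSpan (⊖ᴸ f)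

    MonomialSpanned : ∀ {b} → Term (target []) b → Set
    MonomialSpanned f = ∃[ g ] f ≋ᴸ g × MonomialSpan g

    -- If the letter is a descent, Matsumoto's theorem moves a copy of it to the front of `w`, and
    -- the square relation kills the composite.
    edge-monomial : ∀ {i w b} → Reduced w → (e : target w ⟶[ i ] b) → MonomialSpanned (L.∂ i e ⊚ monomial w refl)
    edge-monomial {i} {w} r e with letter {w} e
    ... | s , s≡ with prepend {s} {w = w} s≡ e refl | ascent? (toℕ s) (isWindow w) (Fin.toℕ<n s)
    ...   | q , m | inj₁ a = monomial (s ∷ w) q , subst (_≋ᴸ monomial (s ∷ w) q) m L.≋-refl , monomialˢ (a ∷ r) q
    ...   | q , m | inj₂ d with reducedWord _ (act (toℕ s) (window w)) (act-window (toℕ s) (isWindow w)) refl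
    ...     | v , rv , v≡ = 0ᴸ , vanishes , 0ˢ
      where
      sv-window : window w ≡ window (s ∷ v)
      sv-window = sym (trans (cong (act (toℕ s)) v≡) (act-involutive (toℕ s) (window w)))
      w~sv : w ~ s ∷ v
      w~sv = matsumoto r (subst (Ascent (toℕ s)) (sym v≡) d ∷ rv) sv-window
      p : target (s ∷ v) ≡ target w
      p = target-cong {s ∷ v} {w} (sym sv-window)
      vanishes : L.∂ i e ⊚ monomial w refl ≋ᴸ 0ᴸ
      vanishes with prepend {s} {w = s ∷ v} s≡ e p
      ... | q′ , m′ = L.≋-trans (L.∘-cong L.≋-refl (monomial-cong w~sv refl p))
        (subst (_≋ᴸ 0ᴸ) m′ (square q′))
        where
        square : ∀ {b} (q : target (s ∷ s ∷ v) ≡ b) → monomial (s ∷ s ∷ v) q ≋ᴸ 0ᴸ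
        square refl = L.≋-trans (L.≋-sym (L.∘-assoc _ _ _))
          (L.≋-trans (L.∘-cong (L.rel (L.square (toℕ s) _ _)) L.≋-refl) (zeroˡ _))

    compose-span : ∀ {d b} (f : Term d b) {g} → MonomialSpan g → MonomialSpanned (f ⊚ g)
    compose-span (gen (i , e)) (monomialˢ r refl) = edge-monomial r e
    compose-span (gen e) 0ˢ = _ , zeroʳ (gen e) , 0ˢ
    compose-span (gen e) (_⊕ˢ_ {f} {g} sf sg) with compose-span (gen e) sf | compose-span (gen e) sg
    ... | _ , p , s | _ , p′ , s′ = _ , L.≋-trans (L.distribˡ (gen e) f g) (L.⊕-cong p p′) , s ⊕ˢ s′
    compose-span (gen e) (⊖ˢ_ {f} sf) with compose-span (gen e) sf
    ... | _ , p , s = _ , L.≋-trans (⊚-⊖ (gen e) f) (L.⊖-cong p) , ⊖ˢ s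
    compose-span id {g} s = g , L.identityˡ g , s
    compose-span (f ⊚ f′) {g} s with compose-span f′ s
    ... | _ , p , s′ with compose-span f s′
    ...   | _ , p′ , s″ = _ , L.≋-trans (L.∘-assoc f f′ g) (L.≋-trans (L.∘-cong L.≋-refl p) p′) , s″
    compose-span 0ᴸ {g} s = _ , zeroˡ g , 0ˢ
    compose-span (f ⊕ᴸ f′) {g} s with compose-span f s | compose-span f′ s
    ... | _ , p , t | _ , p′ , t′ = _ , L.≋-trans (L.distribʳ g f f′) (L.⊕-cong p p′) , t ⊕ˢ t′
    compose-span (⊖ᴸ f) {g} s with compose-span f s
    ... | _ , p , t = _ , L.≋-trans (⊖-⊚ f g) (L.⊖-cong p) , ⊖ˢ t

    -- `f` is composed with the identity, which is the monomial of the empty word.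
    spanned : ∀ {b} (f : Term (target []) b) → MonomialSpanned f
    spanned f with compose-span f (monomialˢ [] refl)
    ... | g , p , s = g , L.≋-trans (L.≋-sym (L.identityʳ f)) p , s

    module _ (b : Sequence n) where

      Represents : W → List (Fin k) → Set
      Represents p w = Tight w × entries (target w) ≡ entries b × product w ∼[ F₀ b , F₀ (target []) ] p

      represents? : ∀ p w → Dec (Represents p w)
      represents? p w = (length w ℕ.≟ inversions (window w))
        ×-dec (List.≡-dec ℕ._≟_ (entries (target w)) (entries b)) ×-dec (product w ∼? p)

      search : ∀ p → Dec (Any (Represents p) (words k (inversionsBound k)))
      search p = Any.any? (represents? p) (words k (inversionsBound k))

      found : ∀ {p w} → Represents p w → Any (Represents p) (words k (inversionsBound k))
      found {w = w} R@(t , _) = lose (∈-words w (inversionsBound k) (length-inversionsBound {w = w} t)) R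

      represented : ∀ {p} → ∃ (Represents p) → Term (target []) b
      represented (w , _ , eq , _) = monomial w (entries-injective eq)

      -- The linear left inverse of `F`. Its compatibility with `_≋_` takes the place of linear
      -- independence of the basis. A representing word is searched in a finite list that contains
      -- all reduced words; cosets without one go to zero.
      retract : Morphism (F₀ (target [])) (F₀ b) → Term (target []) b
      retract (∂ p) with search p
      ... | yes any = represented (Any.satisfied any)
      ... | no  _   = 0ᴸ
      retract 0#      = 0ᴸ
      retract (f ⊕ g) = retract f ⊕ᴸ retract g
      retract (⊖ f)   = ⊖ᴸ retract f

      target-conjugates : ∀ {w} → entries (target w) ≡ entries b → Conjugates (F₀ (target [])) (F₀ b) (product w)
      target-conjugates {w} eq = subst (λ xs → Conjugates (F₀ (target [])) (toSubset n xs) (product w)) eq (product-conjugates w)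

      -- One coset has one minimal element, this determines the window of the word, and reduced
      -- words with the same window have equal monomials by Matsumoto's theorem.
      represented-unique : ∀ {p p′} → p ∼[ F₀ b , F₀ (target []) ] p′ →
        (R : ∃ (Represents p)) (R′ : ∃ (Represents p′)) → represented R ≋ᴸ represented R′
      represented-unique pp (u , t , eq , u∼p) (w , t′ , eq′ , w∼p′) =
        monomial-cong (matsumoto (reduced u t) (reduced w t′) (product-injective {u} {w}
          (Conjugates-distinct (target-conjugates {u} eq) (target-conjugates {w} eq′) (∼-trans u∼p (∼-trans pp (∼-sym w∼p′))))))
          _ _

      retract-cong : ∀ {f g} → f ≋ g → retract f ≋ᴸ retract g
      retract-cong (∂-cong {p} {q} p∼q) with search p | search q
      ... | yes x | yes y = represented-unique p∼q (Any.satisfied x) (Any.satisfied y)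
      ... | yes x | no ¬y = let w , t , eq , w∼p = Any.satisfied x in
        contradiction (found {w = w} (t , eq , ∼-trans w∼p p∼q)) ¬y
      ... | no ¬x | yes y = let w , t , eq , w∼q = Any.satisfied y in
        contradiction (found {w = w} (t , eq , ∼-trans w∼q (∼-sym p∼q))) ¬x
      ... | no _  | no _  = L.≋-refl
      retract-cong ≋-refl = L.≋-refl
      retract-cong (≋-sym e) = L.≋-sym (retract-cong e)
      retract-cong (≋-trans e e′) = L.≋-trans (retract-cong e) (retract-cong e′)
      retract-cong (⊕-cong e e′) = L.⊕-cong (retract-cong e) (retract-cong e′)
      retract-cong (⊖-cong e) = L.⊖-cong (retract-cong e)
      retract-cong (⊕-assoc f g h) = L.⊕-assoc _ _ _
      retract-cong (⊕-comm f g) = L.⊕-comm _ _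
      retract-cong (⊕-identityˡ f) = L.⊕-identityˡ _
      retract-cong (⊖-inverseˡ f) = L.⊖-inverseˡ _

      retract-product : ∀ {w} → Tight w → (q : target w ≡ b) → retract (∂ (product w)) ≋ᴸ monomial w q
      retract-product {w} t refl with search (product w)
      ... | yes x = represented-unique (∼-reflexive ≈-refl) (Any.satisfied x) (w , t , refl , ∼-reflexive ≈-refl)
      ... | no ¬x = contradiction (found {w = w} (t , refl , ∼-reflexive ≈-refl)) ¬x

      retract-F : ∀ {f} → MonomialSpan f → retract (F f) ≋ᴸ f
      retract-F (monomialˢ {w} r q) = L.≋-trans (retract-cong (F-monomial r q)) (retract-product {w} (tight r) q)
      retract-F 0ˢ = L.≋-refl
      retract-F (s ⊕ˢ t) = L.⊕-cong (retract-F s) (retract-F t)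
      retract-F (⊖ˢ s) = L.⊖-cong (retract-F s)

    F-injective₀ : ∀ {a b} {f g : Term a b} → target [] ≡ a → F f ≋ F g → f ≋ᴸ g
    F-injective₀ {b = b} {f} {g} refl e with spanned f | spanned g
    ... | f′ , p , s | g′ , p′ , s′ = L.≋-trans p (L.≋-trans (L.≋-sym (retract-F b s))
      (L.≋-trans (retract-cong b (≋-trans (≋-sym (F-cong p)) (≋-trans e (F-cong p′))))
      (L.≋-trans (retract-F b s′) (L.≋-sym p′))))

  F-injective : ∀ {a b} {f g : Term a b} → F f ≋ F g → f ≋ᴸ g
  F-injective {a} e = let o , ns , c , eq = source a in Faithful.F-injective₀ o c eq e

  F₀-injective : ∀ {a b} → F₀ a ≡ F₀ b → a ≡ b
  F₀-injective {a} {b} eq = entries-injective (trans (sym (classSizes-toSubset (entries-composes a)))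
    (trans (cong classSizes eq) (classSizes-toSubset (entries-composes b))))

  object : Subset n → Sequence n
  object J = sequence (classSizes J) (classSizes-composes J)

  F₀-object : ∀ J → F₀ (object J) ≡ J
  F₀-object = toSubset-classSizes

  step-exists : ∀ (a : Sequence n) i → i < length (separators (F₀ a)) → ∃[ b ] a ⟶[ i ] b
  step-exists a i i< = go refl (entries-composes a)
    where
    go : ∀ {xs} → xs ≡ entries a → Composes n xs → ∃[ b ] a ⟶[ i ] b
    go {suc o ∷ ns} refl c = sequence (suc o ∷ stepSizes i ns) (composes-stepSizes i c)
      , step (stepSizes⇒Step i (ℕ.≤-trans i< (ℕ.≤-reflexive (ℕ.suc-injective (separators-length c)))))

  -- The index determines s and hence `M`; simple reflections are distinct in W, so t and the target
  -- are determined as well.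
  Atomic-unique : ∀ {J I I′ i p p′} → IsAtomic J i I p → IsAtomic J i I′ p′ → I ≡ I′ × p ∼[ I , J ] p′
  Atomic-unique {J} (d , refl , t , t≈ , refl , p∼) (d′ , d′≡ , t′ , t′≈ , I′≡ , p′∼) with Fin.toℕ-injective d′≡
  ... | refl with ⟦⟧-injective {t} {t′} (≈-trans t≈ (≈-sym t′≈)) | I′≡
  ...   | refl | refl = refl , ∼-trans p∼ (∼-sym p′∼)

  -- The intermediate object of a composite in `InAD` is an arbitrary subset and equals some `F₀ c`
  -- only propositionally, so both ends are generalised along equations. For a composite, `object J`
  -- is taken in the middle.
  F-surjective : ∀ {J I} {m : Morphism J I} → InAD m → ∀ a b (J≡ : F₀ a ≡ J) (I≡ : F₀ b ≡ I) →
    ∃[ f ] subst₂ Morphism J≡ I≡ (F {a} {b} f) ≋ m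
  F-surjective (atomic i {p} A@(d , d≡ , _)) a b refl refl
    with step-exists a i (subst (_< length (separators (F₀ a))) d≡ (Fin.toℕ<n d))
  ... | b′ , e with Atomic-unique (edge-atomic i e) A
  ...   | F₀b′≡ , x∼p with F₀-injective {b′} {b} F₀b′≡
  ...     | refl = gen (i , e) , ∂-cong x∼p
  F-surjective id∈ a b refl I≡ with F₀-injective {b} {a} I≡
  ... | refl with I≡
  ...   | refl = id , ≋-refl
  F-surjective (∘∈ {J = J} f∈ g∈) a b refl refl
    with F-surjective f∈ (object J) b (F₀-object J) refl | F-surjective g∈ a (object J) refl (F₀-object J)
  ... | f , p | g , q = f ⊚ g , ≋-trans (transport (F₀-object J) (F f) (F g)) (⊙-cong p q)
    where
    transport : ∀ {A B B′ D} (eq : B ≡ B′) (f : Morphism B D) (g : Morphism A B) →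
      f ⊙ g ≋ subst₂ Morphism eq refl f ⊙ subst₂ Morphism refl eq g
    transport refl f g = ≋-refl
  F-surjective 0∈ a b refl refl = 0ᴸ , ≋-refl
  F-surjective (⊕∈ f∈ g∈) a b refl refl with F-surjective f∈ a b refl refl | F-surjective g∈ a b refl refl
  ... | f , p | g , q = f ⊕ᴸ g , ⊕-cong p q
  F-surjective (⊖∈ f∈) a b refl refl with F-surjective f∈ a b refl refl
  ... | f , p = ⊖ᴸ f , ⊖-cong p
  F-surjective (resp e f∈) a b refl refl with F-surjective f∈ a b refl refl
  ... | f , p = f , ≋-trans p e

  ψ : LNC-B n ≅ 𝒜𝒟
  ψ = record
    { F₀ = F₀
    ; F₁ = λ f → F f , F-inAD f
    ; F₀-bijective = F₀-injective , λ J → object J , λ { refl → F₀-object J }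
    ; F₁-isGroupIsomorphism = λ {a} {b} → record
      { isGroupMonomorphism = record
        { isGroupHomomorphism = record
          { isMonoidHomomorphism = record
            { isMagmaHomomorphism = record
              { isRelHomomorphism = record { cong = F-cong }
              ; homo = λ _ _ → ≋-refl }
            ; ε-homo = ≋-refl }
          ; ⁻¹-homo = λ _ → ≋-refl }
        ; injective = F-injective }
      ; surjective = λ (m , m∈) → let f , p = F-surjective m∈ a b refl refl in
          f , λ e → ≋-trans (F-cong e) p }
    ; F₁-id = ≋-refl
    ; F₁-∘ = λ _ _ → ≋-refl
    }

  ψ-atomic : IsAtomicAssignment ψ
  ψ-atomic = (λ a → classSizes-toSubset (entries-composes a))
    , λ i e → edgeWord i e , edge-atomic i e , ≋-refl

proposition4p9 : (n : ℕ) →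
    CoxeterGroup.Calculus n ×
    ((𝒲 : CoxeterGroup.Calculus n) →
    ∃[ ψ ] Algebroid.IsAtomicAssignment 𝒲 ψ)
proposition4p9 n = Coxeter.calculus n , λ 𝒲 → Isomorphism.ψ 𝒲 , Isomorphism.ψ-atomic 𝒲
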